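{- For $n\ge1$ let $P_{n}^{(\mathrm{pk},\mathrm{ipk})}(s,t)=\sum_{\pi\in\mathfrak{S}_{n}}s^{\mathrm{pk}(\pi)+1}t^{\mathrm{ipk}(\pi)+1}$. Then: (a) As formal power series, \[ \frac{1}{(1-s)(1-t)}+\frac{1}{4}\sum_{n=1}^{\infty}\left(\frac{(1+s)(1+t)}{(1-s)(1-t)}\right)^{n+1}P_{n}^{(\mathrm{pk},\mathrm{ipk})}\left(\frac{4s}{(1+s)^{2}},\frac{4t}{(1+t)^{2}}\right)x^{n} =\sum_{i,j=0}^{\infty}\left(\frac{1+x}{1-x}\right)^{2ij}s^{i}t^{j}. \] (b) For all $n\geq1$, \[ \left(\frac{(1+s)(1+t)}{(1-s)(1-t)}\right)^{n+1}P_{n}^{(\mathrm{pk},\mathrm{ipk})}\left(\frac{4s}{(1+s)^{2}},\frac{4t}{(1+t)^{2}}\right) =4\sum_{i,j=0}^{\infty}\sum_{k=0}^{n}\binom{2ij}{k}\binom{2ij+n-k-1}{n-k}s^{i}t^{j}. \] (c) For all $n\geq1$, \[ \left(\frac{(1+s)(1+t)}{(1-s)(1-t)}\right)^{n+1}P_{n}^{(\mathrm{pk},\mathrm{ipk})}\left(\frac{4s}{(1+s)^{2}},\frac{4t}{(1+t)^{2}}\right) =\frac{1}{n!}\sum_{k=0}^n 4^{k+1}d(n,k)\frac{A_{k}(s)A_{k}(t)}{(1-s)^{k+1}(1-t)^{k+1}}. \]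
   Context: $\mathfrak{S}_n$ is the symmetric group on $[n]$. For $\pi\in\mathfrak{S}_n$, $i\in[n-1]$ is a descent if $\pi(i)>\pi(i+1)$ and $\mathrm{des}(\pi)$ is the number of descents; $i$ with $2\le i\le n-1$ is a peak if $\pi(i-1)<\pi(i)>\pi(i+1)$ and $\mathrm{pk}(\pi)$ is the number of peaks; $\mathrm{ipk}(\pi)=\mathrm{pk}(\pi^{ -1})$. The Eulerian polynomials are $A_n(t)=\sum_{\pi\in\mathfrak{S}_n}t^{\mathrm{des}(\pi)+1}$ for $n\ge1$ and $A_0(t)=1$. $d(n,k)$ denotes the number of permutations in $\mathfrak{S}_n$ with exactly $k$ cycles, all of odd length (with $d(0,0)=1$). -}

module Defs where

open import Data.Bool using (Bool; true; false; if_then_else_; _∧_; not)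
open import Data.Nat as ℕ using (ℕ; zero; suc; _∸_; _<ᵇ_; _≤ᵇ_; _≡ᵇ_)
open import Data.Nat.Properties using (_!≢0)
open import Data.Nat.Combinatorics using (_C_)
open import Data.Nat.Base using (_!)
open import Data.Integer using (+_)
open import Data.Rational using (ℚ; 0ℚ; 1ℚ; _+_; _*_; -_; _/_)
open import Data.Fin using (Fin; toℕ)
open import Data.List using (List; []; _∷_; map; foldr; filterᵇ; length; upTo; allFin; concatMap)
open import Data.Bool.ListAction using (and)
open import Data.Vec using (Vec; []; _∷_; toList)

ℕ→ℚ : ℕ → ℚ
ℕ→ℚ m = + m / 1

sumℚ : List ℚ → ℚ
sumℚ = foldr _+_ 0ℚ

Σ≤ : ℕ → (ℕ → ℚ) → ℚ
Σ≤ n f = sumℚ (map f (upTo (suc n)))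

-- Permutations of [n] in one-line notation (0-based values):
-- a word w ∈ Fin n ^ n with pairwise distinct letters.

allWords : (len n : ℕ) → List (Vec (Fin n) len)
allWords zero    n = [] ∷ []
allWords (suc l) n = concatMap (λ a → map (a ∷_) (allWords l n)) (allFin n)

notIn : ℕ → List ℕ → Bool
notIn a []       = true
notIn a (b ∷ bs) = not (a ≡ᵇ b) ∧ notIn a bs

distinct : List ℕ → Bool
distinct []       = true
distinct (a ∷ as) = notIn a as ∧ distinct as

word : ∀ {n} → Vec (Fin n) n → List ℕ
word w = map toℕ (toList w)

Perms : (n : ℕ) → List (Vec (Fin n) n)
Perms n = filterᵇ (λ w → distinct (word w)) (allWords n n)

desL : List ℕ → ℕ
desL (a ∷ b ∷ r) = (if b <ᵇ a then 1 else 0) ℕ.+ desL (b ∷ r)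
desL _           = 0

pkL : List ℕ → ℕ
pkL (a ∷ b ∷ c ∷ r) = (if (a <ᵇ b) ∧ (c <ᵇ b) then 1 else 0) ℕ.+ pkL (b ∷ c ∷ r)
pkL _               = 0

posOf : ℕ → List ℕ → ℕ
posOf v []       = 0
posOf v (a ∷ as) = if v ≡ᵇ a then 0 else suc (posOf v as)

invL : ℕ → List ℕ → List ℕ
invL n w = map (λ v → posOf v w) (upTo n)

des : ∀ {n} → Vec (Fin n) n → ℕ
des w = desL (word w)

pk : ∀ {n} → Vec (Fin n) n → ℕ
pk w = pkL (word w)

ipk : ∀ {n} → Vec (Fin n) n → ℕ
ipk {n} w = pkL (invL n (word w))

at : List ℕ → ℕ → ℕ
at []       i       = 0
at (a ∷ as) zero    = a
at (a ∷ as) (suc i) = at as i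

iter : (ℕ → ℕ) → ℕ → ℕ → ℕ
iter f zero    i = i
iter f (suc m) i = f (iter f m i)

firstSat : (ℕ → Bool) → List ℕ → ℕ
firstSat p []       = 0
firstSat p (m ∷ ms) = if p m then m else firstSat p ms

cycLen : ∀ {n} → Vec (Fin n) n → ℕ → ℕ
cycLen {n} w i = firstSat (λ m → iter (at (word w)) m i ≡ᵇ i) (map suc (upTo n))

isCycMin : ∀ {n} → Vec (Fin n) n → ℕ → Bool
isCycMin w i = and (map (λ m → i ≤ᵇ iter (at (word w)) m i) (upTo (cycLen w i)))

countB : List Bool → ℕ
countB []           = 0
countB (true ∷ bs)  = suc (countB bs)
countB (false ∷ bs) = countB bs

cyc : ∀ {n} → Vec (Fin n) n → ℕ
cyc {n} w = countB (map (isCycMin w) (upTo n))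

isOdd : ℕ → Bool
isOdd zero          = false
isOdd (suc zero)    = true
isOdd (suc (suc m)) = isOdd m

allCyclesOdd : ∀ {n} → Vec (Fin n) n → Bool
allCyclesOdd {n} w = and (map (λ i → isOdd (cycLen w i)) (upTo n))

d : ℕ → ℕ → ℕ
d n k = length (filterᵇ (λ w → allCyclesOdd w ∧ (cyc w ≡ᵇ k)) (Perms n))

-- Formal power series in one variable over ℚ (coefficient functions)

S1 : Set
S1 = ℕ → ℚ

c1 : ℚ → S1
c1 a zero    = a
c1 a (suc m) = 0ℚ

X : S1
X m = if m ≡ᵇ 1 then 1ℚ else 0ℚ

_⊕_ : S1 → S1 → S1
(f ⊕ g) m = f m + g m

_⊖_ : S1 → S1 → S1
(f ⊖ g) m = f m + (- g m)

_·₁_ : ℚ → S1 → S1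
(a ·₁ f) m = a * f m

_⊛_ : S1 → S1 → S1
(f ⊛ g) m = Σ≤ m (λ k → f k * g (m ∸ k))

_^₁_ : S1 → ℕ → S1
f ^₁ zero  = c1 1ℚ
f ^₁ suc k = f ⊛ (f ^₁ k)

Σ₁ : List S1 → S1
Σ₁ = foldr _⊕_ (c1 0ℚ)

-- Multiplicative inverse of a series with constant term 1:
-- g 0 = 1,  g m = - Σ_{k=1}^{m} f k · g (m-k).
-- invUpTo f m = [g m, g (m-1), …, g 0]
invUpTo : S1 → ℕ → List ℚ
invUpTo f zero    = 1ℚ ∷ []
invUpTo f (suc m) = (- step) ∷ prev
  where
    prev : List ℚ
    prev = invUpTo f m
    -- prev lists g m, …, g 0; pair g (m-j) with f (j+1)
    go : ℕ → List ℚ → ℚ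
    go j []       = 0ℚ
    go j (x ∷ xs) = f (suc j) * x + go (suc j) xs
    step : ℚ
    step = go 0 prev

headℚ : List ℚ → ℚ
headℚ []      = 0ℚ
headℚ (x ∷ _) = x

inv : S1 → S1
inv f m = headℚ (invUpTo f m)

S2 : Set
S2 = ℕ → ℕ → ℚ          -- f i j = coefficient of s^i t^j

c2 : ℚ → S2
c2 a i j = c1 a i * c1 1ℚ j

_⊗_ : S1 → S1 → S2
(f ⊗ g) i j = f i * g j

_⊕₂_ : S2 → S2 → S2
(f ⊕₂ g) i j = f i j + g i j

_·₂_ : ℚ → S2 → S2
(a ·₂ f) i j = a * f i j

_⊛₂_ : S2 → S2 → S2
(f ⊛₂ g) i j = Σ≤ i (λ a → Σ≤ j (λ b → f a b * g (i ∸ a) (j ∸ b)))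

_^₂_ : S2 → ℕ → S2
f ^₂ zero  = c2 1ℚ
f ^₂ suc k = f ⊛₂ (f ^₂ k)

Σ₂ : List S2 → S2
Σ₂ = foldr _⊕₂_ (c2 0ℚ)

-- P_n^{(pk,ipk)}(u,v) = Σ_{π∈𝔖_n} u^{pk π+1} v^{ipk π+1}, evaluated at
-- u = u(s), v = v(t) (u,v one-variable series); P n X X is the polynomial.
P : ℕ → S1 → S1 → S2
P n u v = Σ₂ (map (λ w → (u ^₁ suc (pk w)) ⊗ (v ^₁ suc (ipk w))) (Perms n))

A : ℕ → S1
A zero    = c1 1ℚ
A (suc k) = Σ₁ (map (λ w → X ^₁ suc (des w)) (Perms (suc k)))

four : ℚ
four = ℕ→ℚ 4

one : S1
one = c1 1ℚ

U : S1
U = (four ·₁ X) ⊛ inv ((one ⊕ X) ^₁ 2)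

R : S1
R = (one ⊕ X) ⊛ inv (one ⊖ X)

F : ℕ → S2
F n = ((R ⊗ R) ^₂ suc n) ⊛₂ P n U U

-- (b) right-hand side: 4 Σ_{i,j} Σ_{k=0}^n C(2ij,k) C(2ij+n-k-1,n-k) s^i t^j
-- (natural-number subtraction; the only truncated case is 2ij=0, k=n,
--  where the factor C(0,n) = 0 for n ≥ 1)
RHSb : ℕ → S2
RHSb n i j = four * Σ≤ n (λ k →
  ℕ→ℚ (((2 ℕ.* i ℕ.* j) C k) ℕ.* (((2 ℕ.* i ℕ.* j ℕ.+ (n ∸ k)) ∸ 1) C (n ∸ k))))

RHSc : ℕ → S2
RHSc n = (((+ 1) / (n !)) {{n !≢0}}) ·₂
  Σ₂ (map (λ k → ℕ→ℚ ((4 ℕ.^ suc k) ℕ.* d n k) ·₂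
                 ((A k ⊛ inv ((one ⊖ X) ^₁ suc k)) ⊗ (A k ⊛ inv ((one ⊖ X) ^₁ suc k))))
          (upTo (suc n)))

-- (a) Three-variable series in x, s, t, written as ℕ → S2
-- (the coefficient of x^n is a series in s,t).
S3 : Set
S3 = ℕ → S2

LHSa : S3
LHSa zero    = inv (one ⊖ X) ⊗ inv (one ⊖ X)
LHSa (suc n) = ((+ 1) / 4) ·₂ F (suc n)

RHSa : S3
RHSa n i j = (R ^₁ (2 ℕ.* i ℕ.* j)) n

{-# OPTIONS --safe #-}
module Submission where

-- Attach to a pattern of ascents and descents the weakly decreasing sequences of letters that lie over it, where an even
-- letter may be repeated only over ascents and an odd letter only over descents (Stembridge's enriched P-partitions).
-- With 2i letters their number depends on the pattern of π only through pk π: its generating function in s^i is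
-- 1/2 ((1+s)/(1-s))^(n+1) (4s/(1+s)²)^(pk π + 1).  Hence the coefficient of s^i t^j in F n is 4 times the number of triples
-- (π , f , g) with f over π and g over π⁻¹.  Standardization turns (π , g) into an arbitrary word v = g ∘ π on 2j letters
-- with the same pattern as π, and the pairs (f , v) are the weakly decreasing chains of n elements in a linear order on
-- 2i · 2j pairs of letters, half of which may be repeated.  They are counted by ((1+x)/(1-x))^(2ij).
--
-- Letters that may all be repeated over ascents give Σ_i i^k s^i = A_k(s)/(1-s)^(k+1) in the same way.  For (c), removing the
-- successor of 0 from its cycle changes the parity of that cycle only, so that D_n(y) = Σ_k d(n,k) y^k satisfies
-- D_(n+2) = y D_(n+1) + (n+1) n D_n, which is the recurrence of n! [x^n] ((1+x)/(1-x))^(y/2).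

open import Defs
open import Algebra.Bundles using (CommutativeMonoid)
import Algebra.Solver.CommutativeMonoid as CMSolver
open import Data.Bool as Bool using (Bool; true; false; if_then_else_; _∧_; _∨_; not)
open import Data.Bool.ListAction using (and)
open import Data.Bool.Properties using (∧-assoc; ∧-comm; ∧-idem; ∧-zeroʳ; not-involutive)
open import Data.Fin as Fin using (Fin; toℕ)
import Data.Fin.Properties as FinP
open import Data.Integer as ℤ using () renaming (+_ to pos)
import Data.Integer.Properties as ℤP
open import Data.List using (List; []; _∷_; map; filterᵇ; length; upTo; allFin; concatMap; _++_; tabulate; applyUpTo)
open import Data.List.Membership.Propositional using (_∈_)
open import Data.List.Membership.Propositional.Properties using (∈-upTo⁺; ∈-upTo⁻)
open import Data.List.Properties using (map-∘; map-cong; map-cong-local; map-upTo; map-applyUpTo; map-tabulate; length-upTo; length-map; length-++)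
open import Data.List.Relation.Binary.Permutation.Propositional using (_↭_; ↭-refl; ↭-sym; ↭-trans; ↭-reflexive; prep; swap; ↭⇒↭ₛ)
open import Data.List.Relation.Binary.Permutation.Propositional.Properties using (↭-length; ∈-resp-↭; map⁺)
import Data.List.Relation.Binary.Permutation.Setoid.Properties as PermS
open import Data.List.Relation.Unary.All as All using (All; []; _∷_)
import Data.List.Relation.Unary.All.Properties as AllP
open import Data.List.Relation.Unary.AllPairs as AllPairs using ([]; _∷_)
import Data.List.Relation.Unary.AllPairs.Properties as AllPairsP
open import Data.List.Relation.Unary.Any using (here; there)
open import Data.List.Relation.Unary.Unique.Propositional using (Unique)
open import Data.List.Relation.Unary.Unique.Propositional.Properties using (upTo⁺)
open import Data.Nat using (ℕ; zero; suc; _+_; _*_; _∸_; _^_; _!; _≤_; _<_; z≤n; s≤s; _<ᵇ_; _≤ᵇ_; _≡ᵇ_; NonZero)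
open import Data.Nat.Combinatorics using (_C_; nCk+nC[k+1]≡[n+1]C[k+1]; k>n⇒nCk≡0)
open import Data.Nat.Properties
open import Algebra.Properties.CommutativeSemigroup +-commutativeSemigroup using () renaming (interchange to +-interchange)
open import Data.Nat.Solver using () renaming (module +-*-Solver to ℕS)
open import Data.Product using (_×_; _,_; proj₁; proj₂; ∃)
open import Data.Rational as ℚ using (ℚ; 0ℚ; 1ℚ)
import Data.Rational.Properties as ℚP
open import Data.Rational.Properties using (toℚᵘ-injective; toℚᵘ-homo-+; toℚᵘ-homo-*; toℚᵘ-fromℚᵘ)
open import Data.Rational.Solver using () renaming (module +-*-Solver to ℚS)
import Data.Rational.Unnormalised as ℚᵘ
import Data.Rational.Unnormalised.Properties as ℚᵘP
open import Data.Sum using (inj₁; inj₂)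
open import Data.Unit using (tt)
open import Data.Vec using (Vec; []; _∷_; toList)
open import Function using (_∘_; id)
open import Level using (0ℓ)
open import Relation.Binary.Definitions using (tri<; tri≈; tri>)
open import Relation.Binary.PropositionalEquality
open import Relation.Nullary using (contradiction; yes; no)
open ≡-Reasoning

-- All three parts follow from one identity: for n ≥ 1 the coefficient of s^i t^j in `F n` is 4
-- [x^n] R^(2ij) (`F-closed`). Part (a) divides by 4, part (b) expands R^m = (1+x)^m (1-x)^(-m), and
-- part (c) takes y = 4ij, so that y^k = 4^k i^k j^k splits into coefficients of the two Eulerian
-- series. The obstacle is that π and its inverse occur together. It is overcome by one remark:
-- prefixing a letter a to a permutation inserts a new minimum into its inverse, at index a. A
-- letter x, in turn, can enter a compatible sequence at exactly one index, provided that the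
-- pattern below the sequence changes as it does under insertion of a minimum. So the choice of a
-- first letter a together with a sequence over the longer inverse amounts to the choice of any
-- letter x together with a sequence over the shorter one. This makes standardization an induction
-- on n between sums of natural numbers, with no bijection written down. The same insertion, applied
-- to π itself, gives the power i^k behind the Eulerian polynomials.

⟦_⟧ : Bool → ℕ
⟦ true ⟧  = 1
⟦ false ⟧ = 0

-- Finite sums of natural numbers

Σ< : ℕ → (ℕ → ℕ) → ℕ
Σ< zero    f = 0
Σ< (suc n) f = Σ< n f + f n

Σ<-cong : ∀ n {f g : ℕ → ℕ} → (∀ i → i < n → f i ≡ g i) → Σ< n f ≡ Σ< n g
Σ<-cong zero    h = refl
Σ<-cong (suc n) h = cong₂ _+_ (Σ<-cong n (λ i i<n → h i (m<n⇒m<1+n i<n))) (h n (n<1+n n))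

Σ<-cong′ : ∀ n {f g : ℕ → ℕ} → (∀ i → f i ≡ g i) → Σ< n f ≡ Σ< n g
Σ<-cong′ n h = Σ<-cong n (λ i _ → h i)

Σ<-cons : ∀ n (f : ℕ → ℕ) → Σ< (suc n) f ≡ f 0 + Σ< n (f ∘ suc)
Σ<-cons zero    f = +-comm 0 (f 0)
Σ<-cons (suc n) f = trans (cong (_+ f (suc n)) (Σ<-cons n f)) (+-assoc (f 0) _ _)

Σ<-+ : ∀ n (f g : ℕ → ℕ) → Σ< n (λ i → f i + g i) ≡ Σ< n f + Σ< n g
Σ<-+ zero    f g = refl
Σ<-+ (suc n) f g = trans (cong (_+ (f n + g n)) (Σ<-+ n f g)) (+-interchange (Σ< n f) (Σ< n g) (f n) (g n))

Σ<-* : ∀ n k (f : ℕ → ℕ) → Σ< n (λ i → k * f i) ≡ k * Σ< n f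
Σ<-* zero    k f = sym (*-zeroʳ k)
Σ<-* (suc n) k f = trans (cong (_+ k * f n) (Σ<-* n k f)) (sym (*-distribˡ-+ k (Σ< n f) (f n)))

Σ<-const : ∀ n k → Σ< n (λ _ → k) ≡ n * k
Σ<-const zero    k = refl
Σ<-const (suc n) k = trans (cong (_+ k) (Σ<-const n k)) (+-comm (n * k) k)

Σ<-zero : ∀ n → Σ< n (λ _ → 0) ≡ 0
Σ<-zero n = trans (Σ<-const n 0) (*-zeroʳ n)

Σ<-swap : ∀ m n (f : ℕ → ℕ → ℕ) → Σ< m (λ i → Σ< n (f i)) ≡ Σ< n (λ j → Σ< m (λ i → f i j))
Σ<-swap zero    n f = sym (Σ<-zero n)
Σ<-swap (suc m) n f =
  trans (cong (_+ Σ< n (f m)) (Σ<-swap m n f)) (sym (Σ<-+ n (λ j → Σ< m (λ i → f i j)) (f m)))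

Σ<-reverse : ∀ n (f : ℕ → ℕ) → Σ< n f ≡ Σ< n (λ i → f (n ∸ suc i))
Σ<-reverse zero    f = refl
Σ<-reverse (suc n) f = begin
  Σ< n f + f n                          ≡⟨ +-comm (Σ< n f) (f n) ⟩
  f n + Σ< n f                          ≡⟨ cong (f n +_) (Σ<-reverse n f) ⟩
  f n + Σ< n (λ i → f (n ∸ suc i))      ≡⟨ sym (Σ<-cons n (λ i → f (n ∸ i))) ⟩
  Σ< (suc n) (λ i → f (n ∸ i))          ∎

ΣL : {A : Set} → List A → (A → ℕ) → ℕ
ΣL []       f = 0
ΣL (x ∷ xs) f = f x + ΣL xs f

module _ {A : Set} where

  ΣL-cong : {f g : A → ℕ} (xs : List A) → (∀ x → f x ≡ g x) → ΣL xs f ≡ ΣL xs g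
  ΣL-cong []       h = refl
  ΣL-cong (x ∷ xs) h = cong₂ _+_ (h x) (ΣL-cong xs h)

  ΣL-congAll : {f g : A → ℕ} {xs : List A} → All (λ x → f x ≡ g x) xs → ΣL xs f ≡ ΣL xs g
  ΣL-congAll []       = refl
  ΣL-congAll (p ∷ ps) = cong₂ _+_ p (ΣL-congAll ps)

  ΣL-++ : (xs ys : List A) (f : A → ℕ) → ΣL (xs ++ ys) f ≡ ΣL xs f + ΣL ys f
  ΣL-++ []       ys f = refl
  ΣL-++ (x ∷ xs) ys f = trans (cong (f x +_) (ΣL-++ xs ys f)) (sym (+-assoc (f x) _ _))

  ΣL-+ : (xs : List A) (f g : A → ℕ) → ΣL xs (λ x → f x + g x) ≡ ΣL xs f + ΣL xs g
  ΣL-+ []       f g = refl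
  ΣL-+ (x ∷ xs) f g = trans (cong (f x + g x +_) (ΣL-+ xs f g)) (+-interchange (f x) (g x) _ _)

  ΣL-* : (xs : List A) (k : ℕ) (f : A → ℕ) → ΣL xs (λ x → k * f x) ≡ k * ΣL xs f
  ΣL-* []       k f = sym (*-zeroʳ k)
  ΣL-* (x ∷ xs) k f = trans (cong (k * f x +_) (ΣL-* xs k f)) (sym (*-distribˡ-+ k (f x) _))

  ΣL-filterᵇ : (p : A → Bool) (xs : List A) (f : A → ℕ) → ΣL (filterᵇ p xs) f ≡ ΣL xs (λ x → ⟦ p x ⟧ * f x)
  ΣL-filterᵇ p []       f = refl
  ΣL-filterᵇ p (x ∷ xs) f with p x
  ... | true  = cong₂ _+_ (sym (*-identityˡ (f x))) (ΣL-filterᵇ p xs f)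
  ... | false = ΣL-filterᵇ p xs f

  length-ΣL : (xs : List A) → length xs ≡ ΣL xs (λ _ → 1)
  length-ΣL []       = refl
  length-ΣL (x ∷ xs) = cong suc (length-ΣL xs)

  ΣL-↭ : {xs ys : List A} (f : A → ℕ) → xs ↭ ys → ΣL xs f ≡ ΣL ys f
  ΣL-↭ f _↭_.refl         = refl
  ΣL-↭ f (prep x p)       = cong (f x +_) (ΣL-↭ f p)
  ΣL-↭ {ys = y ∷ x ∷ ys} f (swap x y p) = trans (cong (λ z → f x + (f y + z)) (ΣL-↭ f p))
    (trans (sym (+-assoc (f x) (f y) _)) (trans (cong (_+ ΣL ys f) (+-comm (f x) (f y))) (+-assoc (f y) (f x) _)))
  ΣL-↭ f (_↭_.trans p q)  = trans (ΣL-↭ f p) (ΣL-↭ f q)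

ΣL-map : {A B : Set} (g : A → B) (xs : List A) (f : B → ℕ) → ΣL (map g xs) f ≡ ΣL xs (f ∘ g)
ΣL-map g []       f = refl
ΣL-map g (x ∷ xs) f = cong (f (g x) +_) (ΣL-map g xs f)

ΣL-concatMap : {A B : Set} (g : A → List B) (xs : List A) (f : B → ℕ) →
  ΣL (concatMap g xs) f ≡ ΣL xs (λ x → ΣL (g x) f)
ΣL-concatMap g []       f = refl
ΣL-concatMap g (x ∷ xs) f = trans (ΣL-++ (g x) (concatMap g xs) f) (cong (ΣL (g x) f +_) (ΣL-concatMap g xs f))

-- Sums over arrangements of letters

sel : {A : Set} → List A → List (A × List A)
sel []       = []
sel (x ∷ xs) = (x , xs) ∷ map (λ p → proj₁ p , x ∷ proj₂ p) (sel xs)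

-- ΣA l L Φ is the sum of Φ over all arrangements of l letters of L.
ΣA : {A : Set} → ℕ → List A → (List A → ℕ) → ℕ
ΣA zero    L Φ = Φ []
ΣA (suc l) L Φ = ΣL (sel L) (λ p → ΣA l (proj₂ p) (λ w → Φ (proj₁ p ∷ w)))

module _ {A : Set} where

  ΣL-sel₁ : (L : List A) (f : A → ℕ) → ΣL (sel L) (f ∘ proj₁) ≡ ΣL L f
  ΣL-sel₁ []      f = refl
  ΣL-sel₁ (x ∷ L) f = cong (f x +_) (trans (ΣL-map _ (sel L) _) (ΣL-sel₁ L f))

  sel-↭ : (L : List A) → All (λ p → proj₁ p ∷ proj₂ p ↭ L) (sel L)
  sel-↭ []      = []
  sel-↭ (x ∷ L) = ↭-refl ∷ AllP.map⁺ (All.map (λ {p} r → ↭-trans (swap (proj₁ p) x ↭-refl) (prep x r)) (sel-↭ L))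

  ΣA-cong : ∀ l (L : List A) {Φ Ψ : List A → ℕ} → l ≡ length L → (∀ w → w ↭ L → Φ w ≡ Ψ w) → ΣA l L Φ ≡ ΣA l L Ψ
  ΣA-cong zero    [] e h = h [] ↭-refl
  ΣA-cong (suc l) L  e h = ΣL-congAll (All.map step (sel-↭ L))
    where
    step : ∀ {p} → proj₁ p ∷ proj₂ p ↭ L → _
    step {p} r = ΣA-cong l (proj₂ p) (suc-injective (trans e (sym (↭-length r)))) (λ w s → h _ (↭-trans (prep (proj₁ p) s) r))

  ΣA-cong′ : ∀ l (L : List A) {Φ Ψ : List A → ℕ} → (∀ w → Φ w ≡ Ψ w) → ΣA l L Φ ≡ ΣA l L Ψ
  ΣA-cong′ zero    L h = h []
  ΣA-cong′ (suc l) L h = ΣL-cong (sel L) (λ p → ΣA-cong′ l (proj₂ p) (λ w → h _))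

  ΣA-+ : ∀ l (L : List A) (Φ Ψ : List A → ℕ) → ΣA l L (λ w → Φ w + Ψ w) ≡ ΣA l L Φ + ΣA l L Ψ
  ΣA-+ zero    L Φ Ψ = refl
  ΣA-+ (suc l) L Φ Ψ = trans (ΣL-cong (sel L) (λ p → ΣA-+ l (proj₂ p) _ _)) (ΣL-+ (sel L) _ _)

  ΣA-* : ∀ l (L : List A) k (Φ : List A → ℕ) → ΣA l L (λ w → k * Φ w) ≡ k * ΣA l L Φ
  ΣA-* zero    L k Φ = refl
  ΣA-* (suc l) L k Φ = trans (ΣL-cong (sel L) (λ p → ΣA-* l (proj₂ p) k _)) (ΣL-* (sel L) k _)

  ΣA-zero : ∀ l (L : List A) → ΣA l L (λ _ → 0) ≡ 0
  ΣA-zero l L = ΣA-* l L 0 (λ _ → 0)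

  ΣA-Σ< : ∀ l (L : List A) n (f : List A → ℕ → ℕ) → ΣA l L (λ w → Σ< n (f w)) ≡ Σ< n (λ i → ΣA l L (λ w → f w i))
  ΣA-Σ< l L zero    f = ΣA-zero l L
  ΣA-Σ< l L (suc n) f = trans (ΣA-+ l L _ _) (cong (_+ ΣA l L (λ w → f w n)) (ΣA-Σ< l L n f))

  -- Two letters taken out leave the same rest in either order. This is the transposition from which
  -- `ΣA-moveHead` is composed.
  ΣL-sel² : (L : List A) (h : A → A → List A → ℕ) →
    ΣL (sel L) (λ p → ΣL (sel (proj₂ p)) (λ r → h (proj₁ p) (proj₁ r) (proj₂ r))) ≡
    ΣL (sel L) (λ p → ΣL (sel (proj₂ p)) (λ r → h (proj₁ r) (proj₁ p) (proj₂ r)))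
  ΣL-sel² []      h = refl
  ΣL-sel² (x ∷ L) h = begin
    a + ΣL (map push (sel L)) (λ p → ΣL (sel (proj₂ p)) (λ r → h (proj₁ p) (proj₁ r) (proj₂ r)))
      ≡⟨ cong (a +_) (expand h) ⟩
    a + (b + ΣL (sel L) (λ p → ΣL (sel (proj₂ p)) (λ r → h′ (proj₁ p) (proj₁ r) (proj₂ r))))
      ≡⟨ cong (λ z → a + (b + z)) (ΣL-sel² L h′) ⟩
    a + (b + c)
      ≡⟨ trans (sym (+-assoc a b c)) (trans (cong (_+ c) (+-comm a b)) (+-assoc b a c)) ⟩
    b + (a + c)
      ≡⟨ cong (b +_) (sym (expand (λ y z → h z y))) ⟩
    b + ΣL (map push (sel L)) (λ p → ΣL (sel (proj₂ p)) (λ r → h (proj₁ r) (proj₁ p) (proj₂ r))) ∎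
    where
    push : A × List A → A × List A
    push p = proj₁ p , x ∷ proj₂ p
    h′ : A → A → List A → ℕ
    h′ y z zs = h y z (x ∷ zs)
    a = ΣL (sel L) (λ r → h x (proj₁ r) (proj₂ r))
    b = ΣL (sel L) (λ r → h (proj₁ r) x (proj₂ r))
    c = ΣL (sel L) (λ p → ΣL (sel (proj₂ p)) (λ r → h′ (proj₁ r) (proj₁ p) (proj₂ r)))
    expand : (k : A → A → List A → ℕ) →
      ΣL (map push (sel L)) (λ p → ΣL (sel (proj₂ p)) (λ r → k (proj₁ p) (proj₁ r) (proj₂ r))) ≡
      ΣL (sel L) (λ p → k (proj₁ p) x (proj₂ p)) +
      ΣL (sel L) (λ p → ΣL (sel (proj₂ p)) (λ r → k (proj₁ p) (proj₁ r) (x ∷ proj₂ r)))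
    expand k = trans (ΣL-map push (sel L) _) (trans (ΣL-cong (sel L) (λ p → cong (k (proj₁ p) x (proj₂ p) +_) (ΣL-map push (sel (proj₂ p)) _))) (ΣL-+ (sel L) _ _))

ΣA-map : {A B : Set} (f : A → B) → ∀ l (L : List A) (Φ : List B → ℕ) → ΣA l (map f L) Φ ≡ ΣA l L (Φ ∘ map f)
ΣA-map f zero    L Φ = refl
ΣA-map f (suc l) L Φ = trans (go L (λ y ys → ΣA l ys (λ w → Φ (y ∷ w))))
  (ΣL-cong (sel L) (λ p → ΣA-map f l (proj₂ p) _))
  where
  go : ∀ L (h : _ → List _ → ℕ) → ΣL (sel (map f L)) (λ p → h (proj₁ p) (proj₂ p)) ≡ ΣL (sel L) (λ p → h (f (proj₁ p)) (map f (proj₂ p)))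
  go []      h = refl
  go (x ∷ L) h = cong (h (f x) (map f L) +_) (trans (ΣL-map _ (sel (map f L)) _)
    (trans (go L (λ y ys → h y (f x ∷ ys))) (sym (ΣL-map _ (sel L) _))))

ins : {A : Set} → ℕ → A → List A → List A
ins zero    x ys       = x ∷ ys
ins (suc k) x []       = x ∷ []
ins (suc k) x (y ∷ ys) = y ∷ ins k x ys

map-ins : {A B : Set} (f : A → B) → ∀ k x ys → map f (ins k x ys) ≡ ins k (f x) (map f ys)
map-ins f zero    x ys       = refl
map-ins f (suc k) x []       = refl
map-ins f (suc k) x (y ∷ ys) = cong (f y ∷_) (map-ins f k x ys)

moveHead : {A : Set} → ℕ → List A → List A
moveHead k []       = []
moveHead k (x ∷ xs) = ins k x xs

-- Moving the head to index k is a fixed permutation of positions. It is a product of adjacent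
-- transpositions: `ΣL-sel²` exchanges the first two letters, and a move by one step less remains in
-- the tail.
ΣA-moveHead : {A : Set} → ∀ k l (L : List A) (Φ : List A → ℕ) → l ≡ length L → ΣA l L (Φ ∘ moveHead k) ≡ ΣA l L Φ
ΣA-moveHead zero    zero    L Φ e = refl
ΣA-moveHead zero    (suc l) L Φ e = refl
ΣA-moveHead (suc k) zero    L Φ e = refl
ΣA-moveHead (suc k) (suc zero) L Φ e = refl
ΣA-moveHead (suc k) (suc (suc l)) L Φ e = begin
  ΣA (suc (suc l)) L (Φ ∘ moveHead (suc k))
    ≡⟨ ΣL-sel² L (λ x y zs → ΣA l zs (λ w → Φ (y ∷ ins k x w))) ⟩
  ΣL (sel L) (λ p → ΣA (suc l) (proj₂ p) (λ w → Φ (proj₁ p ∷ moveHead k w)))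
    ≡⟨ ΣL-congAll (All.map (λ {p} r → ΣA-moveHead k (suc l) (proj₂ p) (λ w → Φ (proj₁ p ∷ w)) (suc-injective (trans e (sym (↭-length r))))) (sel-↭ L)) ⟩
  ΣA (suc (suc l)) L Φ ∎

-- Permutations of 0 … n-1 as words

ΣS : ℕ → (List ℕ → ℕ) → ℕ
ΣS n Φ = ΣA n (upTo n) Φ

punchIn : ℕ → ℕ → ℕ
punchIn zero    x       = suc x
punchIn (suc a) zero    = zero
punchIn (suc a) (suc x) = suc (punchIn a x)

upTo-suc : ∀ n → upTo (suc n) ≡ 0 ∷ map suc (upTo n)
upTo-suc n = cong (0 ∷_) (sym (map-upTo suc n))

ΣS-cong : ∀ n {Φ Ψ : List ℕ → ℕ} → (∀ w → w ↭ upTo n → Φ w ≡ Ψ w) → ΣS n Φ ≡ ΣS n Ψ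
ΣS-cong n = ΣA-cong n (upTo n) (sym (length-upTo n))

ΣS-first : ∀ n (Φ : List ℕ → ℕ) → ΣS (suc n) Φ ≡ Σ< (suc n) (λ a → ΣS n (λ σ → Φ (a ∷ map (punchIn a) σ)))
ΣS-first n Φ = trans (go n (λ a L → ΣA n L (λ w → Φ (a ∷ w))))
  (Σ<-cong′ (suc n) (λ a → ΣA-map (punchIn a) n (upTo n) _))
  where
  sel-suc : ∀ L (h : ℕ → List ℕ → ℕ) → ΣL (sel (map suc L)) (λ p → h (proj₁ p) (proj₂ p)) ≡ ΣL (sel L) (λ p → h (suc (proj₁ p)) (map suc (proj₂ p)))
  sel-suc []      h = refl
  sel-suc (x ∷ L) h = cong (h (suc x) (map suc L) +_) (trans (ΣL-map _ (sel (map suc L)) _)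
    (trans (sel-suc L (λ y ys → h y (suc x ∷ ys))) (sym (ΣL-map _ (sel L) _))))
  go : ∀ n (h : ℕ → List ℕ → ℕ) → ΣL (sel (upTo (suc n))) (λ p → h (proj₁ p) (proj₂ p)) ≡ Σ< (suc n) (λ a → h a (map (punchIn a) (upTo n)))
  go zero    h = +-identityʳ _
  go (suc n) h = begin
    ΣL (sel (upTo (suc (suc n)))) (λ p → h (proj₁ p) (proj₂ p))
      ≡⟨ cong (λ L → ΣL (sel L) (λ p → h (proj₁ p) (proj₂ p))) (upTo-suc (suc n)) ⟩
    h 0 (map suc (upTo (suc n))) + ΣL (map _ (sel (map suc (upTo (suc n))))) (λ p → h (proj₁ p) (proj₂ p))
      ≡⟨ cong (h 0 (map suc (upTo (suc n))) +_) (trans (ΣL-map _ (sel (map suc (upTo (suc n)))) _) (sel-suc (upTo (suc n)) (λ y ys → h y (0 ∷ ys)))) ⟩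
    h 0 (map suc (upTo (suc n))) + ΣL (sel (upTo (suc n))) (λ p → h (suc (proj₁ p)) (0 ∷ map suc (proj₂ p)))
      ≡⟨ cong (h 0 (map suc (upTo (suc n))) +_) (trans (go n (λ a L → h (suc a) (0 ∷ map suc L))) (Σ<-cong′ (suc n) (λ a → cong (h (suc a)) (shape a)))) ⟩
    h 0 (map suc (upTo (suc n))) + Σ< (suc n) (λ a → h (suc a) (map (punchIn (suc a)) (upTo (suc n))))
      ≡⟨ sym (Σ<-cons (suc n) (λ a → h a (map (punchIn a) (upTo (suc n))))) ⟩
    Σ< (suc (suc n)) (λ a → h a (map (punchIn a) (upTo (suc n)))) ∎
    where
    shape : ∀ a → 0 ∷ map suc (map (punchIn a) (upTo n)) ≡ map (punchIn (suc a)) (upTo (suc n))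
    shape a = sym (trans (cong (map (punchIn (suc a))) (upTo-suc n))
      (cong (0 ∷_) (trans (sym (map-∘ (upTo n))) (map-∘ (upTo n)))))

-- The dual of `ΣS-first`: here the letter 0 is split off by its index. Either 0 comes first, or the
-- first letter `suc a` is set aside and the induction applies to the rest, where `punchIn (suc a)`
-- leaves 0 in place.
ΣS-insert : ∀ n (Φ : List ℕ → ℕ) → ΣS (suc n) Φ ≡ ΣS n (λ σ → Σ< (suc n) (λ k → Φ (ins k 0 (map suc σ))))
ΣS-insert zero    Φ = +-identityʳ _
ΣS-insert (suc n) Φ = begin
  ΣS (suc (suc n)) Φ
    ≡⟨ trans (ΣS-first (suc n) Φ) (Σ<-cons (suc n) _) ⟩
  ΣS (suc n) (λ σ → Φ (0 ∷ map suc σ)) + Σ< (suc n) (λ a → ΣS (suc n) (λ σ → Φ (suc a ∷ map (punchIn (suc a)) σ)))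
    ≡⟨ cong (ΣS (suc n) (λ σ → Φ (0 ∷ map suc σ)) +_) (Σ<-cong′ (suc n) rest) ⟩
  ΣS (suc n) (λ σ → Φ (0 ∷ map suc σ)) + Σ< (suc n) (λ a → ΣS n (λ σ → Ψ (a ∷ map (punchIn a) σ)))
    ≡⟨ cong (ΣS (suc n) (λ σ → Φ (0 ∷ map suc σ)) +_) (sym (ΣS-first n Ψ)) ⟩
  ΣS (suc n) (λ σ → Φ (0 ∷ map suc σ)) + ΣS (suc n) Ψ
    ≡⟨ sym (ΣA-+ (suc n) (upTo (suc n)) (λ σ → Φ (0 ∷ map suc σ)) Ψ) ⟩
  ΣS (suc n) (λ σ → Φ (0 ∷ map suc σ) + Ψ σ)
    ≡⟨ ΣA-cong′ (suc n) (upTo (suc n)) (λ σ → sym (Σ<-cons (suc n) (λ k → Φ (ins k 0 (map suc σ))))) ⟩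
  ΣS (suc n) (λ σ → Σ< (suc (suc n)) (λ k → Φ (ins k 0 (map suc σ)))) ∎
  where
  Ψ : List ℕ → ℕ
  Ψ σ = Σ< (suc n) (λ k → Φ (ins (suc k) 0 (map suc σ)))
  word-eq : ∀ a k σ → suc a ∷ map (punchIn (suc a)) (ins k 0 (map suc σ)) ≡ ins (suc k) 0 (map suc (a ∷ map (punchIn a) σ))
  word-eq a k σ = cong (suc a ∷_) (trans (map-ins (punchIn (suc a)) k 0 (map suc σ))
    (cong (ins k 0) (trans (sym (map-∘ σ)) (map-∘ σ))))
  rest : ∀ a → ΣS (suc n) (λ σ → Φ (suc a ∷ map (punchIn (suc a)) σ)) ≡ ΣS n (λ σ → Ψ (a ∷ map (punchIn a) σ))
  rest a = trans (ΣS-insert n (λ σ → Φ (suc a ∷ map (punchIn (suc a)) σ)))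
    (ΣA-cong′ n (upTo n) (λ σ → Σ<-cong′ (suc n) (λ k → cong Φ (word-eq a k σ))))

-- From the filtered enumeration to ΣS

ΣW : ℕ → List ℕ → (List ℕ → ℕ) → ℕ
ΣW zero    L Φ = Φ []
ΣW (suc l) L Φ = ΣL L (λ a → ΣW l L (λ w → Φ (a ∷ w)))

ΣW-cong : ∀ l L {Φ Ψ : List ℕ → ℕ} → (∀ w → Φ w ≡ Ψ w) → ΣW l L Φ ≡ ΣW l L Ψ
ΣW-cong zero    L h = h []
ΣW-cong (suc l) L h = ΣL-cong L (λ a → ΣW-cong l L (λ w → h (a ∷ w)))

ΣW-* : ∀ l L k (Φ : List ℕ → ℕ) → ΣW l L (λ w → k * Φ w) ≡ k * ΣW l L Φ
ΣW-* zero    L k Φ = refl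
ΣW-* (suc l) L k Φ = trans (ΣL-cong L (λ a → ΣW-* l L k _)) (ΣL-* L k _)

⟦∧⟧ : ∀ a b → ⟦ a ∧ b ⟧ ≡ ⟦ a ⟧ * ⟦ b ⟧
⟦∧⟧ true  b = sym (+-identityʳ _)
⟦∧⟧ false b = refl

≡ᵇ-refl : ∀ a → (a ≡ᵇ a) ≡ true
≡ᵇ-refl zero    = refl
≡ᵇ-refl (suc a) = ≡ᵇ-refl a

≢⇒≡ᵇ-false : ∀ a b → a ≢ b → (a ≡ᵇ b) ≡ false
≢⇒≡ᵇ-false zero    zero    h = contradiction refl h
≢⇒≡ᵇ-false zero    (suc b) h = refl
≢⇒≡ᵇ-false (suc a) zero    h = refl
≢⇒≡ᵇ-false (suc a) (suc b) h = ≢⇒≡ᵇ-false a b (h ∘ cong suc)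

Unique-↭ : {xs ys : List ℕ} → xs ↭ ys → Unique xs → Unique ys
Unique-↭ = PermS.Unique-resp-↭ (setoid ℕ) ∘ ↭⇒↭ₛ

ΣW-notIn : ∀ l a L L′ → a ∷ L′ ↭ L → Unique L → (Φ : List ℕ → ℕ) → ΣW l L (λ w → ⟦ notIn a w ⟧ * Φ w) ≡ ΣW l L′ Φ
ΣW-notIn zero    a L L′ p u Φ = +-identityʳ _
ΣW-notIn (suc l) a L L′ p u Φ = begin
  ΣL L (λ b → ΣW l L (λ w → ⟦ not (a ≡ᵇ b) ∧ notIn a w ⟧ * Φ (b ∷ w)))
    ≡⟨ ΣL-cong L (λ b → trans (ΣW-cong l L (λ w → trans (cong (_* Φ (b ∷ w)) (⟦∧⟧ (not (a ≡ᵇ b)) _)) (*-assoc ⟦ not (a ≡ᵇ b) ⟧ _ _)))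
                         (trans (ΣW-* l L ⟦ not (a ≡ᵇ b) ⟧ _) (cong (⟦ not (a ≡ᵇ b) ⟧ *_) (ΣW-notIn l a L L′ p u _)))) ⟩
  ΣL L (λ b → ⟦ not (a ≡ᵇ b) ⟧ * g b)
    ≡⟨ sym (ΣL-↭ _ p) ⟩
  ⟦ not (a ≡ᵇ a) ⟧ * g a + ΣL L′ (λ b → ⟦ not (a ≡ᵇ b) ⟧ * g b)
    ≡⟨ cong (λ z → ⟦ not z ⟧ * g a + ΣL L′ (λ b → ⟦ not (a ≡ᵇ b) ⟧ * g b)) (≡ᵇ-refl a) ⟩
  ΣL L′ (λ b → ⟦ not (a ≡ᵇ b) ⟧ * g b)
    ≡⟨ ΣL-congAll (All.map (λ {b} a≢b → trans (cong (λ z → ⟦ not z ⟧ * g b) (≢⇒≡ᵇ-false a b a≢b)) (+-identityʳ (g b))) (AllPairs.head (Unique-↭ (↭-sym p) u))) ⟩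
  ΣL L′ g ∎
  where
  g : ℕ → ℕ
  g b = ΣW l L′ (λ w → Φ (b ∷ w))

ΣW-distinct : ∀ l L → Unique L → (Φ : List ℕ → ℕ) → ΣW l L (λ w → ⟦ distinct w ⟧ * Φ w) ≡ ΣA l L Φ
ΣW-distinct zero    L u Φ = +-identityʳ _
ΣW-distinct (suc l) L u Φ = begin
  ΣL L (λ a → ΣW l L (λ w → ⟦ notIn a w ∧ distinct w ⟧ * Φ (a ∷ w)))
    ≡⟨ ΣL-cong L (λ a → ΣW-cong l L (λ w → trans (cong (_* Φ (a ∷ w)) (⟦∧⟧ (notIn a w) _)) (*-assoc ⟦ notIn a w ⟧ _ _))) ⟩
  ΣL L (λ a → ΣW l L (λ w → ⟦ notIn a w ⟧ * (⟦ distinct w ⟧ * Φ (a ∷ w))))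
    ≡⟨ sym (ΣL-sel₁ L _) ⟩
  ΣL (sel L) (λ p → ΣW l L (λ w → ⟦ notIn (proj₁ p) w ⟧ * (⟦ distinct w ⟧ * Φ (proj₁ p ∷ w))))
    ≡⟨ ΣL-congAll (All.map (λ {p} r → trans (ΣW-notIn l (proj₁ p) L (proj₂ p) r u _)
         (ΣW-distinct l (proj₂ p) (AllPairs.tail (Unique-↭ (↭-sym r) u)) _)) (sel-↭ L)) ⟩
  ΣA (suc l) L Φ ∎

map-toℕ-allFin : ∀ n → map toℕ (allFin n) ≡ upTo n
map-toℕ-allFin n = trans (map-tabulate id toℕ) (go n id)
  where
  go : ∀ n (f : ℕ → ℕ) → tabulate {n = n} (λ i → f (toℕ i)) ≡ applyUpTo f n
  go zero    f = refl
  go (suc n) f = cong (f 0 ∷_) (go n (f ∘ suc))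

ΣL-allWords : ∀ l n (Φ : List ℕ → ℕ) → ΣL (allWords l n) (λ w → Φ (map toℕ (toList w))) ≡ ΣW l (upTo n) Φ
ΣL-allWords zero    n Φ = +-identityʳ _
ΣL-allWords (suc l) n Φ = begin
  ΣL (allWords (suc l) n) (λ w → Φ (map toℕ (toList w)))
    ≡⟨ ΣL-concatMap (λ a → map (a ∷_) (allWords l n)) (allFin n) _ ⟩
  ΣL (allFin n) (λ a → ΣL (map (a ∷_) (allWords l n)) (λ w → Φ (map toℕ (toList w))))
    ≡⟨ ΣL-cong (allFin n) (λ a → trans (ΣL-map (a ∷_) (allWords l n) _) (ΣL-allWords l n (λ w → Φ (toℕ a ∷ w)))) ⟩
  ΣL (allFin n) (λ a → ΣW l (upTo n) (λ w → Φ (toℕ a ∷ w)))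
    ≡⟨ trans (sym (ΣL-map toℕ (allFin n) _)) (cong (λ L → ΣL L (λ a → ΣW l (upTo n) (λ w → Φ (a ∷ w)))) (map-toℕ-allFin n)) ⟩
  ΣW (suc l) (upTo n) Φ ∎

ΣL-Perms : ∀ n (Φ : List ℕ → ℕ) → ΣL (Perms n) (λ w → Φ (word w)) ≡ ΣS n Φ
ΣL-Perms n Φ = begin
  ΣL (Perms n) (λ w → Φ (word w))
    ≡⟨ ΣL-filterᵇ (λ w → distinct (word w)) (allWords n n) _ ⟩
  ΣL (allWords n n) (λ w → ⟦ distinct (word w) ⟧ * Φ (word w))
    ≡⟨ ΣL-allWords n n (λ w → ⟦ distinct w ⟧ * Φ w) ⟩
  ΣW n (upTo n) (λ w → ⟦ distinct w ⟧ * Φ w)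
    ≡⟨ ΣW-distinct n (upTo n) (upTo⁺ n) Φ ⟩
  ΣS n Φ ∎

-- Patterns of ascents and compatible sequences of letters

<⇒<ᵇ-true : ∀ {a b} → a < b → (a <ᵇ b) ≡ true
<⇒<ᵇ-true {zero}  {suc b} p       = refl
<⇒<ᵇ-true {suc a} {suc b} (s≤s p) = <⇒<ᵇ-true p

≥⇒<ᵇ-false : ∀ {a b} → b ≤ a → (a <ᵇ b) ≡ false
≥⇒<ᵇ-false {a}     {zero}  p       = refl
≥⇒<ᵇ-false {suc a} {suc b} (s≤s p) = ≥⇒<ᵇ-false p

punchIn-≡ᵇ : ∀ a x y → (punchIn a x ≡ᵇ punchIn a y) ≡ (x ≡ᵇ y)
punchIn-≡ᵇ zero    x       y       = refl
punchIn-≡ᵇ (suc a) zero    zero    = refl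
punchIn-≡ᵇ (suc a) zero    (suc y) = refl
punchIn-≡ᵇ (suc a) (suc x) zero    = refl
punchIn-≡ᵇ (suc a) (suc x) (suc y) = punchIn-≡ᵇ a x y

punchIn-≢ᵇ : ∀ a x → (punchIn a x ≡ᵇ a) ≡ false
punchIn-≢ᵇ zero    x       = refl
punchIn-≢ᵇ (suc a) zero    = refl
punchIn-≢ᵇ (suc a) (suc x) = punchIn-≢ᵇ a x

punchIn-<ᵇ : ∀ a x y → (punchIn a x <ᵇ punchIn a y) ≡ (x <ᵇ y)
punchIn-<ᵇ zero    x       y       = refl
punchIn-<ᵇ (suc a) zero    zero    = refl
punchIn-<ᵇ (suc a) zero    (suc y) = refl
punchIn-<ᵇ (suc a) (suc x) zero    = refl
punchIn-<ᵇ (suc a) (suc x) (suc y) = punchIn-<ᵇ a x y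

<ᵇ-punchIn : ∀ a x → (a <ᵇ punchIn a x) ≡ (a <ᵇ suc x)
<ᵇ-punchIn zero    x       = refl
<ᵇ-punchIn (suc a) zero    = refl
<ᵇ-punchIn (suc a) (suc x) = <ᵇ-punchIn a x

upTo-ins : ∀ n a → a ≤ n → upTo (suc n) ≡ ins a a (map (punchIn a) (upTo n))
upTo-ins n       zero    p       = upTo-suc n
upTo-ins (suc n) (suc a) (s≤s p) = begin
  upTo (suc (suc n))                                              ≡⟨ upTo-suc (suc n) ⟩
  0 ∷ map suc (upTo (suc n))                                      ≡⟨ cong (λ L → 0 ∷ map suc L) (upTo-ins n a p) ⟩
  0 ∷ map suc (ins a a (map (punchIn a) (upTo n)))                ≡⟨ cong (0 ∷_) (map-ins suc a a _) ⟩
  0 ∷ ins a (suc a) (map suc (map (punchIn a) (upTo n)))          ≡⟨ cong (λ L → 0 ∷ ins a (suc a) L) (trans (sym (map-∘ (upTo n))) (map-∘ (upTo n))) ⟩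
  ins (suc a) (suc a) (map (punchIn (suc a)) (0 ∷ map suc (upTo n))) ≡⟨ cong (ins (suc a) (suc a) ∘ map (punchIn (suc a))) (sym (upTo-suc n)) ⟩
  ins (suc a) (suc a) (map (punchIn (suc a)) (upTo (suc n)))      ∎

posOf-punchIn : ∀ a u σ → posOf (punchIn a u) (map (punchIn a) σ) ≡ posOf u σ
posOf-punchIn a u []      = refl
posOf-punchIn a u (y ∷ σ) rewrite punchIn-≡ᵇ a u y | posOf-punchIn a u σ = refl

-- The value a is found at position 0 and every other value one position later than before, so the
-- inverse acquires a new minimum at index a.
invL-first : ∀ n a σ → a ≤ n → invL (suc n) (a ∷ map (punchIn a) σ) ≡ ins a 0 (map suc (invL n σ))
invL-first n a σ p = begin
  map position (upTo (suc n))                              ≡⟨ cong (map position) (upTo-ins n a p) ⟩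
  map position (ins a a (map (punchIn a) (upTo n)))        ≡⟨ map-ins position a a _ ⟩
  ins a (position a) (map position (map (punchIn a) (upTo n)))  ≡⟨ cong₂ (ins a) pos-a (trans (sym (map-∘ (upTo n))) (trans (map-cong pos-punchIn (upTo n)) (map-∘ (upTo n)))) ⟩
  ins a 0 (map suc (invL n σ))                        ∎
  where
  position : ℕ → ℕ
  position v = posOf v (a ∷ map (punchIn a) σ)
  pos-a : position a ≡ 0
  pos-a rewrite ≡ᵇ-refl a = refl
  pos-punchIn : ∀ u → position (punchIn a u) ≡ suc (posOf u σ)
  pos-punchIn u rewrite punchIn-≢ᵇ a u | posOf-punchIn a u σ = refl

patFrom : (ℕ → ℕ → Bool) → ℕ → List ℕ → List Bool
patFrom lt a []      = []
patFrom lt a (b ∷ r) = lt a b ∷ patFrom lt b r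

pat : (ℕ → ℕ → Bool) → List ℕ → List Bool
pat lt []      = []
pat lt (a ∷ r) = patFrom lt a r

hd : List ℕ → ℕ
hd []      = 0
hd (x ∷ _) = x

patFrom-map : ∀ (f : ℕ → ℕ) → (∀ x y → (f x <ᵇ f y) ≡ (x <ᵇ y)) → ∀ a r → patFrom _<ᵇ_ (f a) (map f r) ≡ patFrom _<ᵇ_ a r
patFrom-map f h a []      = refl
patFrom-map f h a (b ∷ r) = cong₂ _∷_ (h a b) (patFrom-map f h b r)

length-patFrom : ∀ lt a r → length (patFrom lt a r) ≡ length r
length-patFrom lt a []      = refl
length-patFrom lt a (b ∷ r) = cong suc (length-patFrom lt b r)

length-pat : ∀ {n} w → length w ≡ suc n → length (pat _<ᵇ_ w) ≡ n
length-pat (a ∷ r) p = trans (length-patFrom _<ᵇ_ a r) (suc-injective p)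

-- insPatFrom k ds is the pattern of b ∷ w after a new minimum has been inserted into w at index k, where ds is the pattern of b ∷ w
insPatFrom : ℕ → List Bool → List Bool
insPatFrom zero    []       = false ∷ []
insPatFrom zero    (e ∷ ds) = false ∷ true ∷ ds
insPatFrom (suc k) []       = false ∷ []
insPatFrom (suc k) (e ∷ ds) = e ∷ insPatFrom k ds

insPat : ℕ → List Bool → List Bool
insPat zero    ds = true ∷ ds
insPat (suc k) ds = insPatFrom k ds

patFrom-ins : ∀ k b τ → k ≤ length τ → patFrom _<ᵇ_ (suc b) (ins k 0 (map suc τ)) ≡ insPatFrom k (patFrom _<ᵇ_ b τ)
patFrom-ins zero    b []      p       = refl
patFrom-ins zero    b (c ∷ τ) p       = cong (λ ds → false ∷ true ∷ ds) (patFrom-map suc (λ _ _ → refl) c τ)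
patFrom-ins (suc k) b (c ∷ τ) (s≤s p) = cong ((b <ᵇ c) ∷_) (patFrom-ins k c τ p)

pat-ins : ∀ k τ → 1 ≤ length τ → k ≤ length τ → pat _<ᵇ_ (ins k 0 (map suc τ)) ≡ insPat k (pat _<ᵇ_ τ)
pat-ins zero    (b ∷ τ) _ p       = cong (true ∷_) (patFrom-map suc (λ _ _ → refl) b τ)
pat-ins (suc k) (b ∷ τ) _ (s≤s p) = patFrom-ins k b τ p

pat-first : ∀ a σ → 1 ≤ length σ → pat _<ᵇ_ (a ∷ map (punchIn a) σ) ≡ (a <ᵇ suc (hd σ)) ∷ pat _<ᵇ_ σ
pat-first a (s ∷ σ) _ = cong₂ _∷_ (<ᵇ-punchIn a s) (patFrom-map (punchIn a) (punchIn-<ᵇ a) s σ)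

rm : ℕ → List ℕ → List ℕ
rm k       []       = []
rm zero    (x ∷ xs) = xs
rm (suc k) (x ∷ xs) = x ∷ rm k xs

at-punchIn : ∀ g a i → at g (punchIn a i) ≡ at (rm a g) i
at-punchIn []      a       i       = refl
at-punchIn (x ∷ g) zero    i       = refl
at-punchIn (x ∷ g) (suc a) zero    = refl
at-punchIn (x ∷ g) (suc a) (suc i) = at-punchIn g a i

length-invL : ∀ n σ → length (invL n σ) ≡ n
length-invL n σ = trans (length-map (λ v → posOf v σ) (upTo n)) (length-upTo n)

eqB : Bool → Bool → Bool
eqB true  b = b
eqB false b = not b

-- Compatible sequences, insertion of a letter, and standardization

module Letters (sg : ℕ → Bool) (q : ℕ) where

  -- c may follow b in a weakly decreasing sequence of letters lying over an ascent (e = true) or a descent (e = false):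
  -- repeating b is allowed over ascents or over descents according to sg b.
  ok : Bool → ℕ → ℕ → Bool
  ok e b c = (c <ᵇ b) ∨ ((c ≡ᵇ b) ∧ eqB e (sg b))

  ok-< : ∀ e {b c} → c < b → ok e b c ≡ true
  ok-< e p rewrite <⇒<ᵇ-true p = refl

  ok-≡ : ∀ e b → ok e b b ≡ eqB e (sg b)
  ok-≡ e b rewrite ≥⇒<ᵇ-false (≤-refl {b}) | ≡ᵇ-refl b = refl

  ok-> : ∀ e {b c} → b < c → ok e b c ≡ false
  ok-> e {b} {c} p rewrite ≥⇒<ᵇ-false (<⇒≤ p) | ≢⇒≡ᵇ-false c b (<⇒≢ p ∘ sym) = refl

  -- For distinct letters exactly one of the two strict inequalities holds; for equal letters `eqB`
  -- is negated together with the sign.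
  ok-complement : ∀ x c → ok false c x ≡ not (ok true x c)
  ok-complement x c with <-cmp x c
  ... | tri< p _ _ rewrite ok-< false p | ok-> true p = refl
  ... | tri≈ _ refl _ rewrite ok-≡ false x | ok-≡ true x = refl
  ... | tri> _ _ p rewrite ok-> false p | ok-< true p = refl

  ok-complement-sum : ∀ x c → ⟦ ok true x c ⟧ + ⟦ ok false c x ⟧ ≡ 1
  ok-complement-sum x c rewrite ok-complement x c with ok true x c
  ... | true  = refl
  ... | false = refl

  -- For given letters b, c with c allowed after b, the letter x fits on exactly one side of c.
  ok-insert : ∀ e b x c →
    ⟦ ok false b x ⟧ * ⟦ ok true x c ⟧ + ⟦ ok e b c ⟧ * ⟦ ok false c x ⟧ ≡ ⟦ ok false b x ⟧ * ⟦ ok e b c ⟧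
  ok-insert e b x c with <-cmp x c
  ... | tri< x<c _ _ rewrite ok-< false x<c | ok-> true x<c with <-cmp b c
  ...   | tri< b<c _ _ rewrite ok-> e b<c with ok false b x
  ...     | true  = refl
  ...     | false = refl
  ok-insert e b x c | tri< x<c _ _ | tri≈ _ refl _ rewrite ok-< false x<c with ok e b b
  ...     | true  = refl
  ...     | false = refl
  ok-insert e b x c | tri< x<c _ _ | tri> _ _ c<b rewrite ok-< false (<-trans x<c c<b) | ok-< e c<b = refl
  ok-insert e b x c | tri> _ _ c<x rewrite ok-> false c<x | ok-< true c<x with <-cmp b x
  ...   | tri< b<x _ _ rewrite ok-> false b<x = *-zeroʳ ⟦ ok e b c ⟧
  ...   | tri≈ _ refl _ rewrite ok-< e c<x with ok false b b
  ...     | true  = refl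
  ...     | false = refl
  ok-insert e b x c | tri> _ _ c<x | tri> _ _ x<b rewrite ok-< false x<b | ok-< e (<-trans c<x x<b) = refl
  ok-insert e b x c | tri≈ _ refl _ rewrite ok-≡ false x | ok-≡ true x with <-cmp b x
  ...   | tri< b<x _ _ rewrite ok-> false b<x | ok-> e b<x = refl
  ...   | tri≈ _ refl _ rewrite ok-≡ false b | ok-≡ e b with sg b | e
  ...     | true  | true  = refl
  ...     | true  | false = refl
  ...     | false | true  = refl
  ...     | false | false = refl
  ok-insert e b x c | tri≈ _ refl _ | tri> _ _ x<b rewrite ok-< false x<b | ok-< e x<b with sg x
  ...     | true  = refl
  ...     | false = refl

  ok⇒≤ : ∀ e {b c} → ok e b c ≡ true → c ≤ b
  ok⇒≤ e {b} {c} p with <-cmp b c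
  ... | tri< b<c _ _ with trans (sym p) (ok-> e b<c)
  ...   | ()
  ok⇒≤ e p | tri≈ _ refl _ = ≤-refl
  ok⇒≤ e p | tri> _ _ c<b  = <⇒≤ c<b

  -- If x < c, then x < b and any sign is allowed; if x = c, the first step is already the claim.
  -- The companion lemma compares c with b in the same way, so two steps may be composed under
  -- either of their signs.
  ok-transʳ : ∀ e e′ {b c x} → ok e b c ≡ true → ok e′ c x ≡ true → ok e b x ≡ true
  ok-transʳ e e′ {b} {c} {x} p r with <-cmp x c
  ... | tri< x<c _ _  = ok-< e (<-≤-trans x<c (ok⇒≤ e p))
  ... | tri≈ _ refl _ = p
  ... | tri> _ _ c<x  = contradiction (ok⇒≤ e′ r) (<⇒≱ c<x)

  ok-transˡ : ∀ e e′ {b c x} → ok e b c ≡ true → ok e′ c x ≡ true → ok e′ b x ≡ true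
  ok-transˡ e e′ {b} {c} {x} p r with <-cmp c b
  ... | tri< c<b _ _  = ok-< e′ (≤-<-trans (ok⇒≤ e′ r) c<b)
  ... | tri≈ _ refl _ = r
  ... | tri> _ _ b<c  = contradiction (ok⇒≤ e p) (<⇒≱ b<c)

  data Compatible : List Bool → ℕ → List ℕ → Set where
    []  : ∀ {b} → Compatible [] b []
    _∷_ : ∀ {e ds b c g} → ok e b c ≡ true → Compatible ds c g → Compatible (e ∷ ds) b (c ∷ g)

  Σc : List Bool → ℕ → (List ℕ → ℕ) → ℕ
  Σc []       b Ψ = Ψ []
  Σc (e ∷ ds) b Ψ = Σ< q (λ c → ⟦ ok e b c ⟧ * Σc ds c (λ g → Ψ (c ∷ g)))

  ΣC : List Bool → (List ℕ → ℕ) → ℕ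
  ΣC ds Ψ = Σ< q (λ b → Σc ds b (λ g → Ψ (b ∷ g)))

  Σc-cong : ∀ ds b {Ψ Ψ′ : List ℕ → ℕ} → (∀ g → Compatible ds b g → Ψ g ≡ Ψ′ g) → Σc ds b Ψ ≡ Σc ds b Ψ′
  Σc-cong []       b h = h [] []
  Σc-cong (e ∷ ds) b {Ψ} {Ψ′} h = Σ<-cong′ q step
    where
    step : ∀ c → ⟦ ok e b c ⟧ * Σc ds c (λ g → Ψ (c ∷ g)) ≡ ⟦ ok e b c ⟧ * Σc ds c (λ g → Ψ′ (c ∷ g))
    step c with ok e b c in eq
    ... | true  = cong (1 *_) (Σc-cong ds c (λ g p → h (c ∷ g) (eq ∷ p)))
    ... | false = refl

  cnt : List Bool → ℕ → ℕ
  cnt ds b = Σc ds b (λ _ → 1)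

  E : List Bool → ℕ
  E ds = ΣC ds (λ _ → 1)

  Σc-* : ∀ ds b k (Ψ : List ℕ → ℕ) → Σc ds b (λ g → k * Ψ g) ≡ k * Σc ds b Ψ
  Σc-* []       b k Ψ = refl
  Σc-* (e ∷ ds) b k Ψ = trans (Σ<-cong′ q (λ c → trans (cong (⟦ ok e b c ⟧ *_) (Σc-* ds c k _)) (x*[y*z] ⟦ ok e b c ⟧ k _))) (Σ<-* q k _)
    where
    x*[y*z] : ∀ x y z → x * (y * z) ≡ y * (x * z)
    x*[y*z] x y z = trans (sym (*-assoc x y z)) (trans (cong (_* z) (*-comm x y)) (*-assoc y x z))

  -- The letter x stands directly after b or somewhere after the next letter c. The second case is
  -- the induction hypothesis, and `ok-insert` merges both: whenever x may follow b over a descent,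
  -- it enters each sequence at exactly one index.
  Σc-insert : ∀ ds b (Ψ : ℕ → List ℕ → ℕ) →
    Σ< (suc (length ds)) (λ k → Σc (insPatFrom k ds) b (λ g → Ψ (at g k) (rm k g))) ≡
    Σ< q (λ x → ⟦ ok false b x ⟧ * Σc ds b (Ψ x))
  Σc-insert []       b Ψ = refl
  Σc-insert (e ∷ ds) b Ψ = begin
    Σ< (suc (suc (length ds))) (λ k → Σc (insPatFrom k (e ∷ ds)) b (λ g → Ψ (at g k) (rm k g)))
      ≡⟨ Σ<-cons (suc (length ds)) _ ⟩
    Σ< q (λ x → ⟦ ok false b x ⟧ * Σ< q (λ c → ⟦ ok true x c ⟧ * V x c)) +
    Σ< (suc (length ds)) (λ k → Σ< q (λ c → ⟦ ok e b c ⟧ * Σc (insPatFrom k ds) c (λ g → Ψ (at g k) (c ∷ rm k g))))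
      ≡⟨ cong₂ _+_ (Σ<-cong′ q (λ x → sym (Σ<-* q ⟦ ok false b x ⟧ _))) later ⟩
    Σ< q (λ x → Σ< q (λ c → ⟦ ok false b x ⟧ * (⟦ ok true x c ⟧ * V x c))) +
    Σ< q (λ x → Σ< q (λ c → ⟦ ok e b c ⟧ * (⟦ ok false c x ⟧ * V x c)))
      ≡⟨ sym (trans (Σ<-cong′ q (λ x → Σ<-+ q _ _)) (Σ<-+ q _ _)) ⟩
    Σ< q (λ x → Σ< q (λ c → ⟦ ok false b x ⟧ * (⟦ ok true x c ⟧ * V x c) + ⟦ ok e b c ⟧ * (⟦ ok false c x ⟧ * V x c)))
      ≡⟨ Σ<-cong′ q (λ x → trans (Σ<-cong′ q (λ c → merge x c)) (Σ<-* q ⟦ ok false b x ⟧ _)) ⟩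
    Σ< q (λ x → ⟦ ok false b x ⟧ * Σ< q (λ c → ⟦ ok e b c ⟧ * V x c)) ∎
    where
    V : ℕ → ℕ → ℕ
    V x c = Σc ds c (λ g → Ψ x (c ∷ g))
    later : Σ< (suc (length ds)) (λ k → Σ< q (λ c → ⟦ ok e b c ⟧ * Σc (insPatFrom k ds) c (λ g → Ψ (at g k) (c ∷ rm k g)))) ≡
            Σ< q (λ x → Σ< q (λ c → ⟦ ok e b c ⟧ * (⟦ ok false c x ⟧ * V x c)))
    later = begin
      _ ≡⟨ Σ<-swap (suc (length ds)) q _ ⟩
      Σ< q (λ c → Σ< (suc (length ds)) (λ k → ⟦ ok e b c ⟧ * Σc (insPatFrom k ds) c (λ g → Ψ (at g k) (c ∷ rm k g))))
        ≡⟨ Σ<-cong′ q (λ c → trans (Σ<-* (suc (length ds)) ⟦ ok e b c ⟧ _)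
             (trans (cong (⟦ ok e b c ⟧ *_) (Σc-insert ds c (λ x g → Ψ x (c ∷ g)))) (sym (Σ<-* q ⟦ ok e b c ⟧ _)))) ⟩
      Σ< q (λ c → Σ< q (λ x → ⟦ ok e b c ⟧ * (⟦ ok false c x ⟧ * V x c)))
        ≡⟨ Σ<-swap q q _ ⟩
      _ ∎
    merge : ∀ x c → ⟦ ok false b x ⟧ * (⟦ ok true x c ⟧ * V x c) + ⟦ ok e b c ⟧ * (⟦ ok false c x ⟧ * V x c) ≡
                    ⟦ ok false b x ⟧ * (⟦ ok e b c ⟧ * V x c)
    merge x c = begin
      ⟦ ok false b x ⟧ * (⟦ ok true x c ⟧ * V x c) + ⟦ ok e b c ⟧ * (⟦ ok false c x ⟧ * V x c)
        ≡⟨ cong₂ _+_ (sym (*-assoc ⟦ ok false b x ⟧ _ _)) (sym (*-assoc ⟦ ok e b c ⟧ _ _)) ⟩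
      ⟦ ok false b x ⟧ * ⟦ ok true x c ⟧ * V x c + ⟦ ok e b c ⟧ * ⟦ ok false c x ⟧ * V x c
        ≡⟨ sym (*-distribʳ-+ (V x c) (⟦ ok false b x ⟧ * ⟦ ok true x c ⟧) _) ⟩
      (⟦ ok false b x ⟧ * ⟦ ok true x c ⟧ + ⟦ ok e b c ⟧ * ⟦ ok false c x ⟧) * V x c
        ≡⟨ cong (_* V x c) (ok-insert e b x c) ⟩
      ⟦ ok false b x ⟧ * ⟦ ok e b c ⟧ * V x c
        ≡⟨ *-assoc ⟦ ok false b x ⟧ _ _ ⟩
      ⟦ ok false b x ⟧ * (⟦ ok e b c ⟧ * V x c) ∎

  -- The front is now also open to x. It stands before the first letter over an ascent or after it
  -- over a descent, and exactly one of these is allowed, so every pair (x , g) is reached once and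
  -- no condition on x remains.
  ΣC-insert : ∀ ds (Ψ : ℕ → List ℕ → ℕ) →
    Σ< (suc (suc (length ds))) (λ k → ΣC (insPat k ds) (λ g → Ψ (at g k) (rm k g))) ≡ Σ< q (λ x → ΣC ds (Ψ x))
  ΣC-insert ds Ψ = begin
    Σ< (suc (suc (length ds))) (λ k → ΣC (insPat k ds) (λ g → Ψ (at g k) (rm k g)))
      ≡⟨ Σ<-cons (suc (length ds)) _ ⟩
    Σ< q (λ x → Σ< q (λ c → ⟦ ok true x c ⟧ * V x c)) +
    Σ< (suc (length ds)) (λ k → Σ< q (λ c → Σc (insPatFrom k ds) c (λ g → Ψ (at g k) (c ∷ rm k g))))
      ≡⟨ cong (Σ< q (λ x → Σ< q (λ c → ⟦ ok true x c ⟧ * V x c)) +_)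
           (trans (Σ<-swap (suc (length ds)) q _) (trans (Σ<-cong′ q (λ c → Σc-insert ds c (λ x g → Ψ x (c ∷ g)))) (Σ<-swap q q _))) ⟩
    Σ< q (λ x → Σ< q (λ c → ⟦ ok true x c ⟧ * V x c)) + Σ< q (λ x → Σ< q (λ c → ⟦ ok false c x ⟧ * V x c))
      ≡⟨ sym (trans (Σ<-cong′ q (λ x → Σ<-+ q _ _)) (Σ<-+ q _ _)) ⟩
    Σ< q (λ x → Σ< q (λ c → ⟦ ok true x c ⟧ * V x c + ⟦ ok false c x ⟧ * V x c))
      ≡⟨ Σ<-cong′ q (λ x → Σ<-cong′ q (λ c → trans (sym (*-distribʳ-+ (V x c) ⟦ ok true x c ⟧ _))
           (trans (cong (_* V x c) (ok-complement-sum x c)) (+-identityʳ (V x c))))) ⟩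
    Σ< q (λ x → Σ< q (λ c → V x c)) ∎
    where
    V : ℕ → ℕ → ℕ
    V x c = Σc ds c (λ g → Ψ x (c ∷ g))

  ok-all : ∀ e {ds x c g} → ok e x c ≡ true → Compatible ds c g → ∀ i → i ≤ length ds → ok e x (at (c ∷ g) i) ≡ true
  ok-all e p r       zero    _       = p
  ok-all e {e′ ∷ ds} {x} {c} {c′ ∷ g} p (s ∷ r) (suc i) (s≤s l) = ok-all e (ok-transʳ e e′ {x} {c} {c′} p s) r i l

  ok-reach : ∀ k ds {b g} → k ≤ length ds → Compatible (insPatFrom k ds) b g → ok false b (at g k) ≡ true
  ok-reach zero    []       l       (p ∷ _) = p
  ok-reach zero    (e ∷ ds) l       (p ∷ _) = p
  ok-reach (suc k) (e ∷ ds) {b} {c ∷ g} (s≤s l) (p ∷ r) = ok-transˡ e false {b} {c} {at g k} p (ok-reach k ds l r)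

  -- Letters after the inserted one may follow it over an ascent (`ok-all`). Letters before it may
  -- be followed by it over a descent (`ok-reach`), which by `ok-complement` excludes the converse.
  <ᵇ-okFrom : ∀ k ds i {b g} → k ≤ length ds → i ≤ length ds → Compatible (insPatFrom k ds) b g →
    (suc k <ᵇ suc i) ≡ ok true (at g k) (at (b ∷ rm k g) i)
  <ᵇ-okFrom k ds zero {b} {g} l _ r = sym (not-inj (trans (sym (ok-complement (at g k) b)) (ok-reach k ds l r)))
    where
    not-inj : ∀ {a} → not a ≡ true → a ≡ false
    not-inj {false} _ = refl
  <ᵇ-okFrom zero    (e ∷ ds) (suc i) l       (s≤s m) (_ ∷ (p ∷ r)) = sym (ok-all true p r i m)
  <ᵇ-okFrom (suc k) (e ∷ ds) (suc i) (s≤s l) (s≤s m) (_ ∷ r)       = <ᵇ-okFrom k ds i l m r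

  -- For a permutation with first letter k, put in front of a σ with first letter i, the comparison
  -- on the left asks whether it begins with an ascent. The one on the right asks the same of its
  -- word of letters. This matches the two patterns.
  ΣC-<ᵇ : ∀ k ds i → k ≤ suc (length ds) → i ≤ length ds → (Ψ : Bool → ℕ → List ℕ → ℕ) →
    ΣC (insPat k ds) (λ g → Ψ (k <ᵇ suc i) (at g k) (rm k g)) ≡
    ΣC (insPat k ds) (λ g → Ψ (ok true (at g k) (at (rm k g) i)) (at g k) (rm k g))
  ΣC-<ᵇ zero ds i _ m Ψ = Σ<-cong′ q (λ x → Σc-cong (true ∷ ds) x {λ g → Ψ true x g} {λ g → Ψ (ok true x (at g i)) x g} (λ { (c ∷ g) (p ∷ r) → cong (λ z → Ψ z x (c ∷ g)) (sym (ok-all true p r i m)) }))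
  ΣC-<ᵇ (suc k) ds i (s≤s l) m Ψ = Σ<-cong′ q (λ b → Σc-cong (insPatFrom k ds) b (λ g r →
    cong (λ z → Ψ z (at g k) (b ∷ rm k g)) (<ᵇ-okFrom k ds i l m r)))

  Σw : ℕ → (List ℕ → ℕ) → ℕ
  Σw zero    Φ = Φ []
  Σw (suc n) Φ = Σ< q (λ b → Σw n (λ v → Φ (b ∷ v)))

  -- The words v on the letters 0 … q-1 correspond to the pairs (π , g) with g compatible with π⁻¹, via v = g ∘ π.
  standardization : ∀ n (Φ : List Bool → List ℕ → ℕ) →
    Σw (suc n) (λ v → Φ (pat (ok true) v) v) ≡
    ΣS (suc n) (λ π → ΣC (pat _<ᵇ_ (invL (suc n) π)) (λ g → Φ (pat _<ᵇ_ π) (map (at g) π)))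
  standardization zero    Φ = sym (+-identityʳ _)
  standardization (suc n) Φ = begin
    Σ< q (λ b → Σw (suc n) (λ v → Φ (ok true b (hd v) ∷ pat (ok true) v) (b ∷ v)))
      -- `Φ` sees the word as well as its pattern because the new letter b has to be compared with
      -- the first letter of the rest.
      ≡⟨ Σ<-cong′ q (λ b → standardization n (λ p v → Φ (ok true b (hd v) ∷ p) (b ∷ v))) ⟩
    Σ< q (λ b → ΣS (suc n) (λ σ → ΣC (τ σ) (λ g → Φ (ok true b (hd (map (at g) σ)) ∷ pat _<ᵇ_ σ) (b ∷ map (at g) σ))))
      ≡⟨ sym (ΣA-Σ< (suc n) (upTo (suc n)) q
           (λ σ b → ΣC (τ σ) (λ g → Φ (ok true b (hd (map (at g) σ)) ∷ pat _<ᵇ_ σ) (b ∷ map (at g) σ)))) ⟩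
    ΣS (suc n) (λ σ → Σ< q (λ b → ΣC (τ σ) (λ g → Φ (ok true b (hd (map (at g) σ)) ∷ pat _<ᵇ_ σ) (b ∷ map (at g) σ))))
      ≡⟨ ΣS-cong (suc n) perm ⟩
    ΣS (suc n) (λ σ → Σ< (suc (suc n)) (λ a → G (a ∷ map (punchIn a) σ)))
      ≡⟨ ΣA-Σ< (suc n) (upTo (suc n)) (suc (suc n)) (λ σ a → G (a ∷ map (punchIn a) σ)) ⟩
    Σ< (suc (suc n)) (λ a → ΣS (suc n) (λ σ → G (a ∷ map (punchIn a) σ)))
      ≡⟨ sym (ΣS-first (suc n) G) ⟩
    ΣS (suc (suc n)) G ∎
    where
    τ : List ℕ → List Bool
    τ σ = pat _<ᵇ_ (invL (suc n) σ)
    G : List ℕ → ℕ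
    G π = ΣC (pat _<ᵇ_ (invL (suc (suc n)) π)) (λ g → Φ (pat _<ᵇ_ π) (map (at g) π))
    length-τ : ∀ σ → length (τ σ) ≡ n
    length-τ σ = trans (length-patFrom _<ᵇ_ (posOf 0 σ) (map (λ v → posOf v σ) (applyUpTo suc n))) (suc-injective (length-invL (suc n) σ))
    perm : ∀ σ → σ ↭ upTo (suc n) →
      Σ< q (λ b → ΣC (τ σ) (λ g → Φ (ok true b (hd (map (at g) σ)) ∷ pat _<ᵇ_ σ) (b ∷ map (at g) σ))) ≡
      Σ< (suc (suc n)) (λ a → G (a ∷ map (punchIn a) σ))
    perm σ p with ↭-length p
    perm (s ∷ r) p | _ = begin
      Σ< q (λ b → ΣC (τ σ) (Ψ b))
        -- A letter b and a sequence over the inverse of σ are traded for an index k and a longer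
        -- sequence; k becomes the first letter of the longer permutation.
        ≡⟨ sym (ΣC-insert (τ σ) Ψ) ⟩
      Σ< (suc (suc (length (τ σ)))) (λ k → ΣC (insPat k (τ σ)) (λ g → Ψ (at g k) (rm k g)))
        ≡⟨ cong (λ l → Σ< (suc (suc l)) (λ k → ΣC (insPat k (τ σ)) (λ g → Ψ (at g k) (rm k g)))) (length-τ σ) ⟩
      Σ< (suc (suc n)) (λ k → ΣC (insPat k (τ σ)) (λ g → Ψ (at g k) (rm k g)))
        ≡⟨ Σ<-cong (suc (suc n)) (λ a a< → trans
             (sym (ΣC-<ᵇ a (τ σ) s (≤-trans (≤-pred a<) (≤-reflexive (cong suc (sym (length-τ σ)))))
                    (≤-trans (≤-pred (∈-upTo⁻ (∈-resp-↭ p (here refl)))) (≤-reflexive (sym (length-τ σ))))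
                    (λ z x g → Φ (z ∷ pat _<ᵇ_ σ) (x ∷ map (at g) σ))))
             (step a (≤-pred a<))) ⟩
      Σ< (suc (suc n)) (λ a → G (a ∷ map (punchIn a) σ)) ∎
      where
      σ = s ∷ r
      Ψ : ℕ → List ℕ → ℕ
      Ψ x g = Φ (ok true x (at g s) ∷ pat _<ᵇ_ σ) (x ∷ map (at g) σ)
      step : ∀ a → a ≤ suc n →
        ΣC (insPat a (τ σ)) (λ g → Φ ((a <ᵇ suc s) ∷ pat _<ᵇ_ σ) (at g a ∷ map (at (rm a g)) σ)) ≡ G (a ∷ map (punchIn a) σ)
      step a a≤ = trans
        (Σ<-cong′ q (λ b → Σc-cong (insPat a (τ σ)) b (λ g _ →
          cong₂ Φ (sym (pat-first a σ (s≤s z≤n))) (cong (at (b ∷ g) a ∷_) (trans (map-cong (λ i → sym (at-punchIn (b ∷ g) a i)) σ) (map-∘ σ))))))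
        (cong (λ ds → ΣC ds (λ g → Φ (pat _<ᵇ_ (a ∷ map (punchIn a) σ)) (map (at g) (a ∷ map (punchIn a) σ))))
          (sym (trans (cong (pat _<ᵇ_) (invL-first (suc n) a σ a≤))
            (pat-ins a (invL (suc n) σ) (≤-trans (s≤s z≤n) (≤-reflexive (sym (length-invL (suc n) σ)))) (≤-trans a≤ (≤-reflexive (sym (length-invL (suc n) σ))))))))

-- Power series

ℕ→ℚ-+ : ∀ m n → ℕ→ℚ (m + n) ≡ ℕ→ℚ m ℚ.+ ℕ→ℚ n
ℕ→ℚ-+ m n = toℚᵘ-injective (ℚᵘP.≃-trans (toℚᵘ-fromℚᵘ (ℚᵘ.mkℚᵘ (pos (m + n)) 0)) (ℚᵘP.≃-sym (ℚᵘP.≃-trans (toℚᵘ-homo-+ (ℕ→ℚ m) (ℕ→ℚ n))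
  (ℚᵘP.≃-trans (ℚᵘP.+-cong (toℚᵘ-fromℚᵘ (ℚᵘ.mkℚᵘ (pos m) 0)) (toℚᵘ-fromℚᵘ (ℚᵘ.mkℚᵘ (pos n) 0)))
    (ℚᵘ.*≡* (cong (ℤ._* pos 1) (cong₂ ℤ._+_ (ℤP.*-identityʳ (pos m)) (ℤP.*-identityʳ (pos n)))))))))

ℕ→ℚ-* : ∀ m n → ℕ→ℚ (m * n) ≡ ℕ→ℚ m ℚ.* ℕ→ℚ n
ℕ→ℚ-* m n = toℚᵘ-injective (ℚᵘP.≃-trans (toℚᵘ-fromℚᵘ (ℚᵘ.mkℚᵘ (pos (m * n)) 0)) (ℚᵘP.≃-sym (ℚᵘP.≃-trans (toℚᵘ-homo-* (ℕ→ℚ m) (ℕ→ℚ n))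
  (ℚᵘP.≃-trans (ℚᵘP.*-cong (toℚᵘ-fromℚᵘ (ℚᵘ.mkℚᵘ (pos m) 0)) (toℚᵘ-fromℚᵘ (ℚᵘ.mkℚᵘ (pos n) 0)))
    (ℚᵘ.*≡* (cong (ℤ._* pos 1) (sym (ℤP.pos-* m n))))))))

1/n*n≡1 : ∀ n .{{_ : NonZero n}} → (pos 1 ℚ./ n) ℚ.* ℕ→ℚ n ≡ 1ℚ
1/n*n≡1 n@(suc k) = toℚᵘ-injective (ℚᵘP.≃-trans (toℚᵘ-homo-* (pos 1 ℚ./ n) (ℕ→ℚ n))
  (ℚᵘP.≃-trans (ℚᵘP.*-cong (toℚᵘ-fromℚᵘ (ℚᵘ.mkℚᵘ (pos 1) k)) (toℚᵘ-fromℚᵘ (ℚᵘ.mkℚᵘ (pos n) 0)))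
    (ℚᵘ.*≡* (cong pos eq))))
  where
  eq : (n + 0) * 1 ≡ n * 1 + 0
  eq = trans (*-identityʳ _) (cong (_+ 0) (sym (*-identityʳ n)))

tl : S1 → S1
tl f m = f (suc m)

sumℚ-cong : {B : Set} {f g : B → ℚ} (xs : List B) → (∀ x → f x ≡ g x) → sumℚ (map f xs) ≡ sumℚ (map g xs)
sumℚ-cong []       h = refl
sumℚ-cong (x ∷ xs) h = cong₂ ℚ._+_ (h x) (sumℚ-cong xs h)

sumℚ-* : {B : Set} (a : ℚ) (f : B → ℚ) (xs : List B) → sumℚ (map (λ x → a ℚ.* f x) xs) ≡ a ℚ.* sumℚ (map f xs)
sumℚ-* a f []       = sym (ℚP.*-zeroʳ a)
sumℚ-* a f (x ∷ xs) = trans (cong (a ℚ.* f x ℚ.+_) (sumℚ-* a f xs)) (sym (ℚP.*-distribˡ-+ a (f x) _))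

sumℚ-+ : {B : Set} (f g : B → ℚ) (xs : List B) → sumℚ (map (λ x → f x ℚ.+ g x) xs) ≡ sumℚ (map f xs) ℚ.+ sumℚ (map g xs)
sumℚ-+ f g []       = refl
sumℚ-+ f g (x ∷ xs) = trans (cong (f x ℚ.+ g x ℚ.+_) (sumℚ-+ f g xs))
  (solve 4 (λ a b c e → (a :+ b) :+ (c :+ e) := (a :+ c) :+ (b :+ e)) refl (f x) (g x) (sumℚ (map f xs)) (sumℚ (map g xs)))
  where open ℚS using (solve; _:+_; _:*_; :-_; _:=_; con)

Σ≤-suc : ∀ n f → Σ≤ (suc n) f ≡ f 0 ℚ.+ Σ≤ n (f ∘ suc)
Σ≤-suc n f = cong (λ L → f 0 ℚ.+ sumℚ L) (trans (map-applyUpTo suc f (suc n)) (sym (map-applyUpTo id (f ∘ suc) (suc n))))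

Σ≤-cong : ∀ n {f g} → (∀ k → f k ≡ g k) → Σ≤ n f ≡ Σ≤ n g
Σ≤-cong n = sumℚ-cong (upTo (suc n))

⊛-zero : ∀ f g → (f ⊛ g) 0 ≡ f 0 ℚ.* g 0
⊛-zero f g = ℚP.+-identityʳ _

⊛-suc : ∀ f g m → (f ⊛ g) (suc m) ≡ f 0 ℚ.* g (suc m) ℚ.+ (tl f ⊛ g) m
⊛-suc f g m = Σ≤-suc m (λ k → f k ℚ.* g (suc m ∸ k))

⊛-cong : ∀ {f f′ g g′} → f ≗ f′ → g ≗ g′ → f ⊛ g ≗ f′ ⊛ g′
⊛-cong p r m = Σ≤-cong m (λ k → cong₂ ℚ._*_ (p k) (r (m ∸ k)))

⊛-distribʳ : ∀ h f g → (f ⊕ g) ⊛ h ≗ (f ⊛ h) ⊕ (g ⊛ h)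
⊛-distribʳ h f g m = trans (Σ≤-cong m (λ k → ℚP.*-distribʳ-+ (h (m ∸ k)) (f k) (g k))) (sumℚ-+ (λ k → f k ℚ.* h (m ∸ k)) (λ k → g k ℚ.* h (m ∸ k)) (upTo (suc m)))

·₁-⊛ : ∀ a f g → (a ·₁ f) ⊛ g ≗ a ·₁ (f ⊛ g)
·₁-⊛ a f g m = trans (Σ≤-cong m (λ k → ℚP.*-assoc a (f k) _)) (sumℚ-* a _ (upTo (suc m)))

-- `⊛-suc` splits off the first summand of the convolution and this splits off the last;
-- commutativity follows from the two by induction.
⊛-sucʳ : ∀ f g m → (f ⊛ g) (suc m) ≡ (f ⊛ tl g) m ℚ.+ f (suc m) ℚ.* g 0
⊛-sucʳ f g zero = trans (⊛-suc f g 0) (cong₂ ℚ._+_ (sym (⊛-zero f (tl g))) (⊛-zero (tl f) g))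
⊛-sucʳ f g (suc m) = begin
  (f ⊛ g) (suc (suc m))                                                     ≡⟨ ⊛-suc f g (suc m) ⟩
  f 0 ℚ.* g (suc (suc m)) ℚ.+ (tl f ⊛ g) (suc m)                                ≡⟨ cong (f 0 ℚ.* g (suc (suc m)) ℚ.+_) (⊛-sucʳ (tl f) g m) ⟩
  f 0 ℚ.* g (suc (suc m)) ℚ.+ ((tl f ⊛ tl g) m ℚ.+ f (suc (suc m)) ℚ.* g 0)         ≡⟨ sym (ℚP.+-assoc (f 0 ℚ.* g (suc (suc m))) _ _) ⟩
  (f 0 ℚ.* g (suc (suc m)) ℚ.+ (tl f ⊛ tl g) m) ℚ.+ f (suc (suc m)) ℚ.* g 0         ≡⟨ cong (ℚ._+ f (suc (suc m)) ℚ.* g 0) (sym (⊛-suc f (tl g) m)) ⟩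
  (f ⊛ tl g) (suc m) ℚ.+ f (suc (suc m)) ℚ.* g 0                                ∎

⊛-comm : ∀ f g → f ⊛ g ≗ g ⊛ f
⊛-comm f g zero    = trans (⊛-zero f g) (trans (ℚP.*-comm (f 0) (g 0)) (sym (⊛-zero g f)))
⊛-comm f g (suc m) = begin
  (f ⊛ g) (suc m)                       ≡⟨ ⊛-suc f g m ⟩
  f 0 ℚ.* g (suc m) ℚ.+ (tl f ⊛ g) m        ≡⟨ cong₂ ℚ._+_ (ℚP.*-comm (f 0) _) (⊛-comm (tl f) g m) ⟩
  g (suc m) ℚ.* f 0 ℚ.+ (g ⊛ tl f) m        ≡⟨ ℚP.+-comm (g (suc m) ℚ.* f 0) _ ⟩
  (g ⊛ tl f) m ℚ.+ g (suc m) ℚ.* f 0        ≡⟨ sym (⊛-sucʳ g f m) ⟩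
  (g ⊛ f) (suc m)                       ∎

⊛-assoc : ∀ f g h → (f ⊛ g) ⊛ h ≗ f ⊛ (g ⊛ h)
⊛-assoc f g h zero = begin
  ((f ⊛ g) ⊛ h) 0      ≡⟨ ⊛-zero (f ⊛ g) h ⟩
  (f ⊛ g) 0 ℚ.* h 0      ≡⟨ cong (ℚ._* h 0) (⊛-zero f g) ⟩
  f 0 ℚ.* g 0 ℚ.* h 0      ≡⟨ ℚP.*-assoc (f 0) (g 0) (h 0) ⟩
  f 0 ℚ.* (g 0 ℚ.* h 0)    ≡⟨ cong (f 0 ℚ.*_) (sym (⊛-zero g h)) ⟩
  f 0 ℚ.* (g ⊛ h) 0      ≡⟨ sym (⊛-zero f (g ⊛ h)) ⟩
  (f ⊛ (g ⊛ h)) 0      ∎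
⊛-assoc f g h (suc m) = begin
  ((f ⊛ g) ⊛ h) (suc m)
    ≡⟨ ⊛-suc (f ⊛ g) h m ⟩
  (f ⊛ g) 0 ℚ.* h (suc m) ℚ.+ (tl (f ⊛ g) ⊛ h) m
    ≡⟨ cong₂ ℚ._+_ (cong (ℚ._* h (suc m)) (⊛-zero f g)) (trans (⊛-cong {g = h} {g′ = h} (⊛-suc f g) (λ _ → refl) m) (⊛-distribʳ h (f 0 ·₁ tl g) (tl f ⊛ g) m)) ⟩
  f 0 ℚ.* g 0 ℚ.* h (suc m) ℚ.+ (((f 0 ·₁ tl g) ⊛ h) m ℚ.+ ((tl f ⊛ g) ⊛ h) m)
    ≡⟨ cong₂ (λ x y → f 0 ℚ.* g 0 ℚ.* h (suc m) ℚ.+ (x ℚ.+ y)) (·₁-⊛ (f 0) (tl g) h m) (⊛-assoc (tl f) g h m) ⟩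
  f 0 ℚ.* g 0 ℚ.* h (suc m) ℚ.+ (f 0 ℚ.* (tl g ⊛ h) m ℚ.+ (tl f ⊛ (g ⊛ h)) m)
    ≡⟨ solve 5 (λ a b c x y → a :* b :* c :+ (a :* x :+ y) := a :* (b :* c :+ x) :+ y) refl (f 0) (g 0) (h (suc m)) _ _ ⟩
  f 0 ℚ.* (g 0 ℚ.* h (suc m) ℚ.+ (tl g ⊛ h) m) ℚ.+ (tl f ⊛ (g ⊛ h)) m
    ≡⟨ cong (λ x → f 0 ℚ.* x ℚ.+ (tl f ⊛ (g ⊛ h)) m) (sym (⊛-suc g h m)) ⟩
  f 0 ℚ.* (g ⊛ h) (suc m) ℚ.+ (tl f ⊛ (g ⊛ h)) m
    ≡⟨ sym (⊛-suc f (g ⊛ h) m) ⟩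
  (f ⊛ (g ⊛ h)) (suc m) ∎
  where open ℚS using (solve; _:+_; _:*_; :-_; _:=_; con)

0⊛ : ∀ g → (λ _ → 0ℚ) ⊛ g ≗ (λ _ → 0ℚ)
0⊛ g zero    = trans (⊛-zero (λ _ → 0ℚ) g) (ℚP.*-zeroˡ (g 0))
0⊛ g (suc m) = trans (⊛-suc (λ _ → 0ℚ) g m) (trans (cong₂ ℚ._+_ (ℚP.*-zeroˡ (g (suc m))) (0⊛ g m)) refl)

c1-⊛ : ∀ a g → c1 a ⊛ g ≗ a ·₁ g
c1-⊛ a g zero    = ⊛-zero (c1 a) g
c1-⊛ a g (suc m) = trans (⊛-suc (c1 a) g m) (trans (cong (a ℚ.* g (suc m) ℚ.+_) (0⊛ g m)) (ℚP.+-identityʳ _))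

⊛-identityˡ : ∀ g → one ⊛ g ≗ g
⊛-identityˡ g m = trans (c1-⊛ 1ℚ g m) (ℚP.*-identityˡ (g m))

⊛-commutativeMonoid : CommutativeMonoid 0ℓ 0ℓ
⊛-commutativeMonoid = record
  { Carrier = S1 ; _≈_ = _≗_ ; _∙_ = _⊛_ ; ε = one
  ; isCommutativeMonoid = record
    { isMonoid = record
      { isSemigroup = record
        { isMagma = record
          { isEquivalence = record { refl = λ _ → refl ; sym = λ p m → sym (p m) ; trans = λ p r m → trans (p m) (r m) }
          ; ∙-cong = ⊛-cong }
        ; assoc = ⊛-assoc }
      ; identity = ⊛-identityˡ , λ g m → trans (⊛-comm g one m) (⊛-identityˡ g m) }
    ; comm = ⊛-comm } }

open CMSolver ⊛-commutativeMonoid using () renaming (solve to ⊛-solve; _⊕_ to _⊙_; _⊜_ to _⊜_; id to ⊛-ε)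

⊛-congˡ : ∀ f {g g′} → g ≗ g′ → f ⊛ g ≗ f ⊛ g′
⊛-congˡ f = ⊛-cong {f} {f} (λ _ → refl)

⊛-congʳ : ∀ g {f f′} → f ≗ f′ → f ⊛ g ≗ f′ ⊛ g
⊛-congʳ g p = ⊛-cong {g = g} {g′ = g} p (λ _ → refl)

inv-go : S1 → ℕ → List ℚ → ℚ
inv-go f j []       = 0ℚ
inv-go f j (x ∷ xs) = f (suc j) ℚ.* x ℚ.+ inv-go f (suc j) xs

-- Any function with the defining equations of the local helper of invUpTo is inv-go.
inv-go-unique : ∀ f (G : ℕ → List ℚ → ℚ) → (∀ j → G j [] ≡ 0ℚ) → (∀ j x xs → G j (x ∷ xs) ≡ f (suc j) ℚ.* x ℚ.+ G (suc j) xs) →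
  ∀ j xs → G j xs ≡ inv-go f j xs
inv-go-unique f G p r j []       = p j
inv-go-unique f G p r j (x ∷ xs) = trans (r j x xs) (cong (f (suc j) ℚ.* x ℚ.+_) (inv-go-unique f G p r (suc j) xs))

inv-suc-go : ∀ f m → inv f (suc m) ≡ ℚ.- inv-go f 0 (invUpTo f m)
inv-suc-go f m with invUpTo f m | 0 | inv-go-unique f _ (λ _ → refl) (λ _ _ _ → refl)
... | xs | z | e = cong ℚ.-_ (e z xs)

inv-go-invUpTo : ∀ f j m → inv-go f j (invUpTo f m) ≡ Σ≤ m (λ k → f (suc (j + k)) ℚ.* inv f (m ∸ k))
inv-go-invUpTo f j zero    = cong (λ i → f (suc i) ℚ.* 1ℚ ℚ.+ 0ℚ) (sym (+-identityʳ j))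
inv-go-invUpTo f j (suc m) = begin
  f (suc j) ℚ.* inv f (suc m) ℚ.+ inv-go f (suc j) (invUpTo f m)
    ≡⟨ cong₂ (λ i x → f (suc i) ℚ.* inv f (suc m) ℚ.+ x) (sym (+-identityʳ j)) (inv-go-invUpTo f (suc j) m) ⟩
  f (suc (j + 0)) ℚ.* inv f (suc m) ℚ.+ Σ≤ m (λ k → f (suc (suc j + k)) ℚ.* inv f (m ∸ k))
    ≡⟨ cong (f (suc (j + 0)) ℚ.* inv f (suc m) ℚ.+_) (Σ≤-cong m (λ k → cong (λ i → f (suc i) ℚ.* inv f (m ∸ k)) (sym (+-suc j k)))) ⟩
  f (suc (j + 0)) ℚ.* inv f (suc m) ℚ.+ Σ≤ m (λ k → f (suc (j + suc k)) ℚ.* inv f (m ∸ k))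
    ≡⟨ sym (Σ≤-suc m (λ k → f (suc (j + k)) ℚ.* inv f (suc m ∸ k))) ⟩
  Σ≤ (suc m) (λ k → f (suc (j + k)) ℚ.* inv f (suc m ∸ k)) ∎

inv-suc : ∀ f m → inv f (suc m) ≡ ℚ.- (tl f ⊛ inv f) m
inv-suc f m = trans (inv-suc-go f m) (cong ℚ.-_ (inv-go-invUpTo f 0 m))

⊛-inverseʳ : ∀ f → f 0 ≡ 1ℚ → f ⊛ inv f ≗ one
⊛-inverseʳ f p zero    = trans (⊛-zero f (inv f)) (trans (ℚP.*-identityʳ (f 0)) p)
⊛-inverseʳ f p (suc m) = begin
  (f ⊛ inv f) (suc m)                              ≡⟨ ⊛-suc f (inv f) m ⟩
  f 0 ℚ.* inv f (suc m) ℚ.+ (tl f ⊛ inv f) m           ≡⟨ cong₂ (λ x y → x ℚ.* y ℚ.+ (tl f ⊛ inv f) m) p (inv-suc f m) ⟩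
  1ℚ ℚ.* ℚ.- (tl f ⊛ inv f) m ℚ.+ (tl f ⊛ inv f) m       ≡⟨ cong (ℚ._+ (tl f ⊛ inv f) m) (ℚP.*-identityˡ (ℚ.- (tl f ⊛ inv f) m)) ⟩
  ℚ.- (tl f ⊛ inv f) m ℚ.+ (tl f ⊛ inv f) m            ≡⟨ ℚP.+-inverseˡ ((tl f ⊛ inv f) m) ⟩
  0ℚ                                               ∎

tl-X : tl X ≗ one
tl-X zero    = refl
tl-X (suc m) = refl

X⊛-zero : ∀ g → (X ⊛ g) 0 ≡ 0ℚ
X⊛-zero g = trans (⊛-zero X g) (ℚP.*-zeroˡ (g 0))

X⊛-suc : ∀ g m → (X ⊛ g) (suc m) ≡ g m
X⊛-suc g m = begin
  (X ⊛ g) (suc m)                ≡⟨ ⊛-suc X g m ⟩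
  0ℚ ℚ.* g (suc m) ℚ.+ (tl X ⊛ g) m  ≡⟨ cong₂ ℚ._+_ (ℚP.*-zeroˡ (g (suc m))) (trans (⊛-congʳ g tl-X m) (⊛-identityˡ g m)) ⟩
  0ℚ ℚ.+ g m                       ≡⟨ ℚP.+-identityˡ (g m) ⟩
  g m                            ∎

1+X 1-X : S1
1+X = one ⊕ X
1-X = one ⊖ X

[1+X]⊛-zero : ∀ g → (1+X ⊛ g) 0 ≡ g 0
[1+X]⊛-zero g = trans (⊛-zero 1+X g) (ℚP.*-identityˡ (g 0))

[1+X]⊛-suc : ∀ g m → (1+X ⊛ g) (suc m) ≡ g m ℚ.+ g (suc m)
[1+X]⊛-suc g m = trans (⊛-distribʳ g one X (suc m)) (trans (cong₂ ℚ._+_ (⊛-identityˡ g (suc m)) (X⊛-suc g m)) (ℚP.+-comm (g (suc m)) (g m)))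

[1-X]⊛-zero : ∀ g → (1-X ⊛ g) 0 ≡ g 0
[1-X]⊛-zero g = trans (⊛-zero 1-X g) (ℚP.*-identityˡ (g 0))

[1-X]⊛-suc : ∀ g m → (1-X ⊛ g) (suc m) ≡ g (suc m) ℚ.+ ℚ.- g m
[1-X]⊛-suc g m = begin
  (1-X ⊛ g) (suc m)                        ≡⟨ ⊛-suc 1-X g m ⟩
  1ℚ ℚ.* g (suc m) ℚ.+ (tl 1-X ⊛ g) m          ≡⟨ cong₂ ℚ._+_ (ℚP.*-identityˡ (g (suc m))) (trans (⊛-congʳ g tl-1-X m) (c1-⊛ (ℚ.- 1ℚ) g m)) ⟩
  g (suc m) ℚ.+ ℚ.- 1ℚ ℚ.* g m                   ≡⟨ solve 2 (λ a b → a :+ con (ℚ.- 1ℚ) :* b := a :+ :- b) refl (g (suc m)) (g m) ⟩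
  g (suc m) ℚ.+ ℚ.- g m                        ∎
  where
  open ℚS using (solve; _:+_; _:*_; :-_; _:=_; con)
  tl-1-X : tl 1-X ≗ c1 (ℚ.- 1ℚ)
  tl-1-X zero    = refl
  tl-1-X (suc m) = refl

1/[1-X] : S1
1/[1-X] = inv 1-X

1/[1-X]⊛1-X : 1/[1-X] ⊛ 1-X ≗ one
1/[1-X]⊛1-X m = trans (⊛-comm 1/[1-X] 1-X m) (⊛-inverseʳ 1-X refl m)

1-X⊛-cancel : ∀ f g → 1-X ⊛ f ≗ g → f ≗ 1/[1-X] ⊛ g
1-X⊛-cancel f g p m = begin
  f m                              ≡⟨ sym (⊛-identityˡ f m) ⟩
  (one ⊛ f) m                      ≡⟨ ⊛-congʳ f (λ k → sym (1/[1-X]⊛1-X k)) m ⟩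
  ((1/[1-X] ⊛ 1-X) ⊛ f) m          ≡⟨ ⊛-assoc 1/[1-X] 1-X f m ⟩
  (1/[1-X] ⊛ (1-X ⊛ f)) m          ≡⟨ ⊛-congˡ 1/[1-X] p m ⟩
  (1/[1-X] ⊛ g) m                  ∎

partialSums : ∀ f g → f 0 ≡ g 0 → (∀ m → f (suc m) ≡ f m ℚ.+ g (suc m)) → f ≗ 1/[1-X] ⊛ g
partialSums f g p r = 1-X⊛-cancel f g λ
  { zero    → trans ([1-X]⊛-zero f) p
  ; (suc m) → trans ([1-X]⊛-suc f m) (trans (cong (ℚ._+ ℚ.- f m) (r m))
      (solve 2 (λ a b → a :+ b :+ :- a := b) refl (f m) (g (suc m)))) }
  where open ℚS using (solve; _:+_; _:*_; :-_; _:=_; con)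

-- The hypotheses are the coefficients of (1 - x) f = (1 + x) g.
R⊛-char : ∀ f g → f 0 ≡ g 0 → (∀ m → f (suc m) ≡ f m ℚ.+ (g m ℚ.+ g (suc m))) → f ≗ R ⊛ g
R⊛-char f g p r m = begin
  f m                         ≡⟨ partialSums f (1+X ⊛ g) (trans p (sym ([1+X]⊛-zero g))) (λ k → trans (r k) (cong (f k ℚ.+_) (sym ([1+X]⊛-suc g k)))) m ⟩
  (1/[1-X] ⊛ (1+X ⊛ g)) m     ≡⟨ ⊛-solve 3 (λ a b c → a ⊙ (b ⊙ c) ⊜ (b ⊙ a) ⊙ c) (λ _ → refl) 1/[1-X] 1+X g m ⟩
  (R ⊛ g) m                   ∎

4X : S1
4X = four ·₁ X

R²U : S1
R²U = R ⊛ (R ⊛ U)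

U-cancel : (1+X ⊛ 1+X) ⊛ U ≗ 4X
U-cancel m = begin
  ((1+X ⊛ 1+X) ⊛ (4X ⊛ inv (1+X ^₁ 2))) m
    ≡⟨ ⊛-solve 3 (λ a b c → (a ⊙ a) ⊙ (b ⊙ c) ⊜ b ⊙ ((a ⊙ (a ⊙ ⊛-ε)) ⊙ c)) (λ _ → refl) 1+X 4X (inv (1+X ^₁ 2)) m ⟩
  (4X ⊛ ((1+X ^₁ 2) ⊛ inv (1+X ^₁ 2))) m
    ≡⟨ ⊛-congˡ 4X (⊛-inverseʳ (1+X ^₁ 2) refl) m ⟩
  (4X ⊛ one) m
    ≡⟨ trans (⊛-comm 4X one m) (⊛-identityˡ 4X m) ⟩
  4X m ∎

-- The denominator (1+x)² of U cancels against the two numerators of R².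
R²U-eq : R²U ≗ 4X ⊛ (1/[1-X] ⊛ 1/[1-X])
R²U-eq m = begin
  (R ⊛ (R ⊛ U)) m
    ≡⟨ ⊛-solve 3 (λ a b c → (a ⊙ b) ⊙ ((a ⊙ b) ⊙ c) ⊜ ((a ⊙ a) ⊙ c) ⊙ (b ⊙ b)) (λ _ → refl) 1+X 1/[1-X] U m ⟩
  (((1+X ⊛ 1+X) ⊛ U) ⊛ (1/[1-X] ⊛ 1/[1-X])) m
    ≡⟨ ⊛-congʳ (1/[1-X] ⊛ 1/[1-X]) U-cancel m ⟩
  (4X ⊛ (1/[1-X] ⊛ 1/[1-X])) m ∎

-- The hypotheses say (1 - x) f = 4x h, and U R (1 + x) = 4x/(1 - x). The factor is kept in this
-- form because a peak is to contribute U and each position R.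
UR⊛-char : ∀ f h → f 0 ≡ 0ℚ → (∀ m → f (suc m) ≡ f m ℚ.+ four ℚ.* h m) → f ≗ U ⊛ (R ⊛ (1+X ⊛ h))
UR⊛-char f h p r m = begin
  f m
    ≡⟨ partialSums f (4X ⊛ h) (trans p (sym (trans (⊛-zero 4X h) (ℚP.*-zeroˡ (h 0))))) (λ k → trans (r k) (cong (f k ℚ.+_) (sym (trans (·₁-⊛ four X h (suc k)) (cong (four ℚ.*_) (X⊛-suc h k)))))) m ⟩
  (1/[1-X] ⊛ (4X ⊛ h)) m
    ≡⟨ ⊛-congˡ 1/[1-X] (⊛-congʳ h (λ k → sym (U-cancel k))) m ⟩
  (1/[1-X] ⊛ (((1+X ⊛ 1+X) ⊛ U) ⊛ h)) m
    ≡⟨ ⊛-solve 4 (λ a b c e → b ⊙ (((a ⊙ a) ⊙ c) ⊙ e) ⊜ c ⊙ ((a ⊙ b) ⊙ (a ⊙ e))) (λ _ → refl) 1+X 1/[1-X] U h m ⟩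
  (U ⊛ (R ⊛ (1+X ⊛ h))) m ∎

-- Counting compatible sequences

module Count (sg : ℕ → Bool) where

  -- This is `cnt` with the alphabet forgotten: the sequences decrease, so those beginning with b
  -- use letters up to b only, whatever q > b is.
  ct : List Bool → ℕ → ℕ
  ct []       b = 1
  ct (e ∷ ds) b = Σ< b (ct ds) + ⟦ eqB e (sg b) ⟧ * ct ds b

  Σ<-ok : ∀ q e b (f : ℕ → ℕ) → b < q → Σ< q (λ c → ⟦ Letters.ok sg q e b c ⟧ * f c) ≡ Σ< b f + ⟦ eqB e (sg b) ⟧ * f b
  Σ<-ok q e b f b<q = go q b<q
    where
    open Letters sg q
    go : ∀ r → b < r → Σ< r (λ c → ⟦ ok e b c ⟧ * f c) ≡ Σ< b f + ⟦ eqB e (sg b) ⟧ * f b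
    go (suc r) (s≤s b≤r) with m≤n⇒m<n∨m≡n b≤r
    ... | inj₁ b<r = trans (cong₂ _+_ (go r b<r) (cong (λ z → ⟦ z ⟧ * f r) (ok-> e b<r))) (+-identityʳ _)
    ... | inj₂ refl = cong₂ _+_ (Σ<-cong b (λ c c<b → trans (cong (λ z → ⟦ z ⟧ * f c) (ok-< e c<b)) (+-identityʳ (f c))))
                                (cong (λ z → ⟦ z ⟧ * f b) (ok-≡ e b))

  cnt≡ct : ∀ q ds b → b < q → Letters.cnt sg q ds b ≡ ct ds b
  cnt≡ct q []       b p = refl
  cnt≡ct q (e ∷ ds) b p = trans (Σ<-cong q (λ c c<q → cong (⟦ ok e b c ⟧ *_) (cnt≡ct q ds c c<q))) (Σ<-ok q e b (ct ds) p)
    where open Letters sg q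

  E≡ : ∀ q ds → Letters.E sg q ds ≡ Σ< q (ct ds)
  E≡ q ds = Σ<-cong q (cnt≡ct q ds)

-- Peaks: letters grouped into pairs of opposite parity

sgn : ℕ → Bool
sgn zero    = true
sgn (suc c) = not (sgn c)

dbl : ℕ → ℕ
dbl zero    = zero
dbl (suc k) = suc (suc (dbl k))

dbl≡2* : ∀ k → dbl k ≡ 2 * k
dbl≡2* zero    = refl
dbl≡2* (suc k) = trans (cong (suc ∘ suc) (dbl≡2* k)) (cong suc (sym (+-suc k (k + 0))))

sgn-dbl : ∀ k → sgn (dbl k) ≡ true
sgn-dbl zero    = refl
sgn-dbl (suc k) = trans (not-involutive _) (sgn-dbl k)

pkP : List Bool → ℕ
pkP []                  = 0
pkP (false ∷ ds)        = pkP ds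
pkP (true ∷ [])         = 0
pkP (true ∷ true ∷ ds)  = pkP (true ∷ ds)
pkP (true ∷ false ∷ ds) = suc (pkP ds)

ℕ→ℚ-≡+ : ∀ {a} b c → a ≡ b + c → ℕ→ℚ a ≡ ℕ→ℚ b ℚ.+ ℕ→ℚ c
ℕ→ℚ-≡+ b c p = trans (cong ℕ→ℚ p) (ℕ→ℚ-+ b c)

R⊛-charℕ : ∀ (f g : ℕ → ℕ) → f 0 ≡ g 0 → (∀ m → f (suc m) ≡ f m + (g m + g (suc m))) → ℕ→ℚ ∘ f ≗ R ⊛ (ℕ→ℚ ∘ g)
R⊛-charℕ f g p r = R⊛-char (ℕ→ℚ ∘ f) (ℕ→ℚ ∘ g) (cong ℕ→ℚ p)
  (λ m → trans (ℕ→ℚ-≡+ (f m) (g m + g (suc m)) (r m)) (cong (ℕ→ℚ (f m) ℚ.+_) (ℕ→ℚ-+ (g m) (g (suc m)))))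

1/[1-X]-coeff : ∀ m → 1/[1-X] m ≡ 1ℚ
1/[1-X]-coeff m = sym (trans (partialSums (λ _ → 1ℚ) one refl (λ _ → sym (ℚP.+-identityʳ 1ℚ)) m)
  (trans (⊛-comm 1/[1-X] one m) (⊛-identityˡ 1/[1-X] m)))

prefix-series : ∀ (f : ℕ → ℕ) (g : ℕ → ℕ) → f 0 ≡ 0 → (∀ m → f (suc m) ≡ f m + g m) → ℕ→ℚ ∘ f ≗ 1/[1-X] ⊛ (X ⊛ (ℕ→ℚ ∘ g))
prefix-series f g p r = partialSums (ℕ→ℚ ∘ f) (X ⊛ (ℕ→ℚ ∘ g)) (trans (cong ℕ→ℚ p) (sym (X⊛-zero (ℕ→ℚ ∘ g))))
  (λ m → trans (ℕ→ℚ-≡+ (f m) (g m) (r m)) (cong (ℕ→ℚ (f m) ℚ.+_) (sym (X⊛-suc (ℕ→ℚ ∘ g) m))))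

module Peaks where
  open Count sgn public

  -- lo and hi count the sequences that begin with 2k and 2k+1, the k-th pair of letters.
  Pr lo hi y : List Bool → ℕ → ℕ
  Pr ds k = Σ< (dbl k) (ct ds)
  lo ds k = ct ds (dbl k)
  hi ds k = ct ds (suc (dbl k))
  y  ds k = lo ds k + hi ds k

  yS : List Bool → S1
  yS ds k = ℕ→ℚ (y ds k)

  lo-true : ∀ ds k → lo (true ∷ ds) k ≡ Pr ds k + lo ds k
  lo-true ds k rewrite sgn-dbl k = cong (Pr ds k +_) (+-identityʳ _)

  hi-true : ∀ ds k → hi (true ∷ ds) k ≡ Pr ds k + lo ds k
  hi-true ds k rewrite sgn-dbl k = +-identityʳ _

  lo-false : ∀ ds k → lo (false ∷ ds) k ≡ Pr ds k
  lo-false ds k rewrite sgn-dbl k = +-identityʳ _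

  hi-false : ∀ ds k → hi (false ∷ ds) k ≡ Pr ds (suc k)
  hi-false ds k rewrite sgn-dbl k = cong (Pr ds k + lo ds k +_) (+-identityʳ _)

  -- Over a descent 2k may not be repeated and 2k+1 may, so the k-th pair contributes `Pr ds k` +
  -- `Pr ds (suc k)`. Consecutive values then differ by the contributions of pairs k and k+1 to
  -- `ds`.
  y-false : ∀ ds → yS (false ∷ ds) ≗ R ⊛ yS ds
  y-false ds = R⊛-charℕ (y (false ∷ ds)) (y ds) (cong₂ _+_ (lo-false ds 0) (hi-false ds 0)) step
    where
    open ℕS using (solve; _:+_; _:*_; _:=_; con)
    step : ∀ m → y (false ∷ ds) (suc m) ≡ y (false ∷ ds) m + (y ds m + y ds (suc m))
    step m rewrite lo-false ds (suc m) | hi-false ds (suc m) | lo-false ds m | hi-false ds m =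
      solve 5 (λ p a b c e → ((p :+ a) :+ b) :+ ((((p :+ a) :+ b) :+ c) :+ e) := (p :+ ((p :+ a) :+ b)) :+ ((a :+ b) :+ (c :+ e))) refl
        (Pr ds m) (lo ds m) (hi ds m) (lo ds (suc m)) (hi ds (suc m))

  -- Over an ascent both letters of a pair contribute `Pr` + `lo`, with increment 2 (hi k + lo
  -- (k+1)). If lo = hi this is y k + y (k+1). That hypothesis holds for the empty pattern and
  -- before a further ascent; the remaining case is a peak.
  y-true : ∀ ds → (∀ k → lo ds k ≡ hi ds k) → yS (true ∷ ds) ≗ R ⊛ yS ds
  y-true ds lo≡hi = R⊛-charℕ (y (true ∷ ds)) (y ds) (cong₂ _+_ (lo-true ds 0) (trans (hi-true ds 0) (lo≡hi 0))) step
    where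
    open ℕS using (solve; _:+_; _:*_; _:=_; con)
    step : ∀ m → y (true ∷ ds) (suc m) ≡ y (true ∷ ds) m + (y ds m + y ds (suc m))
    step m rewrite lo-true ds (suc m) | hi-true ds (suc m) | lo-true ds m | hi-true ds m | sym (lo≡hi m) | sym (lo≡hi (suc m)) =
      solve 3 (λ p a c → (((p :+ a) :+ a) :+ c) :+ (((p :+ a) :+ a) :+ c) := ((p :+ a) :+ (p :+ a)) :+ ((a :+ a) :+ (c :+ c))) refl
        (Pr ds m) (lo ds m) (lo ds (suc m))

  hiS : List Bool → S1
  hiS ds k = ℕ→ℚ (hi ds k)

  lo-after-false : ∀ ds k → lo (false ∷ ds) (suc k) ≡ hi (false ∷ ds) k
  lo-after-false ds k = trans (lo-false ds (suc k)) (sym (hi-false ds k))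

  y-after-false : ∀ ds → yS (false ∷ ds) ≗ 1+X ⊛ hiS (false ∷ ds)
  y-after-false ds zero    = trans (cong (λ z → ℕ→ℚ (z + hi (false ∷ ds) 0)) (lo-false ds 0)) (sym ([1+X]⊛-zero (hiS (false ∷ ds))))
  y-after-false ds (suc k) = trans (ℕ→ℚ-≡+ (hi (false ∷ ds) k) (hi (false ∷ ds) (suc k)) (cong (_+ hi (false ∷ ds) (suc k)) (lo-after-false ds k))) (sym ([1+X]⊛-suc (hiS (false ∷ ds)) k))

  -- When the rest begins with a descent, its lo (k+1) equals hi k. The increment 2 (hi k + lo
  -- (k+1)) becomes 4 hi k, while y of the rest is (1 + x) hi. Comparing the two produces the factor
  -- U.
  y-peak : ∀ ds → yS (true ∷ false ∷ ds) ≗ U ⊛ (R ⊛ yS (false ∷ ds))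
  y-peak ds m = trans (UR⊛-char (yS (true ∷ w)) (hiS w)
      (cong ℕ→ℚ (trans (cong₂ _+_ (lo-true w 0) (hi-true w 0)) (cong₂ _+_ (lo-false ds 0) (lo-false ds 0))))
      (λ k → trans (ℕ→ℚ-≡+ (y (true ∷ w) k) (4 * hi w k) (step k)) (cong (yS (true ∷ w) k ℚ.+_) (ℕ→ℚ-* 4 (hi w k)))) m)
    (⊛-congˡ U (⊛-congˡ R (λ k → sym (y-after-false ds k))) m)
    where
    open ℕS using (solve; _:+_; _:*_; _:=_; con)
    w = false ∷ ds
    step : ∀ k → y (true ∷ w) (suc k) ≡ y (true ∷ w) k + 4 * hi w k
    step k rewrite lo-true w (suc k) | hi-true w (suc k) | lo-true w k | hi-true w k | lo-after-false ds k =
      solve 3 (λ p a b → (((p :+ a) :+ b) :+ b) :+ (((p :+ a) :+ b) :+ b) := ((p :+ a) :+ (p :+ a)) :+ con 4 :* b) refl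
        (Pr w k) (lo w k) (hi w k)

  base : S1
  base = c1 (ℕ→ℚ 2) ⊛ 1/[1-X]

  R⊛-rearrange : ∀ f g h → R ⊛ (f ⊛ (g ⊛ h)) ≗ (R ⊛ f) ⊛ (g ⊛ h)
  R⊛-rearrange f g h m = sym (⊛-assoc R f (g ⊛ h) m)

  y-series : ∀ ds → yS ds ≗ (R ^₁ length ds) ⊛ ((U ^₁ pkP ds) ⊛ base)
  y-series [] m = begin
    ℕ→ℚ 2                            ≡⟨ sym (ℚP.*-identityʳ (ℕ→ℚ 2)) ⟩
    ℕ→ℚ 2 ℚ.* 1ℚ                     ≡⟨ cong (ℕ→ℚ 2 ℚ.*_) (sym (1/[1-X]-coeff m)) ⟩
    ℕ→ℚ 2 ℚ.* 1/[1-X] m              ≡⟨ sym (c1-⊛ (ℕ→ℚ 2) 1/[1-X] m) ⟩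
    base m                           ≡⟨ sym (trans (⊛-identityˡ (one ⊛ base) m) (⊛-identityˡ base m)) ⟩
    (one ⊛ (one ⊛ base)) m           ∎
  y-series (false ∷ ds) m = trans (y-false ds m) (trans (⊛-congˡ R (y-series ds) m) (R⊛-rearrange (R ^₁ length ds) (U ^₁ pkP ds) base m))
  y-series (true ∷ []) m = trans (y-true [] (λ _ → refl) m) (trans (⊛-congˡ R (y-series []) m) (R⊛-rearrange one one base m))
  y-series (true ∷ true ∷ ds) m = trans (y-true (true ∷ ds) (λ k → trans (lo-true ds k) (sym (hi-true ds k))) m)
    (trans (⊛-congˡ R (y-series (true ∷ ds)) m) (R⊛-rearrange (R ^₁ suc (length ds)) (U ^₁ pkP (true ∷ ds)) base m))
  y-series (true ∷ false ∷ ds) m = trans (y-peak ds m) (trans (⊛-congˡ U (⊛-congˡ R (y-series (false ∷ ds))) m)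
    (⊛-solve 5 (λ u r a b c → u ⊙ (r ⊙ (a ⊙ (b ⊙ c))) ⊜ (r ⊙ a) ⊙ ((u ⊙ b) ⊙ c))
      (λ _ → refl) U R (R ^₁ suc (length ds)) (U ^₁ pkP ds) base m))

  -- `Pr` adds up y over the pairs below i, hence is x/(1-x) times `y-series`, whose `base` is
  -- 2/(1-x). After doubling, the factor 4x/(1-x)² is R² U, which accounts for the two extra factors
  -- R and the extra U.
  peak-series : ∀ ds i → ((R ^₁ suc (suc (length ds))) ⊛ (U ^₁ suc (pkP ds))) i ≡ ℕ→ℚ (2 * Pr ds i)
  peak-series ds i = sym (begin
    ℕ→ℚ (2 * Pr ds i)
      ≡⟨ ℕ→ℚ-* 2 (Pr ds i) ⟩
    ℕ→ℚ 2 ℚ.* ℕ→ℚ (Pr ds i)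
      ≡⟨ sym (c1-⊛ (ℕ→ℚ 2) (ℕ→ℚ ∘ Pr ds) i) ⟩
    (c2′ ⊛ (ℕ→ℚ ∘ Pr ds)) i
      ≡⟨ ⊛-congˡ c2′ (λ k → trans (prefix-series (Pr ds) (y ds) refl (λ m → +-assoc (Pr ds m) (lo ds m) (hi ds m)) k)
           (⊛-congˡ 1/[1-X] (⊛-congˡ X (y-series ds)) k)) i ⟩
    (c2′ ⊛ (1/[1-X] ⊛ (X ⊛ (Rn ⊛ (Up ⊛ (c2′ ⊛ 1/[1-X])))))) i
      ≡⟨ ⊛-solve 5 (λ a b x r u → a ⊙ (b ⊙ (x ⊙ (r ⊙ (u ⊙ (a ⊙ b))))) ⊜ ((a ⊙ a) ⊙ x) ⊙ ((b ⊙ b) ⊙ (r ⊙ u)))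
           (λ _ → refl) c2′ 1/[1-X] X Rn Up i ⟩
    (((c2′ ⊛ c2′) ⊛ X) ⊛ ((1/[1-X] ⊛ 1/[1-X]) ⊛ (Rn ⊛ Up))) i
      ≡⟨ ⊛-congʳ ((1/[1-X] ⊛ 1/[1-X]) ⊛ (Rn ⊛ Up)) c4 i ⟩
    (4X ⊛ ((1/[1-X] ⊛ 1/[1-X]) ⊛ (Rn ⊛ Up))) i
      ≡⟨ sym (⊛-assoc 4X (1/[1-X] ⊛ 1/[1-X]) (Rn ⊛ Up) i) ⟩
    ((4X ⊛ (1/[1-X] ⊛ 1/[1-X])) ⊛ (Rn ⊛ Up)) i
      ≡⟨ ⊛-congʳ (Rn ⊛ Up) (λ k → sym (R²U-eq k)) i ⟩
    (R²U ⊛ (Rn ⊛ Up)) i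
      ≡⟨ ⊛-solve 4 (λ r u a b → (r ⊙ (r ⊙ u)) ⊙ (a ⊙ b) ⊜ (r ⊙ (r ⊙ a)) ⊙ (u ⊙ b))
           (λ _ → refl) R U Rn Up i ⟩
    ((R ^₁ suc (suc (length ds))) ⊛ (U ^₁ suc (pkP ds))) i ∎)
    where
    c2′ Rn Up : S1
    c2′ = c1 (ℕ→ℚ 2)
    Rn = R ^₁ length ds
    Up = U ^₁ pkP ds
    c4 : (c2′ ⊛ c2′) ⊛ X ≗ 4X
    c4 m = trans (⊛-assoc c2′ c2′ X m) (trans (c1-⊛ (ℕ→ℚ 2) (c2′ ⊛ X) m) (trans (cong (ℕ→ℚ 2 ℚ.*_) (c1-⊛ (ℕ→ℚ 2) X m)) (sym (ℚP.*-assoc (ℕ→ℚ 2) (ℕ→ℚ 2) (X m)))))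

-- Chains in the linear order on pairs of letters

^₁-+ : ∀ f m n → f ^₁ (m + n) ≗ (f ^₁ m) ⊛ (f ^₁ n)
^₁-+ f zero    n k = sym (⊛-identityˡ (f ^₁ n) k)
^₁-+ f (suc m) n k = trans (⊛-congˡ f (^₁-+ f m n) k) (sym (⊛-assoc f (f ^₁ m) (f ^₁ n) k))

-- A single row of the order: 2j letters, of which the even ones may be repeated, placed above rows
-- whose chains are counted by `s`. `T n c` counts the chains of n elements that may follow c, and
-- `W c n` those that use only the lower rows and the c lowest letters of this row.
module Row (j : ℕ) (s : ℕ → ℕ) (T : ℕ → ℕ → ℕ)
  (T-zero : ∀ c → c < dbl j → T 0 c ≡ s 0)
  (T-suc : ∀ n c → c < dbl j → T (suc n) c ≡ s (suc n) + (Σ< c (T n) + ⟦ sgn c ⟧ * T n c)) where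

  W : ℕ → ℕ → ℕ
  W c zero    = s 0
  W c (suc n) = s (suc n) + Σ< c (T n)

  T-even : ∀ k n → dbl k < dbl j → T n (dbl k) ≡ W (suc (dbl k)) n
  T-even k zero    p = T-zero (dbl k) p
  T-even k (suc n) p = trans (T-suc n (dbl k) p) (cong (λ z → s (suc n) + (Σ< (dbl k) (T n) + z))
    (trans (cong (λ z → ⟦ z ⟧ * T n (dbl k)) (sgn-dbl k)) (+-identityʳ _)))

  T-odd : ∀ k n → suc (dbl k) < dbl j → T n (suc (dbl k)) ≡ W (suc (dbl k)) n
  T-odd k zero    p = T-zero (suc (dbl k)) p
  T-odd k (suc n) p = trans (T-suc n (suc (dbl k)) p) (cong (s (suc n) +_)
    (trans (cong (λ z → Σ< (suc (dbl k)) (T n) + ⟦ not z ⟧ * T n (suc (dbl k))) (sgn-dbl k)) (+-identityʳ _)))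

  -- The repeatable letter 2k multiplies by 1/(1-x) and the letter 2k+1 by 1+x. The intermediate
  -- series v is eliminated through `twice`, the identity (1+x) v + (1-x) v = 2v.
  W-step : ∀ k → suc (dbl k) < dbl j → ℕ→ℚ ∘ W (dbl (suc k)) ≗ R ⊛ (ℕ→ℚ ∘ W (dbl k))
  W-step k p = R⊛-charℕ (W (dbl (suc k))) (W (dbl k)) refl step
    where
    open ℕS using (solve; _:+_; _:*_; _:=_; con)
    v = W (suc (dbl k))
    v-suc : ∀ n → v (suc n) ≡ W (dbl k) (suc n) + v n
    v-suc n = trans (sym (+-assoc (s (suc n)) _ _)) (cong (W (dbl k) (suc n) +_) (T-even k n (<-trans (n<1+n _) p)))
    w-suc : ∀ n → W (dbl (suc k)) (suc n) ≡ v (suc n) + v n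
    w-suc n = trans (sym (+-assoc (s (suc n)) _ _)) (cong (v (suc n) +_) (T-odd k n p))
    twice : ∀ n → W (dbl (suc k)) n + W (dbl k) n ≡ v n + v n
    twice zero    = refl
    twice (suc n) rewrite w-suc n | v-suc n =
      solve 2 (λ a b → ((a :+ b) :+ b) :+ a := (a :+ b) :+ (a :+ b)) refl (W (dbl k) (suc n)) (v n)
    step : ∀ n → W (dbl (suc k)) (suc n) ≡ W (dbl (suc k)) n + (W (dbl k) n + W (dbl k) (suc n))
    step n = begin
      W (dbl (suc k)) (suc n)                               ≡⟨ w-suc n ⟩
      v (suc n) + v n                                       ≡⟨ cong (_+ v n) (v-suc n) ⟩
      (W (dbl k) (suc n) + v n) + v n                       ≡⟨ trans (+-assoc _ (v n) (v n)) (+-comm _ (v n + v n)) ⟩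
      (v n + v n) + W (dbl k) (suc n)                       ≡⟨ cong (_+ W (dbl k) (suc n)) (sym (twice n)) ⟩
      (W (dbl (suc k)) n + W (dbl k) n) + W (dbl k) (suc n) ≡⟨ +-assoc (W (dbl (suc k)) n) _ _ ⟩
      W (dbl (suc k)) n + (W (dbl k) n + W (dbl k) (suc n)) ∎

  W-series : ∀ k → k ≤ j → ℕ→ℚ ∘ W (dbl k) ≗ (R ^₁ k) ⊛ (ℕ→ℚ ∘ s)
  W-series zero    p zero    = sym (⊛-identityˡ (ℕ→ℚ ∘ s) 0)
  W-series zero    p (suc n) = trans (cong ℕ→ℚ (+-identityʳ (s (suc n)))) (sym (⊛-identityˡ (ℕ→ℚ ∘ s) (suc n)))
  W-series (suc k) p n = trans (W-step k (dbl-mono p) n)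
    (trans (⊛-congˡ R (W-series k (≤-trans (n≤1+n k) p)) n) (sym (⊛-assoc R (R ^₁ k) (ℕ→ℚ ∘ s) n)))
    where
    dbl-mono : ∀ {k j} → suc k ≤ j → suc (suc (dbl k)) ≤ dbl j
    dbl-mono {zero}  {suc j} (s≤s p) = s≤s (s≤s z≤n)
    dbl-mono {suc k} {suc j} (s≤s p) = s≤s (s≤s (dbl-mono p))

module Chains (j : ℕ) where
  q : ℕ
  q = dbl j
  open Letters sgn q
  open Count sgn using (ct; Σ<-ok)

  Σw-+ : ∀ n (Φ Ψ : List ℕ → ℕ) → Σw n (λ v → Φ v + Ψ v) ≡ Σw n Φ + Σw n Ψ
  Σw-+ zero    Φ Ψ = refl
  Σw-+ (suc n) Φ Ψ = trans (Σ<-cong′ q (λ b → Σw-+ n (λ v → Φ (b ∷ v)) (λ v → Ψ (b ∷ v)))) (Σ<-+ q _ _)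

  Σw-* : ∀ n k (Φ : List ℕ → ℕ) → Σw n (λ v → k * Φ v) ≡ k * Σw n Φ
  Σw-* zero    k Φ = refl
  Σw-* (suc n) k Φ = trans (Σ<-cong′ q (λ b → Σw-* n k (λ v → Φ (b ∷ v)))) (Σ<-* q k _)

  Σw-Σ< : ∀ n m (f : List ℕ → ℕ → ℕ) → Σw n (λ v → Σ< m (f v)) ≡ Σ< m (λ i → Σw n (λ v → f v i))
  Σw-Σ< n zero    f = Σw-* n 0 (λ _ → 0)
  Σw-Σ< n (suc m) f = trans (Σw-+ n (λ v → Σ< m (f v)) (λ v → f v m)) (cong (_+ Σw n (λ v → f v m)) (Σw-Σ< n m f))

  -- T n b c counts the weakly decreasing chains of n pairs of letters below the pair (b , c).
  T : ℕ → ℕ → ℕ → ℕ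
  T n b c = Σw n (λ v → ct (patFrom (ok true) c v) b)

  S : ℕ → ℕ → ℕ
  S B zero    = 1
  S B (suc n) = Σ< B (λ b → Σ< q (T n b))

  -- The next pair lies in a lower row or in the row of b. There the condition on letters is
  -- `ok true c c′` for even b and its negation for odd b: the order is lexicographic, with every
  -- odd row reversed.
  T-suc : ∀ n b c → T (suc n) b c ≡ S b (suc n) + Σ< q (λ c′ → ⟦ eqB (ok true c c′) (sgn b) ⟧ * T n b c′)
  T-suc n b c = begin
    Σ< q (λ c′ → Σw n (λ v → Σ< b (ct (patFrom (ok true) c′ v)) + ⟦ eqB (ok true c c′) (sgn b) ⟧ * ct (patFrom (ok true) c′ v) b))
      ≡⟨ Σ<-cong′ q (λ c′ → trans (Σw-+ n _ _) (cong₂ _+_ (Σw-Σ< n b (λ v → ct (patFrom (ok true) c′ v))) (Σw-* n ⟦ eqB (ok true c c′) (sgn b) ⟧ _))) ⟩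
    Σ< q (λ c′ → Σ< b (λ b′ → T n b′ c′) + ⟦ eqB (ok true c c′) (sgn b) ⟧ * T n b c′)
      ≡⟨ Σ<-+ q _ _ ⟩
    Σ< q (λ c′ → Σ< b (λ b′ → T n b′ c′)) + Σ< q (λ c′ → ⟦ eqB (ok true c c′) (sgn b) ⟧ * T n b c′)
      ≡⟨ cong (_+ Σ< q (λ c′ → ⟦ eqB (ok true c c′) (sgn b) ⟧ * T n b c′)) (Σ<-swap q b (λ c′ b′ → T n b′ c′)) ⟩
    S b (suc n) + Σ< q (λ c′ → ⟦ eqB (ok true c c′) (sgn b) ⟧ * T n b c′) ∎

  sgn-reverse : ∀ j c → c < dbl j → sgn (dbl j ∸ suc c) ≡ not (sgn c)
  sgn-reverse (suc j) zero          p             = cong not (sgn-dbl j)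
  sgn-reverse (suc j) (suc zero)    p             = sgn-dbl j
  sgn-reverse (suc j) (suc (suc c)) (s≤s (s≤s p)) = trans (sgn-reverse j c p) (sym (not-involutive _))

  reverse-< : ∀ {c c′} → c′ < q → c < c′ → q ∸ suc c′ < q ∸ suc c
  reverse-< p r = ∸-monoʳ-< (s≤s r) p

  -- An odd row is reversed and its repeatable letters are the odd ones. As q is even, the
  -- reflection of the letters undoes both, so that `Row` applies to odd rows as well.
  ok-reverse : ∀ c c′ → c < q → c′ < q → not (ok true (q ∸ suc c) (q ∸ suc c′)) ≡ ok true c c′
  ok-reverse c c′ p p′ = trans (sym (ok-complement (q ∸ suc c) (q ∸ suc c′))) (go (<-cmp c c′))
    where
    go : _ → ok false (q ∸ suc c′) (q ∸ suc c) ≡ ok true c c′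
    go (tri< c<c′ _ _) = trans (ok-> false (reverse-< p′ c<c′)) (sym (ok-> true c<c′))
    go (tri≈ _ refl _) = trans (ok-≡ false (q ∸ suc c)) (trans (cong not (sgn-reverse j c p)) (trans (not-involutive (sgn c)) (sym (ok-≡ true c))))
    go (tri> _ _ c′<c) = trans (ok-< false (reverse-< p c′<c)) (sym (ok-< true c′<c))

  eqB-true : ∀ e → eqB e true ≡ e
  eqB-true true  = refl
  eqB-true false = refl

  eqB-false : ∀ e → eqB e false ≡ not e
  eqB-false true  = refl
  eqB-false false = refl

  -- Each row has j repeatable and j unrepeatable letters, whatever the parity of b.
  S-step : ∀ b → ℕ→ℚ ∘ S (suc b) ≗ (R ^₁ j) ⊛ (ℕ→ℚ ∘ S b)
  S-step b n with sgn b in eq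
  ... | true = trans (cong ℕ→ℚ (same n)) (W-series j ≤-refl n)
    where
    open Row j (S b) (λ n c → T n b c) (λ _ _ → refl)
      (λ n c p → trans (T-suc n b c) (cong (S b (suc n) +_)
        (trans (Σ<-cong′ q (λ c′ → cong (λ z → ⟦ z ⟧ * T n b c′) (trans (cong (eqB (ok true c c′)) eq) (eqB-true (ok true c c′)))))
          (Σ<-ok q true c (T n b) p))))
    same : ∀ n → S (suc b) n ≡ W q n
    same zero    = refl
    same (suc n) = refl
  ... | false = trans (cong ℕ→ℚ (same n)) (W-series j ≤-refl n)
    where
    T′ : ℕ → ℕ → ℕ
    T′ n c = T n b (q ∸ suc c)
    open Row j (S b) T′ (λ _ _ → refl)
      (λ n c p → trans (T-suc n b (q ∸ suc c)) (cong (S b (suc n) +_) (begin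
        Σ< q (λ c′ → ⟦ eqB (ok true (q ∸ suc c) c′) (sgn b) ⟧ * T n b c′)
          ≡⟨ Σ<-reverse q _ ⟩
        Σ< q (λ c′ → ⟦ eqB (ok true (q ∸ suc c) (q ∸ suc c′)) (sgn b) ⟧ * T′ n c′)
          ≡⟨ Σ<-cong q (λ c′ p′ → cong (λ z → ⟦ z ⟧ * T′ n c′) (trans (cong (eqB (ok true (q ∸ suc c) (q ∸ suc c′))) eq) (trans (eqB-false (ok true (q ∸ suc c) (q ∸ suc c′))) (ok-reverse c c′ p p′)))) ⟩
        Σ< q (λ c′ → ⟦ ok true c c′ ⟧ * T′ n c′)
          ≡⟨ Σ<-ok q true c (T′ n) p ⟩
        Σ< c (T′ n) + ⟦ sgn c ⟧ * T′ n c ∎)))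
    same : ∀ n → S (suc b) n ≡ W q n
    same zero    = refl
    same (suc n) = cong (S b (suc n) +_) (Σ<-reverse q (T n b))

  S-series : ∀ B → ℕ→ℚ ∘ S B ≗ R ^₁ (B * j)
  S-series zero    zero    = refl
  S-series zero    (suc n) = refl
  S-series (suc B) n = trans (S-step B n) (trans (⊛-congˡ (R ^₁ j) (S-series B) n) (sym (^₁-+ R j (B * j) n)))

  words≡S : ∀ n p → Σw (suc n) (λ v → Σ< p (ct (pat (ok true) v))) ≡ S p (suc n)
  words≡S n p = trans (Σ<-cong′ q (λ c → Σw-Σ< n p (λ v → ct (patFrom (ok true) c v)))) (Σ<-swap q p (λ c b → T n b c))

  ΣC-const : ∀ ds k → ΣC ds (λ _ → k) ≡ k * Σ< q (ct ds)
  ΣC-const ds k = trans (Σ<-cong′ q (λ b → trans (Σc-cong ds b (λ _ _ → sym (*-identityʳ k))) (Σc-* ds b k (λ _ → 1))))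
    (trans (Σ<-* q k _) (cong (k *_) (Count.E≡ sgn q ds)))

-- The count for the inverse is written as a sum over compatible g (`ΣC-const`). `standardization`
-- fuses π and g into a word on 2j letters with the pattern of π, and this word with a sequence on
-- 2i letters over that pattern is a chain of pairs.
two-sided : ∀ n i j →
  ℕ→ℚ (ΣS (suc n) (λ π → Σ< (dbl i) (Peaks.ct (pat _<ᵇ_ π)) * Σ< (dbl j) (Peaks.ct (pat _<ᵇ_ (invL (suc n) π))))) ≡ (R ^₁ (2 * i * j)) (suc n)
two-sided n i j = begin
  ℕ→ℚ (ΣS (suc n) (λ π → e (pat _<ᵇ_ π) * Σ< (dbl j) (Peaks.ct (pat _<ᵇ_ (invL (suc n) π)))))
    ≡⟨ cong ℕ→ℚ (ΣA-cong′ (suc n) (upTo (suc n)) (λ π → sym (ΣC-const (pat _<ᵇ_ (invL (suc n) π)) (e (pat _<ᵇ_ π))))) ⟩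
  ℕ→ℚ (ΣS (suc n) (λ π → ΣC (pat _<ᵇ_ (invL (suc n) π)) (λ _ → e (pat _<ᵇ_ π))))
    ≡⟨ cong ℕ→ℚ (sym (standardization n (λ ds _ → e ds))) ⟩
  ℕ→ℚ (Σw (suc n) (λ v → e (pat (ok true) v)))
    ≡⟨ cong ℕ→ℚ (words≡S n (dbl i)) ⟩
  ℕ→ℚ (S (dbl i) (suc n))
    ≡⟨ S-series (dbl i) (suc n) ⟩
  (R ^₁ (dbl i * j)) (suc n)
    ≡⟨ cong (λ z → (R ^₁ (z * j)) (suc n)) (dbl≡2* i) ⟩
  (R ^₁ (2 * i * j)) (suc n) ∎
  where
  open Chains j
  open Letters sgn (dbl j)
  e : List Bool → ℕ
  e ds = Σ< (dbl i) (Peaks.ct ds)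

-- Descents and powers

desP : List Bool → ℕ
desP []           = 0
desP (true ∷ ds)  = desP ds
desP (false ∷ ds) = suc (desP ds)

module Descents where
  open Count (λ _ → true) public

  ctS : List Bool → S1
  ctS ds b = ℕ→ℚ (ct ds b)

  ctS-true : ∀ ds → ctS (true ∷ ds) ≗ 1/[1-X] ⊛ ctS ds
  ctS-true ds = partialSums (ctS (true ∷ ds)) (ctS ds) (cong ℕ→ℚ (+-identityʳ (ct ds 0)))
    (λ m → ℕ→ℚ-≡+ (ct (true ∷ ds) m) (ct ds (suc m)) (cong₂ _+_ (cong (Σ< m (ct ds) +_) (sym (+-identityʳ (ct ds m)))) (+-identityʳ (ct ds (suc m)))))

  ctS-false : ∀ ds → ctS (false ∷ ds) ≗ 1/[1-X] ⊛ (X ⊛ ctS ds)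
  ctS-false ds = prefix-series (ct (false ∷ ds)) (ct ds) refl
    (λ m → trans (+-identityʳ _) (cong (_+ ct ds m) (sym (+-identityʳ (Σ< m (ct ds))))))

  -- An ascent admits an equal or smaller next letter and multiplies by 1/(1-x); a descent demands a
  -- smaller one and multiplies by x/(1-x).
  ctS-series : ∀ ds → ctS ds ≗ (X ^₁ desP ds) ⊛ (1/[1-X] ^₁ suc (length ds))
  ctS-series [] m = trans (sym (1/[1-X]-coeff m)) (sym (trans (⊛-identityˡ (1/[1-X] ⊛ one) m) (trans (⊛-comm 1/[1-X] one m) (⊛-identityˡ 1/[1-X] m))))
  ctS-series (true ∷ ds) m = trans (ctS-true ds m) (trans (⊛-congˡ 1/[1-X] (ctS-series ds) m)
    (⊛-solve 3 (λ a b c → a ⊙ (b ⊙ c) ⊜ b ⊙ (a ⊙ c)) (λ _ → refl) 1/[1-X] (X ^₁ desP ds) (1/[1-X] ^₁ suc (length ds)) m))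
  ctS-series (false ∷ ds) m = trans (ctS-false ds m) (trans (⊛-congˡ 1/[1-X] (⊛-congˡ X (ctS-series ds)) m)
    (⊛-solve 4 (λ a x b c → a ⊙ (x ⊙ (b ⊙ c)) ⊜ (x ⊙ b) ⊙ (a ⊙ c)) (λ _ → refl) 1/[1-X] X (X ^₁ desP ds) (1/[1-X] ^₁ suc (length ds)) m))

  descent-series : ∀ ds i → ((X ^₁ suc (desP ds)) ⊛ (1/[1-X] ^₁ suc (suc (length ds)))) i ≡ ℕ→ℚ (Σ< i (ct ds))
  descent-series ds i = sym (trans (prefix-series (λ k → Σ< k (ct ds)) (ct ds) refl (λ _ → refl) i)
    (trans (⊛-congˡ 1/[1-X] (⊛-congˡ X (ctS-series ds)) i)
    (⊛-solve 4 (λ a x b c → a ⊙ (x ⊙ (b ⊙ c)) ⊜ (x ⊙ b) ⊙ (a ⊙ c)) (λ _ → refl) 1/[1-X] X (X ^₁ desP ds) (1/[1-X] ^₁ suc (length ds)) i)))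

  -- The new minimum is inserted into π itself here. By `ΣC-insert` each of the q letters finds
  -- exactly one place, so a further position multiplies the sum by q.
  one-sided : ∀ q n → ΣS (suc n) (λ π → Σ< q (ct (pat _<ᵇ_ π))) ≡ q ^ suc n
  one-sided q zero = trans (+-identityʳ _) (Σ<-const q 1)
  one-sided q (suc n) = begin
    ΣS (suc (suc n)) (λ π → Σ< q (ct (pat _<ᵇ_ π)))
      ≡⟨ ΣS-insert (suc n) (λ π → Σ< q (ct (pat _<ᵇ_ π))) ⟩
    ΣS (suc n) (λ σ → Σ< (suc (suc n)) (λ k → Σ< q (ct (pat _<ᵇ_ (ins k 0 (map suc σ))))))
      ≡⟨ ΣS-cong (suc n) step ⟩
    ΣS (suc n) (λ σ → q * Σ< q (ct (pat _<ᵇ_ σ)))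
      ≡⟨ ΣA-* (suc n) (upTo (suc n)) q (λ σ → Σ< q (ct (pat _<ᵇ_ σ))) ⟩
    q * ΣS (suc n) (λ σ → Σ< q (ct (pat _<ᵇ_ σ)))
      ≡⟨ cong (q *_) (one-sided q n) ⟩
    q ^ suc (suc n) ∎
    where
    open Letters (λ _ → true) q
    step : ∀ σ → σ ↭ upTo (suc n) → Σ< (suc (suc n)) (λ k → Σ< q (ct (pat _<ᵇ_ (ins k 0 (map suc σ))))) ≡ q * Σ< q (ct (pat _<ᵇ_ σ))
    step σ p = begin
      Σ< (suc (suc n)) (λ k → Σ< q (ct (pat _<ᵇ_ (ins k 0 (map suc σ)))))
        ≡⟨ Σ<-cong (suc (suc n)) (λ k k< → trans (sym (E≡ q (pat _<ᵇ_ (ins k 0 (map suc σ)))))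
             (cong E (pat-ins k σ (≤-trans (s≤s z≤n) (≤-reflexive (sym len))) (≤-trans (≤-pred k<) (≤-reflexive (sym len)))))) ⟩
      Σ< (suc (suc n)) (λ k → E (insPat k (pat _<ᵇ_ σ)))
        ≡⟨ cong (λ l → Σ< (suc (suc l)) (λ k → E (insPat k (pat _<ᵇ_ σ)))) (sym (length-pat σ len)) ⟩
      Σ< (suc (suc (length (pat _<ᵇ_ σ)))) (λ k → E (insPat k (pat _<ᵇ_ σ)))
        ≡⟨ ΣC-insert (pat _<ᵇ_ σ) (λ _ _ → 1) ⟩
      Σ< q (λ _ → E (pat _<ᵇ_ σ))
        ≡⟨ Σ<-const q (E (pat _<ᵇ_ σ)) ⟩
      q * E (pat _<ᵇ_ σ)
        ≡⟨ cong (q *_) (E≡ q (pat _<ᵇ_ σ)) ⟩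
      q * Σ< q (ct (pat _<ᵇ_ σ)) ∎
      where
      len : length σ ≡ suc n
      len = trans (↭-length p) (length-upTo (suc n))

-- Peaks and descents of permutations read off from their patterns

ΣL≡0⇒All : {A : Set} (xs : List A) (f : A → ℕ) → ΣL xs f ≡ 0 → All (λ x → f x ≡ 0) xs
ΣL≡0⇒All []       f p = []
ΣL≡0⇒All (x ∷ xs) f p = m+n≡0⇒m≡0 (f x) p ∷ ΣL≡0⇒All xs f (m+n≡0⇒n≡0 (f x) p)

-- The sum over Perms n of the indicator of f ≠ g vanishes.
Perms-≡ : ∀ n (f g : List ℕ → ℕ) → (∀ w → w ↭ upTo n → f w ≡ g w) → All (λ v → f (word v) ≡ g (word v)) (Perms n)
Perms-≡ n f g h = All.map (λ {v} → unindicate (f (word v)) (g (word v)))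
  (ΣL≡0⇒All (Perms n) (λ v → ⟦ not (f (word v) ≡ᵇ g (word v)) ⟧)
    (trans (ΣL-Perms n (λ w → ⟦ not (f w ≡ᵇ g w) ⟧))
      (trans (ΣS-cong n (λ w p → trans (cong (λ z → ⟦ not (z ≡ᵇ g w) ⟧) (h w p)) (cong (⟦_⟧ ∘ not) (≡ᵇ-refl (g w))))) (ΣA-zero n (upTo n)))))
  where
  unindicate : ∀ a b → ⟦ not (a ≡ᵇ b) ⟧ ≡ 0 → a ≡ b
  unindicate a b p with a ≡ᵇ b in eq
  ... | true = ≡ᵇ⇒≡ a b (subst Bool.T (sym eq) tt)

<ᵇ-flip : ∀ b c → b ≢ c → (c <ᵇ b) ≡ not (b <ᵇ c)
<ᵇ-flip zero    zero    p = contradiction refl p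
<ᵇ-flip zero    (suc c) p = refl
<ᵇ-flip (suc b) zero    p = refl
<ᵇ-flip (suc b) (suc c) p = <ᵇ-flip b c (p ∘ cong suc)

-- The pattern records `b <ᵇ c` where `pkL` tests `c <ᵇ b`; for distinct letters each is the
-- negation of the other.
pkL≡pkP : ∀ w → Unique w → pkL w ≡ pkP (pat _<ᵇ_ w)
pkL≡pkP []                _ = refl
pkL≡pkP (a ∷ [])          _ = refl
pkL≡pkP (a ∷ b ∷ [])      _ with a <ᵇ b
... | true  = refl
... | false = refl
pkL≡pkP (a ∷ b ∷ c ∷ r) (_ ∷ u@((b≢c ∷ _) ∷ _)) =
  trans (cong ((if (a <ᵇ b) ∧ (c <ᵇ b) then 1 else 0) +_) (pkL≡pkP (b ∷ c ∷ r) u)) step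
  where
  step : (if (a <ᵇ b) ∧ (c <ᵇ b) then 1 else 0) + pkP (pat _<ᵇ_ (b ∷ c ∷ r)) ≡ pkP (pat _<ᵇ_ (a ∷ b ∷ c ∷ r))
  step rewrite <ᵇ-flip b c b≢c with a <ᵇ b | b <ᵇ c
  ... | false | _     = refl
  ... | true  | true  = refl
  ... | true  | false = refl

desL≡desP : ∀ w → Unique w → desL w ≡ desP (pat _<ᵇ_ w)
desL≡desP []          _ = refl
desL≡desP (a ∷ [])    _ = refl
desL≡desP (a ∷ b ∷ r) ((a≢b ∷ _) ∷ u) rewrite <ᵇ-flip a b a≢b | desL≡desP (b ∷ r) u with a <ᵇ b
... | true  = refl
... | false = refl

at-posOf : ∀ {u w} → u ∈ w → at w (posOf u w) ≡ u
at-posOf {u} {a ∷ w} p with u ≡ᵇ a in eq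
... | true = sym (≡ᵇ⇒≡ u a (subst Bool.T (sym eq) tt))
at-posOf {u} {.u ∷ w} (here refl) | false with trans (sym (≡ᵇ-refl u)) eq
... | ()
at-posOf {u} {a ∷ w} (there p) | false = at-posOf p

-- On the letters of w, `at w` is a left inverse of taking positions.
Unique-invL : ∀ n w → w ↭ upTo n → Unique (invL n w)
Unique-invL n w p = subst Unique (sym (map-upTo (λ v → posOf v w) n))
  (AllPairsP.applyUpTo⁺₁ (λ v → posOf v w) n (λ i<j j<n eq → <⇒≢ i<j
    (trans (sym (at-posOf (mem (<-trans i<j j<n)))) (trans (cong (at w) eq) (at-posOf (mem j<n))))))
  where
  mem : ∀ {v} → v < n → v ∈ w
  mem v<n = ∈-resp-↭ (↭-sym p) (∈-upTo⁺ v<n)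

Unique-perm : ∀ {n w} → w ↭ upTo n → Unique w
Unique-perm {n} p = Unique-↭ (↭-sym p) (upTo⁺ n)

sumℚ-congAll : {B : Set} {f g : B → ℚ} {xs : List B} → All (λ x → f x ≡ g x) xs → sumℚ (map f xs) ≡ sumℚ (map g xs)
sumℚ-congAll []       = refl
sumℚ-congAll (p ∷ ps) = cong₂ ℚ._+_ p (sumℚ-congAll ps)

sumℚ-ℕ→ℚ : {B : Set} (f : B → ℕ) (xs : List B) → sumℚ (map (ℕ→ℚ ∘ f) xs) ≡ ℕ→ℚ (ΣL xs f)
sumℚ-ℕ→ℚ f []       = refl
sumℚ-ℕ→ℚ f (x ∷ xs) = trans (cong (ℕ→ℚ (f x) ℚ.+_) (sumℚ-ℕ→ℚ f xs)) (sym (ℕ→ℚ-+ (f x) _))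

sumℚ-zero : {B : Set} (xs : List B) → sumℚ (map (λ _ → 0ℚ) xs) ≡ 0ℚ
sumℚ-zero []       = refl
sumℚ-zero (x ∷ xs) = trans (ℚP.+-identityˡ _) (sumℚ-zero xs)

-- Two-variable series

⊛₂-cong : ∀ {f f′ g g′ : S2} → (∀ i j → f i j ≡ f′ i j) → (∀ i j → g i j ≡ g′ i j) → ∀ i j → (f ⊛₂ g) i j ≡ (f′ ⊛₂ g′) i j
⊛₂-cong p r i j = Σ≤-cong i (λ a → Σ≤-cong j (λ b → cong₂ ℚ._*_ (p a b) (r (i ∸ a) (j ∸ b))))

⊛₂-⊗ : ∀ f g h k i j → ((f ⊗ g) ⊛₂ (h ⊗ k)) i j ≡ (f ⊛ h) i ℚ.* (g ⊛ k) j
⊛₂-⊗ f g h k i j = begin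
  Σ≤ i (λ a → Σ≤ j (λ b → (f a ℚ.* g b) ℚ.* (h (i ∸ a) ℚ.* k (j ∸ b))))
    ≡⟨ Σ≤-cong i (λ a → trans (Σ≤-cong j (λ b →
         solve 4 (λ x y z w → (x :* y) :* (z :* w) := (x :* z) :* (y :* w)) refl (f a) (g b) (h (i ∸ a)) (k (j ∸ b))))
         (trans (sumℚ-* (f a ℚ.* h (i ∸ a)) (λ b → g b ℚ.* k (j ∸ b)) (upTo (suc j))) (ℚP.*-comm (f a ℚ.* h (i ∸ a)) _))) ⟩
  Σ≤ i (λ a → (g ⊛ k) j ℚ.* (f a ℚ.* h (i ∸ a)))
    ≡⟨ sumℚ-* ((g ⊛ k) j) (λ a → f a ℚ.* h (i ∸ a)) (upTo (suc i)) ⟩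
  (g ⊛ k) j ℚ.* (f ⊛ h) i
    ≡⟨ ℚP.*-comm ((g ⊛ k) j) _ ⟩
  (f ⊛ h) i ℚ.* (g ⊛ k) j ∎
  where open ℚS using (solve; _:+_; _:*_; :-_; _:=_; con)

^₂-⊗ : ∀ f g k i j → ((f ⊗ g) ^₂ k) i j ≡ (f ^₁ k) i ℚ.* (g ^₁ k) j
^₂-⊗ f g zero    i j = refl
^₂-⊗ f g (suc k) i j = trans (⊛₂-cong {f ⊗ g} {f ⊗ g} (λ _ _ → refl) (^₂-⊗ f g k) i j) (⊛₂-⊗ f g (f ^₁ k) (g ^₁ k) i j)

⊛₂-Σ₂ : {B : Set} (f : S2) (h : B → S2) (xs : List B) → ∀ i j → (f ⊛₂ Σ₂ (map h xs)) i j ≡ sumℚ (map (λ x → (f ⊛₂ h x) i j) xs)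
⊛₂-Σ₂ f h []       i j = trans (Σ≤-cong i (λ a → trans (Σ≤-cong j (λ b → zeroʳ (f a b) (i ∸ a) (j ∸ b))) (sumℚ-zero (upTo (suc j))))) (sumℚ-zero (upTo (suc i)))
  where
  zeroʳ : ∀ x a b → x ℚ.* c2 0ℚ a b ≡ 0ℚ
  zeroʳ x zero    b = trans (cong (x ℚ.*_) (ℚP.*-zeroˡ (c1 1ℚ b))) (ℚP.*-zeroʳ x)
  zeroʳ x (suc a) b = trans (cong (x ℚ.*_) (ℚP.*-zeroˡ (c1 1ℚ b))) (ℚP.*-zeroʳ x)
⊛₂-Σ₂ f h (x ∷ xs) i j = trans
  (trans (Σ≤-cong i (λ a → trans (Σ≤-cong j (λ b → ℚP.*-distribˡ-+ (f a b) _ _)) (sumℚ-+ (λ b → f a b ℚ.* h x (i ∸ a) (j ∸ b)) _ (upTo (suc j)))))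
         (sumℚ-+ (λ a → Σ≤ j (λ b → f a b ℚ.* h x (i ∸ a) (j ∸ b))) _ (upTo (suc i))))
  (cong ((f ⊛₂ h x) i j ℚ.+_) (⊛₂-Σ₂ f h xs i j))

F-sum : ∀ n i j → F n i j ≡ sumℚ (map (λ w → ((R ^₁ suc n) ⊛ (U ^₁ suc (pk w))) i ℚ.* ((R ^₁ suc n) ⊛ (U ^₁ suc (ipk w))) j) (Perms n))
F-sum n i j = trans (⊛₂-Σ₂ ((R ⊗ R) ^₂ suc n) (λ w → (U ^₁ suc (pk w)) ⊗ (U ^₁ suc (ipk w))) (Perms n) i j)
  (sumℚ-cong (Perms n) (λ w → trans
    (⊛₂-cong {g = (U ^₁ suc (pk w)) ⊗ (U ^₁ suc (ipk w))} (^₂-⊗ R R (suc n)) (λ _ _ → refl) i j)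
    (⊛₂-⊗ (R ^₁ suc n) (R ^₁ suc n) (U ^₁ suc (pk w)) (U ^₁ suc (ipk w)) i j)))

length-word : ∀ {n} → All (λ v → length (pat _<ᵇ_ (word v)) ≡ n) (Perms (suc n))
length-word {n} = Perms-≡ (suc n) (length ∘ pat _<ᵇ_) (λ _ → n)
  (λ w p → length-pat w (trans (↭-length p) (length-upTo (suc n))))

-- Each permutation contributes a product of a series in s and one in t, whose coefficients are
-- twice the numbers of compatible sequences (`peak-series`). The two factors 2 give the 4, and
-- `two-sided` sums what is left.
F-closed : ∀ n i j → F (suc n) i j ≡ four ℚ.* (R ^₁ (2 * i * j)) (suc n)
F-closed n i j = begin
  F (suc n) i j
    ≡⟨ F-sum (suc n) i j ⟩
  sumℚ (map (λ w → ((R ^₁ suc (suc n)) ⊛ (U ^₁ suc (pk w))) i ℚ.* ((R ^₁ suc (suc n)) ⊛ (U ^₁ suc (ipk w))) j) (Perms (suc n)))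
    ≡⟨ sumℚ-congAll (All.zipWith (λ { {w} (p , r) → cong₂ ℚ._*_ p r }) (side pkL (λ w → pat _<ᵇ_ w) i pk-eq len₁ , side (pkL ∘ invL (suc n)) (λ w → pat _<ᵇ_ (invL (suc n) w)) j ipk-eq len₂)) ⟩
  sumℚ (map (λ w → ℕ→ℚ (2 * Pr (pat _<ᵇ_ (word w)) i) ℚ.* ℕ→ℚ (2 * Pr (pat _<ᵇ_ (invL (suc n) (word w))) j)) (Perms (suc n)))
    ≡⟨ sumℚ-cong (Perms (suc n)) (λ w → trans (sym (ℕ→ℚ-* (2 * a w) (2 * b w)))
         (trans (cong ℕ→ℚ (solve 2 (λ x y → (con 2 :* x) :* (con 2 :* y) := con 4 :* (x :* y)) refl (a w) (b w))) (ℕ→ℚ-* 4 (a w * b w)))) ⟩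
  sumℚ (map (λ w → four ℚ.* ℕ→ℚ (a w * b w)) (Perms (suc n)))
    ≡⟨ sumℚ-* four (λ w → ℕ→ℚ (a w * b w)) (Perms (suc n)) ⟩
  four ℚ.* sumℚ (map (λ w → ℕ→ℚ (a w * b w)) (Perms (suc n)))
    ≡⟨ cong (four ℚ.*_) (trans (sumℚ-ℕ→ℚ (λ w → a w * b w) (Perms (suc n)))
         (trans (cong ℕ→ℚ (ΣL-Perms (suc n) (λ w → Pr (pat _<ᵇ_ w) i * Pr (pat _<ᵇ_ (invL (suc n) w)) j))) (two-sided n i j))) ⟩
  four ℚ.* (R ^₁ (2 * i * j)) (suc n) ∎
  where
  open ℕS using (solve; _:+_; _:*_; _:=_; con)
  open Peaks using (Pr; peak-series)
  a b : Vec (Fin (suc n)) (suc n) → ℕ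
  a w = Pr (pat _<ᵇ_ (word w)) i
  b w = Pr (pat _<ᵇ_ (invL (suc n) (word w))) j
  pk-eq : ∀ w → w ↭ upTo (suc n) → pkL w ≡ pkP (pat _<ᵇ_ w)
  pk-eq w p = pkL≡pkP w (Unique-perm p)
  ipk-eq : ∀ w → w ↭ upTo (suc n) → pkL (invL (suc n) w) ≡ pkP (pat _<ᵇ_ (invL (suc n) w))
  ipk-eq w p = pkL≡pkP (invL (suc n) w) (Unique-invL (suc n) w p)
  len₁ : ∀ w → w ↭ upTo (suc n) → length (pat _<ᵇ_ w) ≡ n
  len₁ w p = length-pat w (trans (↭-length p) (length-upTo (suc n)))
  len₂ : ∀ w → w ↭ upTo (suc n) → length (pat _<ᵇ_ (invL (suc n) w)) ≡ n
  len₂ w p = length-pat (invL (suc n) w) (length-invL (suc n) w)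
  side : (f : List ℕ → ℕ) (g : List ℕ → List Bool) (k : ℕ) → (∀ w → w ↭ upTo (suc n) → f w ≡ pkP (g w)) → (∀ w → w ↭ upTo (suc n) → length (g w) ≡ n) →
    All (λ v → ((R ^₁ suc (suc n)) ⊛ (U ^₁ suc (f (word v)))) k ≡ ℕ→ℚ (2 * Pr (g (word v)) k)) (Perms (suc n))
  side f g k p l = All.zipWith (λ { {v} (e , e′) → trans (cong₂ (λ x y → ((R ^₁ suc (suc x)) ⊛ (U ^₁ suc y)) k) (sym e′) e) (peak-series (g (word v)) k) })
    (Perms-≡ (suc n) f (pkP ∘ g) p , Perms-≡ (suc n) (length ∘ g) (λ _ → n) l)

-- Parts (a) and (b): powers of (1+x)/(1-x) in binomial form

R^-zero : ∀ m → (R ^₁ m) 0 ≡ 1ℚ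
R^-zero zero    = refl
R^-zero (suc m) = trans (⊛-zero R (R ^₁ m)) (trans (cong (R 0 ℚ.*_) (R^-zero m)) refl)

part-a : ∀ n i j → LHSa n i j ≡ RHSa n i j
part-a zero    i j = trans (cong₂ ℚ._*_ (1/[1-X]-coeff i) (1/[1-X]-coeff j)) (sym (R^-zero (2 * i * j)))
part-a (suc n) i j = begin
  (pos 1 ℚ./ 4) ℚ.* F (suc n) i j                                 ≡⟨ cong ((pos 1 ℚ./ 4) ℚ.*_) (F-closed n i j) ⟩
  (pos 1 ℚ./ 4) ℚ.* (four ℚ.* (R ^₁ (2 * i * j)) (suc n))         ≡⟨ sym (ℚP.*-assoc (pos 1 ℚ./ 4) four ((R ^₁ (2 * i * j)) (suc n))) ⟩
  1ℚ ℚ.* (R ^₁ (2 * i * j)) (suc n)                               ≡⟨ ℚP.*-identityˡ _ ⟩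
  (R ^₁ (2 * i * j)) (suc n)                                      ∎

-- The coefficients of (1+x)^m and (1-x)^(-m). For m = 0 truncated subtraction still gives the right
-- values, 0 C 0 = 1 and l C (l+1) = 0.
binomS multiS : ℕ → S1
binomS m k = ℕ→ℚ (m C k)
multiS m l = ℕ→ℚ ((m + l ∸ 1) C l)

[1+X]^-coeff : ∀ m → binomS m ≗ 1+X ^₁ m
[1+X]^-coeff zero    zero    = refl
[1+X]^-coeff zero    (suc k) = cong ℕ→ℚ (k>n⇒nCk≡0 {0} {suc k} (s≤s z≤n))
[1+X]^-coeff (suc m) k = trans (pascal k) (⊛-congˡ 1+X ([1+X]^-coeff m) k)
  where
  pascal : binomS (suc m) ≗ 1+X ⊛ binomS m
  pascal zero    = sym ([1+X]⊛-zero (binomS m))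
  pascal (suc k) = trans (ℕ→ℚ-≡+ (m C k) (m C suc k) (sym (nCk+nC[k+1]≡[n+1]C[k+1] m k))) (sym ([1+X]⊛-suc (binomS m) k))

1/[1-X]^-coeff : ∀ m → multiS m ≗ 1/[1-X] ^₁ m
1/[1-X]^-coeff zero    zero    = refl
1/[1-X]^-coeff zero    (suc l) = cong ℕ→ℚ (k>n⇒nCk≡0 (n<1+n l))
1/[1-X]^-coeff (suc m) l = trans (partialSums (multiS (suc m)) (multiS m) refl hockey-stick l) (⊛-congˡ 1/[1-X] (1/[1-X]^-coeff m) l)
  where
  hockey-stick : ∀ l → multiS (suc m) (suc l) ≡ multiS (suc m) l ℚ.+ multiS m (suc l)
  hockey-stick l = ℕ→ℚ-≡+ ((m + l) C l) ((m + suc l ∸ 1) C suc l)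
    (trans (cong (_C suc l) (+-suc m l)) (trans (sym (nCk+nC[k+1]≡[n+1]C[k+1] (m + l) l)) (cong (λ z → (m + l) C l + (z ∸ 1) C suc l) (sym (+-suc m l)))))

⊛-^₁ : ∀ f g m → (f ⊛ g) ^₁ m ≗ (f ^₁ m) ⊛ (g ^₁ m)
⊛-^₁ f g zero    k = sym (⊛-identityˡ one k)
⊛-^₁ f g (suc m) k = trans (⊛-congˡ (f ⊛ g) (⊛-^₁ f g m) k)
  (⊛-solve 4 (λ a b c e → (a ⊙ b) ⊙ (c ⊙ e) ⊜ (a ⊙ c) ⊙ (b ⊙ e)) (λ _ → refl) f g (f ^₁ m) (g ^₁ m) k)

R^-coeff : ∀ m n → (R ^₁ m) n ≡ Σ≤ n (λ k → ℕ→ℚ ((m C k) * ((m + (n ∸ k) ∸ 1) C (n ∸ k))))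
R^-coeff m n = begin
  (R ^₁ m) n                                   ≡⟨ ⊛-^₁ 1+X 1/[1-X] m n ⟩
  ((1+X ^₁ m) ⊛ (1/[1-X] ^₁ m)) n              ≡⟨ ⊛-cong (λ k → sym ([1+X]^-coeff m k)) (λ k → sym (1/[1-X]^-coeff m k)) n ⟩
  (binomS m ⊛ multiS m) n                      ≡⟨ Σ≤-cong n (λ k → sym (ℕ→ℚ-* (m C k) ((m + (n ∸ k) ∸ 1) C (n ∸ k)))) ⟩
  Σ≤ n (λ k → ℕ→ℚ ((m C k) * ((m + (n ∸ k) ∸ 1) C (n ∸ k)))) ∎

part-b : ∀ n → 1 ≤ n → ∀ i j → F n i j ≡ RHSb n i j
part-b (suc n) _ i j = trans (F-closed n i j) (cong (four ℚ.*_) (R^-coeff (2 * i * j) (suc n)))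

-- Eulerian polynomials as numerators of power sums

^₁-zero : ∀ f m → f 0 ≡ 1ℚ → (f ^₁ m) 0 ≡ 1ℚ
^₁-zero f zero    p = refl
^₁-zero f (suc m) p = trans (⊛-zero f (f ^₁ m)) (trans (cong₂ ℚ._*_ p (^₁-zero f m p)) refl)

inv-^₁ : ∀ f m → f 0 ≡ 1ℚ → inv (f ^₁ m) ≗ inv f ^₁ m
inv-^₁ f m p k = begin
  inv (f ^₁ m) k                                            ≡⟨ sym (trans (⊛-comm (inv (f ^₁ m)) one k) (⊛-identityˡ (inv (f ^₁ m)) k)) ⟩
  (inv (f ^₁ m) ⊛ one) k                                    ≡⟨ ⊛-congˡ (inv (f ^₁ m)) (λ l → sym (cancel l)) k ⟩
  (inv (f ^₁ m) ⊛ ((f ^₁ m) ⊛ (inv f ^₁ m))) k              ≡⟨ ⊛-solve 3 (λ a b c → a ⊙ (b ⊙ c) ⊜ (b ⊙ a) ⊙ c) (λ _ → refl) (inv (f ^₁ m)) (f ^₁ m) (inv f ^₁ m) k ⟩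
  (((f ^₁ m) ⊛ inv (f ^₁ m)) ⊛ (inv f ^₁ m)) k              ≡⟨ ⊛-congʳ (inv f ^₁ m) (⊛-inverseʳ (f ^₁ m) (^₁-zero f m p)) k ⟩
  (one ⊛ (inv f ^₁ m)) k                                    ≡⟨ ⊛-identityˡ (inv f ^₁ m) k ⟩
  (inv f ^₁ m) k                                            ∎
  where
  one^ : ∀ n → one ^₁ n ≗ one
  one^ zero    l = refl
  one^ (suc n) l = trans (⊛-identityˡ (one ^₁ n) l) (one^ n l)
  ^-cong : ∀ {g h} n → g ≗ h → g ^₁ n ≗ h ^₁ n
  ^-cong zero    e l = refl
  ^-cong (suc n) e l = ⊛-cong e (^-cong n e) l
  cancel : (f ^₁ m) ⊛ (inv f ^₁ m) ≗ one
  cancel l = trans (sym (⊛-^₁ f (inv f) m l)) (trans (^-cong m (⊛-inverseʳ f p) l) (one^ m l))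

Σ₁-⊛ : {B : Set} (h : B → S1) (g : S1) (xs : List B) → ∀ i → (Σ₁ (map h xs) ⊛ g) i ≡ sumℚ (map (λ x → (h x ⊛ g) i) xs)
Σ₁-⊛ h g []       i = trans (c1-⊛ 0ℚ g i) (ℚP.*-zeroˡ (g i))
Σ₁-⊛ h g (x ∷ xs) i = trans (⊛-distribʳ g (h x) (Σ₁ (map h xs)) i) (cong ((h x ⊛ g) i ℚ.+_) (Σ₁-⊛ h g xs i))

-- For k = 0 the series is 1/(1-s), in agreement with 0^0 = 1. For k > 0 each permutation
-- contributes its `descent-series`, and `one-sided` adds these up.
eulerian : ∀ k i → (A k ⊛ inv ((one ⊖ X) ^₁ suc k)) i ≡ ℕ→ℚ (i ^ k)
eulerian zero i = trans (⊛-identityˡ (inv (1-X ^₁ 1)) i) (trans (inv-^₁ 1-X 1 refl i)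
  (trans (⊛-comm 1/[1-X] one i) (trans (⊛-identityˡ 1/[1-X] i) (1/[1-X]-coeff i))))
eulerian (suc k) i = begin
  (A (suc k) ⊛ inv (1-X ^₁ suc (suc k))) i
    ≡⟨ ⊛-congˡ (A (suc k)) (inv-^₁ 1-X (suc (suc k)) refl) i ⟩
  (A (suc k) ⊛ (1/[1-X] ^₁ suc (suc k))) i
    ≡⟨ Σ₁-⊛ (λ w → X ^₁ suc (des w)) (1/[1-X] ^₁ suc (suc k)) (Perms (suc k)) i ⟩
  sumℚ (map (λ w → ((X ^₁ suc (des w)) ⊛ (1/[1-X] ^₁ suc (suc k))) i) (Perms (suc k)))
    ≡⟨ sumℚ-congAll (All.zipWith (λ { {w} (e , e′) → trans (cong₂ (λ x y → ((X ^₁ suc x) ⊛ (1/[1-X] ^₁ suc (suc y))) i) e (sym e′)) (descent-series (pat _<ᵇ_ (word w)) i) })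
         (Perms-≡ (suc k) desL (desP ∘ pat _<ᵇ_) (λ w p → desL≡desP w (Unique-perm p)) , length-word)) ⟩
  sumℚ (map (λ w → ℕ→ℚ (Σ< i (ct (pat _<ᵇ_ (word w))))) (Perms (suc k)))
    ≡⟨ sumℚ-ℕ→ℚ (λ w → Σ< i (ct (pat _<ᵇ_ (word w)))) (Perms (suc k)) ⟩
  ℕ→ℚ (ΣL (Perms (suc k)) (λ w → Σ< i (ct (pat _<ᵇ_ (word w)))))
    ≡⟨ cong ℕ→ℚ (trans (ΣL-Perms (suc k) (λ w → Σ< i (ct (pat _<ᵇ_ w)))) (one-sided i k)) ⟩
  ℕ→ℚ (i ^ suc k) ∎
  where
  open Descents using (ct; descent-series; one-sided)

-- Cycles

-- Run f i xs j: iterating f from i passes through exactly the points xs before arriving at j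
data Run (f : ℕ → ℕ) : ℕ → List ℕ → ℕ → Set where
  []   : ∀ {i} → Run f i [] i
  step : ∀ {i k xs j} → f i ≡ k → Run f k xs j → Run f i (i ∷ xs) j

-- The cycle of i is `i ∷ ys`; `fresh` makes the return to i the first one, which determines `ys`.
record Cycle (f : ℕ → ℕ) (i : ℕ) (ys : List ℕ) : Set where
  constructor cycle
  field
    run   : Run f (f i) ys i
    fresh : All (i ≢_) ys

Run-unique : ∀ {f x i ys zs} → Run f x ys i → Run f x zs i → All (i ≢_) ys → All (i ≢_) zs → ys ≡ zs
Run-unique []            []            _        _        = refl
Run-unique []            (step _ _)    _        (p ∷ _)  = contradiction refl p
Run-unique (step _ _)    []            (p ∷ _)  _        = contradiction refl p
Run-unique (step refl r) (step refl s) (_ ∷ ps) (_ ∷ qs) = cong (_ ∷_) (Run-unique r s ps qs)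

Cycle-unique : ∀ {f i ys zs} → Cycle f i ys → Cycle f i zs → ys ≡ zs
Cycle-unique (cycle r p) (cycle s q) = Run-unique r s p q

iter-shift : ∀ f m i → iter f m (f i) ≡ iter f (suc m) i
iter-shift f zero    i = refl
iter-shift f (suc m) i = cong f (iter-shift f m i)

-- `g` renumbers the steps, so that the search can advance by one while the run loses its first
-- point.
firstSat-Run : ∀ {f x i ys} → Run f x ys i → All (i ≢_) ys → ∀ n → length ys < n → (g : ℕ → ℕ) → (∀ k → iter f (g k) i ≡ iter f k x) →
  firstSat (λ m → iter f m i ≡ᵇ i) (applyUpTo g n) ≡ g (length ys)
firstSat-Run {i = i} [] _ (suc n) _ g h rewrite h 0 | ≡ᵇ-refl i = refl
firstSat-Run {f} {x} {i} (step refl r) (p ∷ ps) (suc n) (s≤s l) g h rewrite h 0 | ≢⇒≡ᵇ-false x i (p ∘ sym) =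
  firstSat-Run r ps n l (g ∘ suc) (λ k → trans (h (suc k)) (sym (iter-shift f k x)))

applyUpTo-Run : ∀ {f x i ys} → Run f x ys i → (g : ℕ → ℕ) → (∀ k → g k ≡ iter f k x) → applyUpTo g (length ys) ≡ ys
applyUpTo-Run []                      g h = refl
applyUpTo-Run {f} {x} (step refl r) g h = cong₂ _∷_ (h 0) (applyUpTo-Run r (g ∘ suc) (λ k → trans (h (suc k)) (sym (iter-shift f k x))))

abstract
  cycleOf : ℕ → List ℕ → ℕ → List ℕ
  cycleOf n w i = map (λ k → iter (at w) k i) (upTo (firstSat (λ m → iter (at w) m i ≡ᵇ i) (map suc (upTo n))))

  cycleOf-def : ∀ n w i → cycleOf n w i ≡ map (λ k → iter (at w) k i) (upTo (firstSat (λ m → iter (at w) m i ≡ᵇ i) (map suc (upTo n))))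
  cycleOf-def n w i = refl

cycleOf-Cycle : ∀ n w i {ys} → Cycle (at w) i ys → length ys < n → cycleOf n w i ≡ i ∷ ys
cycleOf-Cycle n w i {ys} (cycle r p) l = begin
  cycleOf n w i
    ≡⟨ cycleOf-def n w i ⟩
  map (λ k → iter (at w) k i) (upTo (firstSat (λ m → iter (at w) m i ≡ᵇ i) (map suc (upTo n))))
    ≡⟨ cong (λ k → map (λ k → iter (at w) k i) (upTo k)) (trans (cong (firstSat (λ m → iter (at w) m i ≡ᵇ i)) (map-upTo suc n))
         (firstSat-Run r p n l suc (λ k → sym (iter-shift (at w) k i)))) ⟩
  map (λ k → iter (at w) k i) (upTo (suc (length ys)))
    ≡⟨ map-upTo (λ k → iter (at w) k i) (suc (length ys)) ⟩
  i ∷ applyUpTo (λ k → iter (at w) (suc k) i) (length ys)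
    ≡⟨ cong (i ∷_) (applyUpTo-Run r (λ k → iter (at w) (suc k) i) (λ k → sym (iter-shift (at w) k i))) ⟩
  i ∷ ys ∎

-- Existence of cycles

at-∈ : ∀ w k → k < length w → at w k ∈ w
at-∈ (x ∷ w) zero    _       = here refl
at-∈ (x ∷ w) (suc k) (s≤s p) = there (at-∈ w k p)

at-injective : ∀ w → Unique w → ∀ {a b} → a < length w → b < length w → at w a ≡ at w b → a ≡ b
at-injective (x ∷ w) (_ ∷ u) {zero}  {zero}  _       _       e = refl
at-injective (x ∷ w) (p ∷ u) {zero}  {suc b} _       (s≤s l) e = contradiction e (All.lookup p (at-∈ w b l))
at-injective (x ∷ w) (p ∷ u) {suc a} {zero}  (s≤s l) _       e = contradiction (sym e) (All.lookup p (at-∈ w a l))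
at-injective (x ∷ w) (_ ∷ u) {suc a} {suc b} (s≤s l) (s≤s m) e = cong suc (at-injective w u l m e)

module _ (n : ℕ) (w : List ℕ) (w↭ : w ↭ upTo n) where

  private
    f : ℕ → ℕ
    f = at w
    len : length w ≡ n
    len = trans (↭-length w↭) (length-upTo n)

  at-< : ∀ {i} → i < n → f i < n
  at-< {i} p = ∈-upTo⁻ (∈-resp-↭ w↭ (at-∈ w i (≤-trans p (≤-reflexive (sym len)))))

  private
    iter-< : ∀ m {i} → i < n → iter f m i < n
    iter-< zero    p = p
    iter-< (suc m) p = at-< (iter-< m p)

    f-injective : ∀ {a b} → a < n → b < n → f a ≡ f b → a ≡ b
    f-injective p q = at-injective w (Unique-perm w↭) (≤-trans p (≤-reflexive (sym len))) (≤-trans q (≤-reflexive (sym len)))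

    iter-cancel : ∀ p e {i} → i < n → iter f p i ≡ iter f (p + e) i → i ≡ iter f e i
    iter-cancel zero    e l q = q
    iter-cancel (suc p) e l q = iter-cancel p e l (f-injective (iter-< p l) (iter-< (p + e) l) q)

    -- The walk is cut off at its first visit to i, which keeps i out of the points passed.
    arrive : ∀ m x i → iter f m x ≡ i → ∃ λ ys → Run f x ys i × All (i ≢_) ys × length ys ≤ m
    arrive m x i e with i ≟ x
    arrive m       x .x e | yes refl = [] , [] , [] , z≤n
    arrive zero    x i  e | no i≢x   = contradiction (sym e) i≢x
    arrive (suc m) x i  e | no i≢x   with arrive m (f x) i (trans (iter-shift f m x) e)
    ... | ys , r , p , l = x ∷ ys , step refl r , i≢x ∷ p , s≤s l

  abstract
    -- Two of the n+1 iterates with exponents 0 to n agree. Injectivity cancels the steps they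
    -- share, so i returns to itself after at most n steps, and `arrive` extracts the first return.
    cycle-exists : ∀ i → i < n → ∃ λ ys → Cycle f i ys × length ys < n
    cycle-exists i i<n with FinP.pigeonhole (n<1+n n) (λ k → Fin.fromℕ< (iter-< (Fin.toℕ k) i<n))
    ... | p , q , p<q , e = close (Fin.toℕ q ∸ suc (Fin.toℕ p)) (sym (m+[n∸m]≡n p<q))
      where
      close : ∀ m → Fin.toℕ q ≡ suc (Fin.toℕ p) + m → ∃ λ ys → Cycle f i ys × length ys < n
      close m q≡ with arrive m (f i) i (trans (iter-shift f m i) (sym (iter-cancel (Fin.toℕ p) (suc m) i<n
        (trans (FinP.fromℕ<-injective _ _ (iter-< (Fin.toℕ p) i<n) (iter-< (Fin.toℕ q) i<n) e) (cong (λ z → iter f z i) (trans q≡ (sym (+-suc (Fin.toℕ p) m))))))))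
      ... | ys , r , fr , l = ys , cycle r fr , ≤-trans (s≤s (≤-trans l (m≤n+m m (Fin.toℕ p)))) (≤-trans (≤-reflexive (sym q≡)) (≤-pred (FinP.toℕ<n q)))

  cycleOf-char : ∀ i {ys} → i < n → Cycle f i ys → cycleOf n w i ≡ i ∷ ys
  cycleOf-char i i<n c with cycle-exists i i<n
  ... | zs , c′ , l = trans (cycleOf-Cycle n w i c′ l) (cong (i ∷_) (Cycle-unique c′ c))

countZ : List ℕ → ℕ
countZ []           = 0
countZ (zero ∷ xs)  = suc (countZ xs)
countZ (suc _ ∷ xs) = countZ xs

-- The cycle through 0 is counted as if it were longer by c.
weight : ℕ → List ℕ → ℕ
weight c xs = length xs + c * countZ xs

oddC : ℕ → ℕ → List ℕ → ℕ → Bool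
oddC c n w i = isOdd (weight c (cycleOf n w i))

minC : ℕ → List ℕ → ℕ → Bool
minC n w i = and (map (i ≤ᵇ_) (cycleOf n w i))

allOdd : ℕ → ℕ → List ℕ → Bool
allOdd c n w = and (map (oddC c n w) (upTo n))

cycC : ℕ → List ℕ → ℕ
cycC n w = countB (map (minC n w) (upTo n))

all-upTo : ∀ {P : ℕ → Set} n → (∀ i → i < n → P i) → All P (upTo n)
all-upTo n h = AllP.applyUpTo⁺₁ id n (λ {i} → h i)

ins-↭ : {A : Set} → ∀ k (x : A) ys → ins k x ys ↭ x ∷ ys
ins-↭ zero    x ys       = ↭-refl
ins-↭ (suc k) x []       = ↭-refl
ins-↭ (suc k) x (y ∷ ys) = ↭-trans (prep y (ins-↭ k x ys)) (swap y x ↭-refl)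

and-ins : (p : ℕ → Bool) → ∀ k x ys → and (map p (ins k x ys)) ≡ p x ∧ and (map p ys)
and-ins p zero    x ys       = refl
and-ins p (suc k) x []       = refl
and-ins p (suc k) x (y ∷ ys) = begin
  p y ∧ and (map p (ins k x ys))     ≡⟨ cong (p y ∧_) (and-ins p k x ys) ⟩
  p y ∧ (p x ∧ and (map p ys))       ≡⟨ sym (∧-assoc (p y) (p x) _) ⟩
  (p y ∧ p x) ∧ and (map p ys)       ≡⟨ cong (_∧ and (map p ys)) (∧-comm (p y) (p x)) ⟩
  (p x ∧ p y) ∧ and (map p ys)       ≡⟨ ∧-assoc (p x) (p y) _ ⟩
  p x ∧ (p y ∧ and (map p ys))       ∎

countB-∷ : ∀ b bs → countB (b ∷ bs) ≡ ⟦ b ⟧ + countB bs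
countB-∷ true  bs = refl
countB-∷ false bs = refl

countB-ins : (p : ℕ → Bool) → ∀ k x ys → countB (map p (ins k x ys)) ≡ ⟦ p x ⟧ + countB (map p ys)
countB-ins p zero    x ys       = countB-∷ (p x) (map p ys)
countB-ins p (suc k) x []       = countB-∷ (p x) []
countB-ins p (suc k) x (y ∷ ys) = begin
  countB (p y ∷ map p (ins k x ys))            ≡⟨ countB-∷ (p y) _ ⟩
  ⟦ p y ⟧ + countB (map p (ins k x ys))        ≡⟨ cong (⟦ p y ⟧ +_) (countB-ins p k x ys) ⟩
  ⟦ p y ⟧ + (⟦ p x ⟧ + countB (map p ys))      ≡⟨ trans (sym (+-assoc ⟦ p y ⟧ ⟦ p x ⟧ _)) (trans (cong (_+ countB (map p ys)) (+-comm ⟦ p y ⟧ ⟦ p x ⟧)) (+-assoc ⟦ p x ⟧ ⟦ p y ⟧ _)) ⟩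
  ⟦ p x ⟧ + (⟦ p y ⟧ + countB (map p ys))      ≡⟨ cong (⟦ p x ⟧ +_) (sym (countB-∷ (p y) (map p ys))) ⟩
  ⟦ p x ⟧ + countB (p y ∷ map p ys)            ∎

punchIn-< : ∀ a {x n} → x < n → punchIn a x < suc n
punchIn-< zero    p                       = s≤s p
punchIn-< (suc a) {zero}  p               = s≤s z≤n
punchIn-< (suc a) {suc x} {suc n} (s≤s p) = s≤s (punchIn-< a p)

punchIn-injective : ∀ a {x y} → punchIn a x ≡ punchIn a y → x ≡ y
punchIn-injective zero                    e = suc-injective e
punchIn-injective (suc a) {zero}  {zero}  e = refl
punchIn-injective (suc a) {suc x} {suc y} e = cong suc (punchIn-injective a (suc-injective e))

punchIn-≢ : ∀ a x → a ≢ punchIn a x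
punchIn-≢ (suc a) (suc x) e = punchIn-≢ a x (suc-injective e)

punchIn-≤ᵇ : ∀ a x y → (punchIn a x <ᵇ suc (punchIn a y)) ≡ (x <ᵇ suc y)
punchIn-≤ᵇ zero    x       y       = refl
punchIn-≤ᵇ (suc a) zero    zero    = refl
punchIn-≤ᵇ (suc a) zero    (suc y) = refl
punchIn-≤ᵇ (suc a) (suc x) zero    = refl
punchIn-≤ᵇ (suc a) (suc x) (suc y) = punchIn-≤ᵇ a x y

-- Inserting b = suc a into the cycle of 0, directly after 0.
module InsertAfter0 (a : ℕ) where

  b : ℕ
  b = suc a

  -- Now 0 maps to b, and b to the old image of 0. `moveHead a` therefore carries that image to
  -- index a of the tail, which is index b of the whole word.
  insert : List ℕ → List ℕ
  insert σ = b ∷ map (punchIn b) (moveHead a σ)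

  at-map : ∀ L k → at (map (punchIn b) L) k ≡ punchIn b (at L k)
  at-map []      k       = refl
  at-map (x ∷ L) zero    = refl
  at-map (x ∷ L) (suc k) = at-map L k

  at-ins : ∀ a s r → a ≤ length r → at (ins a s r) a ≡ s
  at-ins zero    s r       p       = refl
  at-ins (suc a) s (y ∷ r) (s≤s p) = at-ins a s r p

  at-ins-punchIn : ∀ a s r i → a ≤ length r → at (ins a s r) (punchIn a i) ≡ at r i
  at-ins-punchIn zero    s r       i       p       = refl
  at-ins-punchIn (suc a) s (y ∷ r) zero    p       = refl
  at-ins-punchIn (suc a) s (y ∷ r) (suc i) (s≤s p) = at-ins-punchIn a s r i p

  expand : List ℕ → List ℕ
  expand []           = []
  expand (zero ∷ xs)  = 0 ∷ b ∷ expand xs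
  expand (suc x ∷ xs) = punchIn b (suc x) ∷ expand xs

  length-expand : ∀ xs → length (expand xs) ≡ length xs + countZ xs
  length-expand []           = refl
  length-expand (zero ∷ xs)  = cong suc (trans (cong suc (length-expand xs)) (sym (+-suc (length xs) (countZ xs))))
  length-expand (suc x ∷ xs) = cong suc (length-expand xs)

  countZ-expand : ∀ xs → countZ (expand xs) ≡ countZ xs
  countZ-expand []           = refl
  countZ-expand (zero ∷ xs)  = cong suc (countZ-expand xs)
  countZ-expand (suc x ∷ xs) = countZ-expand xs

  -- The new point lengthens only the cycle through 0, by one, which is what raising the offset c by
  -- one expresses.
  weight-expand : ∀ c xs → weight c (expand xs) ≡ weight (suc c) xs
  weight-expand c xs = trans (cong₂ (λ l z → l + c * z) (length-expand xs) (countZ-expand xs)) (+-assoc (length xs) (countZ xs) _)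

  min-expand : ∀ i xs → and (map (punchIn b i ≤ᵇ_) (expand xs)) ≡ and (map (i ≤ᵇ_) xs)
  min-expand zero    []           = refl
  min-expand zero    (zero ∷ xs)  = min-expand zero xs
  min-expand zero    (suc x ∷ xs) = min-expand zero xs
  min-expand (suc i) []           = refl
  min-expand (suc i) (zero ∷ xs)  = refl
  min-expand (suc i) (suc x ∷ xs) = cong₂ _∧_ (punchIn-≤ᵇ a i x) (min-expand (suc i) xs)

  fresh-suc : ∀ i {ys} → All (suc i ≢_) ys → All (punchIn b (suc i) ≢_) (expand ys)
  fresh-suc i {[]}         []       = []
  fresh-suc i {zero ∷ ys}  (_ ∷ ps) = (λ ()) ∷ (λ e → punchIn-≢ b (suc i) (sym e)) ∷ fresh-suc i ps
  fresh-suc i {suc y ∷ ys} (p ∷ ps) = (λ e → p (punchIn-injective b e)) ∷ fresh-suc i ps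

  fresh-zero : ∀ {ys} → All (0 ≢_) ys → All (0 ≢_) (expand ys)
  fresh-zero {[]}         []       = []
  fresh-zero {zero ∷ ys}  (p ∷ _)  = contradiction refl p
  fresh-zero {suc y ∷ ys} (_ ∷ ps) = (λ ()) ∷ fresh-zero ps

  fresh-b : ∀ {ys} → All (0 ≢_) ys → All (b ≢_) (expand ys)
  fresh-b {[]}         []       = []
  fresh-b {zero ∷ ys}  (p ∷ _)  = contradiction refl p
  fresh-b {suc y ∷ ys} (_ ∷ ps) = punchIn-≢ b (suc y) ∷ fresh-b ps

  module _ (n : ℕ) (s : ℕ) (r : List ℕ) (a<n : a < n) (σ↭ : s ∷ r ↭ upTo n) where

    private
      σ π : List ℕ
      σ = s ∷ r
      π = insert σ
      f g : ℕ → ℕ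
      f = at σ
      g = at π

      a≤ : a ≤ length r
      a≤ = ≤-pred (≤-trans a<n (≤-reflexive (sym (trans (↭-length σ↭) (length-upTo n)))))

      π↭ : π ↭ upTo (suc n)
      π↭ = ↭-trans (prep b (map⁺ (punchIn b) (↭-trans (ins-↭ a s r) σ↭)))
        (↭-trans (↭-sym (ins-↭ b b (map (punchIn b) (upTo n)))) (↭-reflexive (sym (upTo-ins n b a<n))))

      g-b : g b ≡ punchIn b (f 0)
      g-b = trans (at-map (ins a s r) a) (cong (punchIn b) (at-ins a s r a≤))

      g-suc : ∀ i → g (punchIn b (suc i)) ≡ punchIn b (f (suc i))
      g-suc i = trans (at-map (ins a s r) (punchIn a i)) (cong (punchIn b) (at-ins-punchIn a s r i a≤))

      Run-expand : ∀ {i xs j} → Run f i xs j → Run g (punchIn b i) (expand xs) (punchIn b j)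
      Run-expand []                         = []
      Run-expand {zero}  (step refl u)      = step refl (step g-b (Run-expand u))
      Run-expand {suc i} (step refl u)      = step (g-suc i) (Run-expand u)

      Run-∷ʳ : ∀ {i xs j k} → Run g i xs j → g j ≡ k → Run g i (xs ++ j ∷ []) k
      Run-∷ʳ []         e = step e []
      Run-∷ʳ (step q u) e = step q (Run-∷ʳ u e)

      cycle-zero : ∀ {ys} → Cycle f 0 ys → Cycle g 0 (b ∷ expand ys)
      cycle-zero (cycle u p) = cycle (step g-b (Run-expand u)) ((λ ()) ∷ fresh-zero p)

      cycle-suc : ∀ i {ys} → Cycle f (suc i) ys → Cycle g (punchIn b (suc i)) (expand ys)
      cycle-suc i (cycle u p) = cycle (subst (λ z → Run g z _ _) (sym (g-suc i)) (Run-expand u)) (fresh-suc i p)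

      cycle-b : ∀ {ys} → Cycle f 0 ys → Cycle g b (expand ys ++ 0 ∷ [])
      cycle-b (cycle u p) = cycle (subst (λ z → Run g z _ _) (sym g-b) (Run-∷ʳ (Run-expand u) refl)) (AllP.++⁺ (fresh-b p) ((λ ()) ∷ []))

    cycleOf-insert : ∀ i → i < n → cycleOf (suc n) π (punchIn b i) ≡ expand (cycleOf n σ i)
    cycleOf-insert i i<n with cycle-exists n σ σ↭ i i<n
    cycleOf-insert zero    i<n | ys , c , _ =
      trans (cycleOf-char (suc n) π π↭ 0 (s≤s z≤n) (cycle-zero c)) (cong expand (sym (cycleOf-char n σ σ↭ 0 i<n c)))
    cycleOf-insert (suc i) i<n | ys , c , _ =
      trans (cycleOf-char (suc n) π π↭ (punchIn b (suc i)) (punchIn-< b i<n) (cycle-suc i c)) (cong expand (sym (cycleOf-char n σ σ↭ (suc i) i<n c)))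

    private
      0<n : 0 < n
      0<n = ≤-trans (s≤s z≤n) a<n

      -- The cycle of b is that of 0 read from its second point. Hence b imposes no parity condition
      -- beyond that of 0, and it is not the minimum of its cycle.
      cycleOf-b : ∃ λ zs → cycleOf (suc n) π b ≡ b ∷ zs ++ 0 ∷ [] × expand (cycleOf n σ 0) ≡ 0 ∷ b ∷ zs
      cycleOf-b with cycle-exists n σ σ↭ 0 0<n
      ... | ys , c , _ = expand ys , cycleOf-char (suc n) π π↭ b (s≤s a<n) (cycle-b c) , cong expand (cycleOf-char n σ σ↭ 0 0<n c)

      countZ-++0 : ∀ zs → countZ (zs ++ 0 ∷ []) ≡ suc (countZ zs)
      countZ-++0 []           = refl
      countZ-++0 (zero ∷ zs)  = cong suc (countZ-++0 zs)
      countZ-++0 (suc _ ∷ zs) = countZ-++0 zs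

      and-++false : ∀ (p : ℕ → Bool) zs x → p x ≡ false → and (map p (zs ++ x ∷ [])) ≡ false
      and-++false p []       x e rewrite e = refl
      and-++false p (z ∷ zs) x e = trans (cong (p z ∧_) (and-++false p zs x e)) (∧-zeroʳ (p z))

    odd-insert : ∀ c i → i < n → oddC c (suc n) π (punchIn b i) ≡ oddC (suc c) n σ i
    odd-insert c i i<n = cong isOdd (trans (cong (weight c) (cycleOf-insert i i<n)) (weight-expand c (cycleOf n σ i)))

    odd-b : ∀ c → oddC c (suc n) π b ≡ oddC (suc c) n σ 0
    odd-b c = trans (cong isOdd weight-b) (odd-insert c 0 0<n)
      where
      zs : List ℕ
      zs = proj₁ cycleOf-b
      weight-b : weight c (cycleOf (suc n) π b) ≡ weight c (cycleOf (suc n) π 0)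
      weight-b = begin
        weight c (cycleOf (suc n) π b)    ≡⟨ cong (weight c) (proj₁ (proj₂ cycleOf-b)) ⟩
        weight c (b ∷ zs ++ 0 ∷ [])       ≡⟨ cong₂ (λ l z → suc l + c * z) (trans (length-++ zs) (+-comm (length zs) 1)) (countZ-++0 zs) ⟩
        weight c (0 ∷ b ∷ zs)             ≡⟨ cong (weight c) (sym (trans (cycleOf-insert 0 0<n) (proj₂ (proj₂ cycleOf-b)))) ⟩
        weight c (cycleOf (suc n) π 0)    ∎

    min-insert : ∀ i → i < n → minC (suc n) π (punchIn b i) ≡ minC n σ i
    min-insert i i<n = trans (cong (and ∘ map (punchIn b i ≤ᵇ_)) (cycleOf-insert i i<n)) (min-expand i (cycleOf n σ i))

    min-b : minC (suc n) π b ≡ false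
    min-b = trans (cong (and ∘ map (b ≤ᵇ_)) (proj₁ (proj₂ cycleOf-b)))
      (trans (cong ((b ≤ᵇ b) ∧_) (and-++false (b ≤ᵇ_) (proj₁ cycleOf-b) 0 refl)) (∧-zeroʳ (b ≤ᵇ b)))

    allOdd-insert : ∀ c → allOdd c (suc n) π ≡ allOdd (suc c) n σ
    allOdd-insert c = begin
      and (map (oddC c (suc n) π) (upTo (suc n)))
        ≡⟨ trans (cong (and ∘ map (oddC c (suc n) π)) (upTo-ins n b a<n)) (and-ins (oddC c (suc n) π) b b (map (punchIn b) (upTo n))) ⟩
      oddC c (suc n) π b ∧ and (map (oddC c (suc n) π) (map (punchIn b) (upTo n)))
        ≡⟨ cong₂ _∧_ (odd-b c) (cong and (trans (sym (map-∘ (upTo n))) (map-cong-local (all-upTo n (odd-insert c))))) ⟩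
      oddC (suc c) n σ 0 ∧ and (map (oddC (suc c) n σ) (upTo n))
        ≡⟨ absorb n 0<n (oddC (suc c) n σ) ⟩
      and (map (oddC (suc c) n σ) (upTo n)) ∎
      where
      absorb : ∀ n → 0 < n → (p : ℕ → Bool) → p 0 ∧ and (map p (upTo n)) ≡ and (map p (upTo n))
      absorb (suc n) _ p = trans (sym (∧-assoc (p 0) (p 0) _)) (cong (_∧ and (map p (applyUpTo suc n))) (∧-idem (p 0)))

    cycC-insert : cycC (suc n) π ≡ cycC n σ
    cycC-insert = begin
      countB (map (minC (suc n) π) (upTo (suc n)))
        ≡⟨ trans (cong (countB ∘ map (minC (suc n) π)) (upTo-ins n b a<n)) (countB-ins (minC (suc n) π) b b (map (punchIn b) (upTo n))) ⟩
      ⟦ minC (suc n) π b ⟧ + countB (map (minC (suc n) π) (map (punchIn b) (upTo n)))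
        ≡⟨ cong₂ _+_ (cong ⟦_⟧ min-b) (cong countB (trans (sym (map-∘ (upTo n))) (map-cong-local (all-upTo n min-insert)))) ⟩
      countB (map (minC n σ) (upTo n)) ∎

module FixedPoint (n : ℕ) (σ : List ℕ) (σ↭ : σ ↭ upTo n) where

  private
    π : List ℕ
    π = 0 ∷ map suc σ
    f g : ℕ → ℕ
    f = at σ
    g = at π

    π↭ : π ↭ upTo (suc n)
    π↭ = ↭-trans (prep 0 (map⁺ suc σ↭)) (↭-reflexive (sym (upTo-suc n)))

    at-suc : ∀ L i → i < length L → at (map suc L) i ≡ suc (at L i)
    at-suc (x ∷ L) zero    p       = refl
    at-suc (x ∷ L) (suc i) (s≤s p) = at-suc L i p

    g-suc : ∀ i → i < n → g (suc i) ≡ suc (f i)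
    g-suc i p = at-suc σ i (≤-trans p (≤-reflexive (sym (trans (↭-length σ↭) (length-upTo n)))))

    Run-suc : ∀ {i xs j} → i < n → Run f i xs j → Run g (suc i) (map suc xs) (suc j)
    Run-suc p []            = []
    Run-suc {i} p (step refl u) = step (g-suc i p) (Run-suc (at-< n σ σ↭ p) u)

    cycle-suc : ∀ i {ys} → i < n → Cycle f i ys → Cycle g (suc i) (map suc ys)
    cycle-suc i p (cycle u q) = cycle (subst (λ z → Run g z _ _) (sym (g-suc i p)) (Run-suc (at-< n σ σ↭ p) u))
      (AllP.map⁺ (All.map (λ i≢ e → i≢ (suc-injective e)) q))

    cycleOf-suc : ∀ i → i < n → cycleOf (suc n) π (suc i) ≡ map suc (cycleOf n σ i)
    cycleOf-suc i i<n with cycle-exists n σ σ↭ i i<n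
    ... | ys , c , _ = trans (cycleOf-char (suc n) π π↭ (suc i) (s≤s i<n) (cycle-suc i i<n c)) (cong (map suc) (sym (cycleOf-char n σ σ↭ i i<n c)))

    countZ-suc : ∀ xs → countZ (map suc xs) ≡ 0
    countZ-suc []       = refl
    countZ-suc (x ∷ xs) = countZ-suc xs

    ≤ᵇ-suc : ∀ x y → (suc x ≤ᵇ suc y) ≡ (x ≤ᵇ y)
    ≤ᵇ-suc zero    y = refl
    ≤ᵇ-suc (suc x) y = refl

    min-map-suc : ∀ i xs → and (map (suc i ≤ᵇ_) (map suc xs)) ≡ and (map (i ≤ᵇ_) xs)
    min-map-suc i []       = refl
    min-map-suc i (x ∷ xs) = cong₂ _∧_ (≤ᵇ-suc i x) (min-map-suc i xs)

    cycleOf-zero : cycleOf (suc n) π 0 ≡ 0 ∷ []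
    cycleOf-zero = cycleOf-char (suc n) π π↭ 0 (s≤s z≤n) (cycle [] [])

    odd-suc : ∀ c i → i < n → oddC c (suc n) π (suc i) ≡ oddC 0 n σ i
    odd-suc c i p rewrite cycleOf-suc i p | length-map suc (cycleOf n σ i) | countZ-suc (cycleOf n σ i) | *-zeroʳ c = refl

    min-suc : ∀ i → i < n → minC (suc n) π (suc i) ≡ minC n σ i
    min-suc i p rewrite cycleOf-suc i p = min-map-suc i (cycleOf n σ i)

  -- The cycle of the fixed point 0 has weight 1 + c. All other cycles avoid 0, and the point
  -- relabelled from the 0 of σ carries no offset, hence the 0 on the right.
  allOdd-fixed : ∀ c → allOdd c (suc n) π ≡ isOdd (suc c) ∧ allOdd 0 n σ
  allOdd-fixed c = trans (cong (and ∘ map (oddC c (suc n) π)) (upTo-suc n)) (cong₂ _∧_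
    (trans (cong (isOdd ∘ weight c) cycleOf-zero) (cong (isOdd ∘ suc) (*-identityʳ c)))
    (cong and (trans (sym (map-∘ (upTo n))) (map-cong-local (all-upTo n (odd-suc c))))))

  cycC-fixed : cycC (suc n) π ≡ suc (cycC n σ)
  cycC-fixed = trans (cong (countB ∘ map (minC (suc n) π)) (upTo-suc n)) (trans (countB-∷ (minC (suc n) π 0) _)
    (cong₂ _+_ (cong (λ L → ⟦ and (map (0 ≤ᵇ_) L) ⟧) cycleOf-zero)
      (cong countB (trans (sym (map-∘ (upTo n))) (map-cong-local (all-upTo n min-suc))))))

-- The recurrence for permutations with odd cycles

cycleSum : ℕ → ℕ → ℕ → ℕ
cycleSum c y n = ΣS n (λ w → ⟦ allOdd c n w ⟧ * y ^ cycC n w)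

-- The first letter is the successor of 0. If it is 0, a cycle splits off and gives the factor y.
-- Otherwise it is one of n letters `suc a`, and its removal raises the offset; `ΣA-moveHead` brings
-- the words into the form of `InsertAfter0`.
cycleSum-suc : ∀ c y n → cycleSum c y (suc n) ≡ ⟦ isOdd (suc c) ⟧ * (y * cycleSum 0 y n) + n * cycleSum (suc c) y n
cycleSum-suc c y n = begin
  ΣS (suc n) Φ
    ≡⟨ trans (ΣS-first n Φ) (Σ<-cons n _) ⟩
  ΣS n (λ σ → Φ (0 ∷ map suc σ)) + Σ< n (λ a → ΣS n (λ σ → Φ (suc a ∷ map (punchIn (suc a)) σ)))
    ≡⟨ cong₂ _+_ fixed (trans (Σ<-cong n moved) (Σ<-const n (cycleSum (suc c) y n))) ⟩
  ⟦ isOdd (suc c) ⟧ * (y * cycleSum 0 y n) + n * cycleSum (suc c) y n ∎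
  where
  open ℕS using (solve; _:+_; _:*_; _:=_; con)
  Φ : List ℕ → ℕ
  Φ w = ⟦ allOdd c (suc n) w ⟧ * y ^ cycC (suc n) w
  fixed : ΣS n (λ σ → Φ (0 ∷ map suc σ)) ≡ ⟦ isOdd (suc c) ⟧ * (y * cycleSum 0 y n)
  fixed = begin
    ΣS n (λ σ → Φ (0 ∷ map suc σ))
      ≡⟨ ΣS-cong n (λ σ p → trans (cong₂ (λ o k → ⟦ o ⟧ * y ^ k) (FixedPoint.allOdd-fixed n σ p c) (FixedPoint.cycC-fixed n σ p))
           (trans (cong (_* (y * y ^ cycC n σ)) (⟦∧⟧ (isOdd (suc c)) (allOdd 0 n σ)))
             (solve 4 (λ o u z k → (o :* u) :* (z :* k) := o :* (z :* (u :* k))) refl ⟦ isOdd (suc c) ⟧ ⟦ allOdd 0 n σ ⟧ y (y ^ cycC n σ)))) ⟩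
    ΣS n (λ σ → ⟦ isOdd (suc c) ⟧ * (y * (⟦ allOdd 0 n σ ⟧ * y ^ cycC n σ)))
      ≡⟨ trans (ΣA-* n (upTo n) ⟦ isOdd (suc c) ⟧ (λ σ → y * (⟦ allOdd 0 n σ ⟧ * y ^ cycC n σ)))
           (cong (⟦ isOdd (suc c) ⟧ *_) (ΣA-* n (upTo n) y (λ σ → ⟦ allOdd 0 n σ ⟧ * y ^ cycC n σ))) ⟩
    ⟦ isOdd (suc c) ⟧ * (y * cycleSum 0 y n) ∎
  moved : ∀ a → a < n → ΣS n (λ σ → Φ (suc a ∷ map (punchIn (suc a)) σ)) ≡ cycleSum (suc c) y n
  moved a a<n = trans (sym (ΣA-moveHead a n (upTo n) (λ σ → Φ (suc a ∷ map (punchIn (suc a)) σ)) (sym (length-upTo n))))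
    (ΣS-cong n perm)
    where
    perm : ∀ σ → σ ↭ upTo n → Φ (suc a ∷ map (punchIn (suc a)) (moveHead a σ)) ≡ ⟦ allOdd (suc c) n σ ⟧ * y ^ cycC n σ
    perm []      p = contradiction (trans (↭-length p) (length-upTo n)) (<⇒≢ (≤-trans (s≤s z≤n) a<n))
    perm (s ∷ r) p = cong₂ (λ o k → ⟦ o ⟧ * y ^ k) (InsertAfter0.allOdd-insert a n s r a<n p c) (InsertAfter0.cycC-insert a n s r a<n p)

isOdd-+2 : ∀ z m → isOdd (z + (z + m)) ≡ isOdd m
isOdd-+2 zero    m = refl
isOdd-+2 (suc z) m = trans (cong (isOdd ∘ suc) (+-suc z (z + m))) (isOdd-+2 z m)

-- Only the parity of the offset matters. Removing two points in succession thus returns to the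
-- original sum, which is what closes the recurrence.
cycleSum-periodic : ∀ y n → cycleSum 2 y n ≡ cycleSum 0 y n
cycleSum-periodic y n = ΣA-cong′ n (upTo n) (λ w → cong (λ o → ⟦ o ⟧ * y ^ cycC n w) (cong and (map-cong-local (all-upTo n (λ i _ →
  trans (cong isOdd (solve 2 (λ l z → l :+ con 2 :* z := z :+ (z :+ (l :+ con 0))) refl (length (cycleOf n w i)) (countZ (cycleOf n w i))))
    (isOdd-+2 (countZ (cycleOf n w i)) _))))))
  where open ℕS using (solve; _:+_; _:*_; _:=_; con)

cycleSum-recurrence : ∀ y n → cycleSum 0 y (suc (suc n)) ≡ y * cycleSum 0 y (suc n) + suc n * (n * cycleSum 0 y n)
cycleSum-recurrence y n = trans (cycleSum-suc 0 y (suc n)) (cong₂ _+_ (+-identityʳ (y * cycleSum 0 y (suc n)))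
  (cong (suc n *_) (trans (cycleSum-suc 1 y n) (cong (n *_) (cycleSum-periodic y n)))))

allCyclesOdd≡ : ∀ {n} (v : Vec (Fin n) n) → allCyclesOdd v ≡ allOdd 0 n (word v)
allCyclesOdd≡ {n} v = cong and (map-cong (λ i → cong isOdd (sym (trans (+-identityʳ _)
  (trans (cong length (cycleOf-def n (word v) i)) (trans (length-map _ (upTo (cycLen v i))) (length-upTo (cycLen v i))))))) (upTo n))

cyc≡ : ∀ {n} (v : Vec (Fin n) n) → cyc v ≡ cycC n (word v)
cyc≡ {n} v = cong countB (map-cong (λ i → cong and (sym (trans (cong (map (i ≤ᵇ_)) (cycleOf-def n (word v) i)) (sym (map-∘ (upTo (cycLen v i))))))) (upTo n))

countB-≤ : ∀ bs → countB bs ≤ length bs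
countB-≤ []           = z≤n
countB-≤ (true ∷ bs)  = s≤s (countB-≤ bs)
countB-≤ (false ∷ bs) = m≤n⇒m≤1+n (countB-≤ bs)

cycC-≤ : ∀ n w → cycC n w ≤ n
cycC-≤ n w = ≤-trans (countB-≤ (map (minC n w) (upTo n))) (≤-reflexive (trans (length-map (minC n w) (upTo n)) (length-upTo n)))

Σ<-pick : ∀ n a (f : ℕ → ℕ) → a < n → Σ< n (λ k → ⟦ a ≡ᵇ k ⟧ * f k) ≡ f a
Σ<-pick (suc n) a f (s≤s a≤n) with m≤n⇒m<n∨m≡n a≤n
... | inj₁ a<n  = trans (cong₂ _+_ (Σ<-pick n a f a<n) (cong (λ z → ⟦ z ⟧ * f n) (≢⇒≡ᵇ-false a n (<⇒≢ a<n)))) (+-identityʳ _)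
... | inj₂ refl = cong₂ _+_
  (trans (Σ<-cong n (λ k k<n → cong (λ z → ⟦ z ⟧ * f k) (≢⇒≡ᵇ-false n k (<⇒≢ k<n ∘ sym)))) (Σ<-zero n))
  (trans (cong (λ z → ⟦ z ⟧ * f n) (≡ᵇ-refl n)) (+-identityʳ (f n)))

d-sum : ∀ n k → d n k ≡ ΣS n (λ w → ⟦ allOdd 0 n w ⟧ * ⟦ cycC n w ≡ᵇ k ⟧)
d-sum n k = begin
  d n k
    ≡⟨ trans (length-ΣL (filterᵇ p (Perms n))) (ΣL-filterᵇ p (Perms n) (λ _ → 1)) ⟩
  ΣL (Perms n) (λ v → ⟦ p v ⟧ * 1)
    ≡⟨ ΣL-cong (Perms n) (λ v → trans (*-identityʳ _) (trans (cong₂ (λ o c → ⟦ o ∧ (c ≡ᵇ k) ⟧) (allCyclesOdd≡ v) (cyc≡ v)) (⟦∧⟧ (allOdd 0 n (word v)) _))) ⟩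
  ΣL (Perms n) (λ v → ⟦ allOdd 0 n (word v) ⟧ * ⟦ cycC n (word v) ≡ᵇ k ⟧)
    ≡⟨ ΣL-Perms n (λ w → ⟦ allOdd 0 n w ⟧ * ⟦ cycC n w ≡ᵇ k ⟧) ⟩
  ΣS n (λ w → ⟦ allOdd 0 n w ⟧ * ⟦ cycC n w ≡ᵇ k ⟧) ∎
  where
  p : Vec (Fin n) n → Bool
  p v = allCyclesOdd v ∧ (cyc v ≡ᵇ k)

d-polynomial : ∀ n y → Σ< (suc n) (λ k → y ^ k * d n k) ≡ cycleSum 0 y n
d-polynomial n y = begin
  Σ< (suc n) (λ k → y ^ k * d n k)
    ≡⟨ Σ<-cong′ (suc n) (λ k → trans (cong (y ^ k *_) (d-sum n k)) (sym (ΣA-* n (upTo n) (y ^ k) (λ w → ⟦ allOdd 0 n w ⟧ * ⟦ cycC n w ≡ᵇ k ⟧)))) ⟩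
  Σ< (suc n) (λ k → ΣS n (λ w → y ^ k * (⟦ allOdd 0 n w ⟧ * ⟦ cycC n w ≡ᵇ k ⟧)))
    ≡⟨ sym (ΣA-Σ< n (upTo n) (suc n) (λ w k → y ^ k * (⟦ allOdd 0 n w ⟧ * ⟦ cycC n w ≡ᵇ k ⟧))) ⟩
  ΣS n (λ w → Σ< (suc n) (λ k → y ^ k * (⟦ allOdd 0 n w ⟧ * ⟦ cycC n w ≡ᵇ k ⟧)))
    ≡⟨ ΣA-cong′ n (upTo n) pick ⟩
  ΣS n (λ w → ⟦ allOdd 0 n w ⟧ * y ^ cycC n w) ∎
  where
  open ℕS using (solve; _:*_; _:=_)
  pick : ∀ w → Σ< (suc n) (λ k → y ^ k * (⟦ allOdd 0 n w ⟧ * ⟦ cycC n w ≡ᵇ k ⟧)) ≡ ⟦ allOdd 0 n w ⟧ * y ^ cycC n w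
  pick w = trans (Σ<-cong′ (suc n) (λ k → solve 3 (λ a b c → a :* (b :* c) := b :* (c :* a)) refl (y ^ k) ⟦ allOdd 0 n w ⟧ ⟦ cycC n w ≡ᵇ k ⟧))
    (trans (Σ<-* (suc n) ⟦ allOdd 0 n w ⟧ (λ k → ⟦ cycC n w ≡ᵇ k ⟧ * y ^ k))
      (cong (⟦ allOdd 0 n w ⟧ *_) (Σ<-pick (suc n) (cycC n w) (y ^_) (s≤s (cycC-≤ n w)))))

-- Powers of (1+x)/(1-x) and the same recurrence

R⊛-suc : ∀ g m → (R ⊛ g) (suc m) ≡ (R ⊛ g) m ℚ.+ (g m ℚ.+ g (suc m))
R⊛-suc g m = begin
  h (suc m)                                          ≡⟨ solve 2 (λ a b → a := b :+ (a :+ :- b)) refl (h (suc m)) (h m) ⟩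
  h m ℚ.+ (h (suc m) ℚ.+ ℚ.- h m)                    ≡⟨ cong (h m ℚ.+_) (sym ([1-X]⊛-suc h m)) ⟩
  h m ℚ.+ (1-X ⊛ h) (suc m)                          ≡⟨ cong (h m ℚ.+_) (clear (suc m)) ⟩
  h m ℚ.+ (1+X ⊛ g) (suc m)                          ≡⟨ cong (h m ℚ.+_) ([1+X]⊛-suc g m) ⟩
  h m ℚ.+ (g m ℚ.+ g (suc m))                        ∎
  where
  open ℚS using (solve; _:+_; :-_; _:=_)
  h : S1
  h = R ⊛ g
  clear : 1-X ⊛ h ≗ 1+X ⊛ g
  clear k = trans (⊛-solve 4 (λ a b c e → a ⊙ ((b ⊙ c) ⊙ e) ⊜ (a ⊙ c) ⊙ (b ⊙ e)) (λ _ → refl) 1-X 1+X 1/[1-X] g k)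
    (trans (⊛-congʳ (1+X ⊛ g) (⊛-inverseʳ 1-X refl) k) (⊛-identityˡ (1+X ⊛ g) k))

ℚ2 : ℚ
ℚ2 = ℕ→ℚ 2

ℕ→ℚ-suc : ∀ n → ℕ→ℚ (suc n) ≡ 1ℚ ℚ.+ ℕ→ℚ n
ℕ→ℚ-suc n = ℕ→ℚ-+ 1 n

R^-one : ∀ m → (R ^₁ m) 1 ≡ ℚ2 ℚ.* ℕ→ℚ m
R^-one zero    = sym (ℚP.*-zeroʳ ℚ2)
R^-one (suc m) = begin
  (R ^₁ suc m) 1
    ≡⟨ R⊛-suc (R ^₁ m) 0 ⟩
  (R ^₁ suc m) 0 ℚ.+ ((R ^₁ m) 0 ℚ.+ (R ^₁ m) 1)
    ≡⟨ cong₂ ℚ._+_ (R^-zero (suc m)) (cong₂ ℚ._+_ (R^-zero m) (R^-one m)) ⟩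
  1ℚ ℚ.+ (1ℚ ℚ.+ ℚ2 ℚ.* ℕ→ℚ m)
    ≡⟨ solve 1 (λ x → con 1ℚ :+ (con 1ℚ :+ con ℚ2 :* x) := con ℚ2 :* (con 1ℚ :+ x)) refl (ℕ→ℚ m) ⟩
  ℚ2 ℚ.* (1ℚ ℚ.+ ℕ→ℚ m)
    ≡⟨ cong (ℚ2 ℚ.*_) (sym (ℕ→ℚ-suc m)) ⟩
  ℚ2 ℚ.* ℕ→ℚ (suc m) ∎
  where open ℚS using (solve; _:+_; _:*_; _:=_; con)

-- Comes from the differential equation (1 - x²) f′ = 2m f of f = ((1+x)/(1-x))^m.
R^-recurrence : ∀ m n → (1ℚ ℚ.+ (1ℚ ℚ.+ ℕ→ℚ n)) ℚ.* (R ^₁ m) (suc (suc n)) ≡ ℚ2 ℚ.* ℕ→ℚ m ℚ.* (R ^₁ m) (suc n) ℚ.+ ℕ→ℚ n ℚ.* (R ^₁ m) n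
R^-recurrence zero n = begin
  (1ℚ ℚ.+ (1ℚ ℚ.+ ℕ→ℚ n)) ℚ.* 0ℚ                       ≡⟨ ℚP.*-zeroʳ (1ℚ ℚ.+ (1ℚ ℚ.+ ℕ→ℚ n)) ⟩
  0ℚ                                                   ≡⟨ sym (cong₂ ℚ._+_ (ℚP.*-zeroʳ (ℚ2 ℚ.* ℕ→ℚ 0)) (n*one n)) ⟩
  ℚ2 ℚ.* ℕ→ℚ 0 ℚ.* 0ℚ ℚ.+ ℕ→ℚ n ℚ.* one n              ∎
  where
  n*one : ∀ n → ℕ→ℚ n ℚ.* one n ≡ 0ℚ
  n*one zero    = ℚP.*-zeroˡ 1ℚ
  n*one (suc n) = ℚP.*-zeroʳ (ℕ→ℚ (suc n))
R^-recurrence (suc m) zero = begin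
  ℚ2′ ℚ.* N 2
    ≡⟨ cong (ℚ2′ ℚ.*_) (R⊛-suc (R ^₁ m) 1) ⟩
  ℚ2′ ℚ.* (N 1 ℚ.+ (M 1 ℚ.+ M 2))
    ≡⟨ solve 4 (λ t a b c → t :* (a :+ (b :+ c)) := t :* a :+ (t :* b :+ t :* c)) refl ℚ2′ (N 1) (M 1) (M 2) ⟩
  ℚ2′ ℚ.* N 1 ℚ.+ (ℚ2′ ℚ.* M 1 ℚ.+ ℚ2′ ℚ.* M 2)
    ≡⟨ cong (λ z → ℚ2′ ℚ.* N 1 ℚ.+ (ℚ2′ ℚ.* M 1 ℚ.+ z)) (R^-recurrence m 0) ⟩
  ℚ2′ ℚ.* N 1 ℚ.+ (ℚ2′ ℚ.* M 1 ℚ.+ (ℚ2 ℚ.* ℕ→ℚ m ℚ.* M 1 ℚ.+ ℕ→ℚ 0 ℚ.* M 0))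
    ≡⟨ cong₂ (λ a b → ℚ2′ ℚ.* b ℚ.+ (ℚ2′ ℚ.* a ℚ.+ (ℚ2 ℚ.* ℕ→ℚ m ℚ.* a ℚ.+ ℕ→ℚ 0 ℚ.* M 0))) (R^-one m) (trans (R^-one (suc m)) (cong (ℚ2 ℚ.*_) (ℕ→ℚ-suc m))) ⟩
  ℚ2′ ℚ.* (ℚ2 ℚ.* (1ℚ ℚ.+ ℕ→ℚ m)) ℚ.+ (ℚ2′ ℚ.* (ℚ2 ℚ.* ℕ→ℚ m) ℚ.+ (ℚ2 ℚ.* ℕ→ℚ m ℚ.* (ℚ2 ℚ.* ℕ→ℚ m) ℚ.+ ℕ→ℚ 0 ℚ.* M 0))
    ≡⟨ solve 3 (λ x u v → con ℚ2′ :* (con ℚ2 :* (con 1ℚ :+ x)) :+ (con ℚ2′ :* (con ℚ2 :* x) :+ (con ℚ2 :* x :* (con ℚ2 :* x) :+ con 0ℚ :* u))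
                := con ℚ2 :* (con 1ℚ :+ x) :* (con ℚ2 :* (con 1ℚ :+ x)) :+ con 0ℚ :* v) refl (ℕ→ℚ m) (M 0) (N 0) ⟩
  ℚ2 ℚ.* (1ℚ ℚ.+ ℕ→ℚ m) ℚ.* (ℚ2 ℚ.* (1ℚ ℚ.+ ℕ→ℚ m)) ℚ.+ ℕ→ℚ 0 ℚ.* N 0
    ≡⟨ cong (λ z → ℚ2 ℚ.* z ℚ.* (ℚ2 ℚ.* z) ℚ.+ ℕ→ℚ 0 ℚ.* N 0) (sym (ℕ→ℚ-suc m)) ⟩
  ℚ2 ℚ.* ℕ→ℚ (suc m) ℚ.* (ℚ2 ℚ.* ℕ→ℚ (suc m)) ℚ.+ ℕ→ℚ 0 ℚ.* N 0
    ≡⟨ cong (λ z → ℚ2 ℚ.* ℕ→ℚ (suc m) ℚ.* z ℚ.+ ℕ→ℚ 0 ℚ.* N 0) (sym (R^-one (suc m))) ⟩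
  ℚ2 ℚ.* ℕ→ℚ (suc m) ℚ.* N 1 ℚ.+ ℕ→ℚ 0 ℚ.* N 0 ∎
  where
  open ℚS using (solve; _:+_; _:*_; _:=_; con)
  ℚ2′ : ℚ
  ℚ2′ = 1ℚ ℚ.+ (1ℚ ℚ.+ ℕ→ℚ 0)
  M N : S1
  M = R ^₁ m
  N = R ^₁ suc m
R^-recurrence (suc m) (suc n) = begin
  (1ℚ ℚ.+ (1ℚ ℚ.+ ℕ→ℚ (suc n))) ℚ.* N (suc (suc (suc n)))
    ≡⟨ cong₂ (λ z w → (1ℚ ℚ.+ (1ℚ ℚ.+ z)) ℚ.* w) (ℕ→ℚ-suc n) (R⊛-suc M (suc (suc n))) ⟩
  (1ℚ ℚ.+ (1ℚ ℚ.+ (1ℚ ℚ.+ ν))) ℚ.* (N2 ℚ.+ (M2 ℚ.+ M3))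
    -- The factor n+3 is split as (n+2)+1 in front of `N2` and `M2`, so that the recurrence applies
    -- to N at n and to M at both n and n+1.
    ≡⟨ solve 4 (λ v x a b → (con 1ℚ :+ (con 1ℚ :+ (con 1ℚ :+ v))) :* (x :+ (a :+ b)) :=
                 ((con 1ℚ :+ (con 1ℚ :+ v)) :* x :+ x) :+ (((con 1ℚ :+ (con 1ℚ :+ v)) :* a :+ a) :+ (con 1ℚ :+ (con 1ℚ :+ (con 1ℚ :+ v))) :* b)) refl ν N2 M2 M3 ⟩
  ((1ℚ ℚ.+ (1ℚ ℚ.+ ν)) ℚ.* N2 ℚ.+ N2) ℚ.+ (((1ℚ ℚ.+ (1ℚ ℚ.+ ν)) ℚ.* M2 ℚ.+ M2) ℚ.+ (1ℚ ℚ.+ (1ℚ ℚ.+ (1ℚ ℚ.+ ν))) ℚ.* M3)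
    ≡⟨ cong₂ ℚ._+_ (cong (ℚ._+ N2) (R^-recurrence (suc m) n))
         (cong₂ ℚ._+_ (cong (ℚ._+ M2) (R^-recurrence m n)) (subst (λ z → (1ℚ ℚ.+ (1ℚ ℚ.+ z)) ℚ.* M3 ≡ ℚ2 ℚ.* μ ℚ.* M2 ℚ.+ z ℚ.* M1) (ℕ→ℚ-suc n) (R^-recurrence m (suc n)))) ⟩
  ((ℚ2 ℚ.* ℕ→ℚ (suc m) ℚ.* N1 ℚ.+ ν ℚ.* N0) ℚ.+ N2) ℚ.+ (((ℚ2 ℚ.* μ ℚ.* M1 ℚ.+ ν ℚ.* M0) ℚ.+ M2) ℚ.+ (ℚ2 ℚ.* μ ℚ.* M2 ℚ.+ (1ℚ ℚ.+ ν) ℚ.* M1))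
    ≡⟨ cong₂ (λ z w → ((ℚ2 ℚ.* z ℚ.* N1 ℚ.+ ν ℚ.* N0) ℚ.+ w) ℚ.+ (((ℚ2 ℚ.* μ ℚ.* M1 ℚ.+ ν ℚ.* M0) ℚ.+ M2) ℚ.+ (ℚ2 ℚ.* μ ℚ.* M2 ℚ.+ (1ℚ ℚ.+ ν) ℚ.* M1)))
         (ℕ→ℚ-suc m) (R⊛-suc M (suc n)) ⟩
  ((ℚ2 ℚ.* (1ℚ ℚ.+ μ) ℚ.* N1 ℚ.+ ν ℚ.* N0) ℚ.+ (N1 ℚ.+ (M1 ℚ.+ M2))) ℚ.+ (((ℚ2 ℚ.* μ ℚ.* M1 ℚ.+ ν ℚ.* M0) ℚ.+ M2) ℚ.+ (ℚ2 ℚ.* μ ℚ.* M2 ℚ.+ (1ℚ ℚ.+ ν) ℚ.* M1))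
    ≡⟨ cong (λ z → ((ℚ2 ℚ.* (1ℚ ℚ.+ μ) ℚ.* z ℚ.+ ν ℚ.* N0) ℚ.+ (z ℚ.+ (M1 ℚ.+ M2))) ℚ.+ (((ℚ2 ℚ.* μ ℚ.* M1 ℚ.+ ν ℚ.* M0) ℚ.+ M2) ℚ.+ (ℚ2 ℚ.* μ ℚ.* M2 ℚ.+ (1ℚ ℚ.+ ν) ℚ.* M1)))
         (R⊛-suc M n) ⟩
  ((ℚ2 ℚ.* (1ℚ ℚ.+ μ) ℚ.* (N0 ℚ.+ (M0 ℚ.+ M1)) ℚ.+ ν ℚ.* N0) ℚ.+ ((N0 ℚ.+ (M0 ℚ.+ M1)) ℚ.+ (M1 ℚ.+ M2))) ℚ.+ (((ℚ2 ℚ.* μ ℚ.* M1 ℚ.+ ν ℚ.* M0) ℚ.+ M2) ℚ.+ (ℚ2 ℚ.* μ ℚ.* M2 ℚ.+ (1ℚ ℚ.+ ν) ℚ.* M1))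
    ≡⟨ solve 6 (λ u v x a b c →
         ((con ℚ2 :* (con 1ℚ :+ u) :* (x :+ (a :+ b)) :+ v :* x) :+ ((x :+ (a :+ b)) :+ (b :+ c))) :+ (((con ℚ2 :* u :* b :+ v :* a) :+ c) :+ (con ℚ2 :* u :* c :+ (con 1ℚ :+ v) :* b))
         := con ℚ2 :* (con 1ℚ :+ u) :* ((x :+ (a :+ b)) :+ (b :+ c)) :+ (con 1ℚ :+ v) :* (x :+ (a :+ b))) refl μ ν N0 M0 M1 M2 ⟩
  ℚ2 ℚ.* (1ℚ ℚ.+ μ) ℚ.* ((N0 ℚ.+ (M0 ℚ.+ M1)) ℚ.+ (M1 ℚ.+ M2)) ℚ.+ (1ℚ ℚ.+ ν) ℚ.* (N0 ℚ.+ (M0 ℚ.+ M1))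
    ≡⟨ cong (λ z → ℚ2 ℚ.* (1ℚ ℚ.+ μ) ℚ.* (z ℚ.+ (M1 ℚ.+ M2)) ℚ.+ (1ℚ ℚ.+ ν) ℚ.* z) (sym (R⊛-suc M n)) ⟩
  ℚ2 ℚ.* (1ℚ ℚ.+ μ) ℚ.* (N1 ℚ.+ (M1 ℚ.+ M2)) ℚ.+ (1ℚ ℚ.+ ν) ℚ.* N1
    ≡⟨ cong₂ (λ z w → ℚ2 ℚ.* z ℚ.* w ℚ.+ (1ℚ ℚ.+ ν) ℚ.* N1) (sym (ℕ→ℚ-suc m)) (sym (R⊛-suc M (suc n))) ⟩
  ℚ2 ℚ.* ℕ→ℚ (suc m) ℚ.* N2 ℚ.+ (1ℚ ℚ.+ ν) ℚ.* N1
    ≡⟨ cong (λ z → ℚ2 ℚ.* ℕ→ℚ (suc m) ℚ.* N2 ℚ.+ z ℚ.* N1) (sym (ℕ→ℚ-suc n)) ⟩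
  ℚ2 ℚ.* ℕ→ℚ (suc m) ℚ.* N2 ℚ.+ ℕ→ℚ (suc n) ℚ.* N1 ∎
  where
  open ℚS using (solve; _:+_; _:*_; _:=_; con)
  M N : S1
  M = R ^₁ m
  N = R ^₁ suc m
  ν μ M0 M1 M2 M3 N0 N1 N2 : ℚ
  ν = ℕ→ℚ n
  μ = ℕ→ℚ m
  M0 = M n
  M1 = M (suc n)
  M2 = M (suc (suc n))
  M3 = M (suc (suc (suc n)))
  N0 = N n
  N1 = N (suc n)
  N2 = N (suc (suc n))

-- Both sides obey D(n+2) = 2m D(n+1) + (n+1) n D(n) with D(0) = 1 and D(1) = 2m.
R^-cycleSum : ∀ m n → ℕ→ℚ (n !) ℚ.* (R ^₁ m) n ≡ ℕ→ℚ (cycleSum 0 (2 * m) n)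
R^-cycleSum m zero          = trans (ℚP.*-identityˡ _) (R^-zero m)
R^-cycleSum m (suc zero)    = trans (ℚP.*-identityˡ _) (trans (R^-one m) (trans (sym (ℕ→ℚ-* 2 m))
  (cong ℕ→ℚ (sym (trans (cycleSum-suc 0 (2 * m) 0) (trans (+-identityʳ _) (trans (+-identityʳ _) (*-identityʳ (2 * m)))))))))
R^-cycleSum m (suc (suc n)) = begin
  ℕ→ℚ (suc (suc n) !) ℚ.* M (suc (suc n))
    ≡⟨ cong (ℚ._* M (suc (suc n))) (trans (ℕ→ℚ-* (suc (suc n)) (suc n !)) (cong₂ ℚ._*_ (trans (ℕ→ℚ-suc (suc n)) (cong (1ℚ ℚ.+_) (ℕ→ℚ-suc n))) refl)) ⟩
  (1ℚ ℚ.+ (1ℚ ℚ.+ ν)) ℚ.* ℕ→ℚ (suc n !) ℚ.* M (suc (suc n))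
    ≡⟨ solve 3 (λ a b c → a :* b :* c := b :* (a :* c)) refl (1ℚ ℚ.+ (1ℚ ℚ.+ ν)) (ℕ→ℚ (suc n !)) (M (suc (suc n))) ⟩
  ℕ→ℚ (suc n !) ℚ.* ((1ℚ ℚ.+ (1ℚ ℚ.+ ν)) ℚ.* M (suc (suc n)))
    ≡⟨ cong (ℕ→ℚ (suc n !) ℚ.*_) (R^-recurrence m n) ⟩
  ℕ→ℚ (suc n !) ℚ.* (ℚ2 ℚ.* ℕ→ℚ m ℚ.* M (suc n) ℚ.+ ν ℚ.* M n)
    ≡⟨ solve 5 (λ a t b v c → a :* (t :* b :+ v :* c) := t :* (a :* b) :+ a :* (v :* c)) refl (ℕ→ℚ (suc n !)) (ℚ2 ℚ.* ℕ→ℚ m) (M (suc n)) ν (M n) ⟩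
  ℚ2 ℚ.* ℕ→ℚ m ℚ.* (ℕ→ℚ (suc n !) ℚ.* M (suc n)) ℚ.+ ℕ→ℚ (suc n !) ℚ.* (ν ℚ.* M n)
    ≡⟨ cong₂ (λ x y → ℚ2 ℚ.* ℕ→ℚ m ℚ.* x ℚ.+ y ℚ.* (ν ℚ.* M n)) (R^-cycleSum m (suc n)) (ℕ→ℚ-* (suc n) (n !)) ⟩
  ℚ2 ℚ.* ℕ→ℚ m ℚ.* ℕ→ℚ (D (suc n)) ℚ.+ ℕ→ℚ (suc n) ℚ.* ℕ→ℚ (n !) ℚ.* (ν ℚ.* M n)
    ≡⟨ cong (ℚ2 ℚ.* ℕ→ℚ m ℚ.* ℕ→ℚ (D (suc n)) ℚ.+_) (solve 4 (λ a b v c → a :* b :* (v :* c) := a :* (v :* (b :* c))) refl (ℕ→ℚ (suc n)) (ℕ→ℚ (n !)) ν (M n)) ⟩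
  ℚ2 ℚ.* ℕ→ℚ m ℚ.* ℕ→ℚ (D (suc n)) ℚ.+ ℕ→ℚ (suc n) ℚ.* (ν ℚ.* (ℕ→ℚ (n !) ℚ.* M n))
    ≡⟨ cong₂ (λ x y → x ℚ.* ℕ→ℚ (D (suc n)) ℚ.+ ℕ→ℚ (suc n) ℚ.* (ν ℚ.* y)) (sym (ℕ→ℚ-* 2 m)) (R^-cycleSum m n) ⟩
  ℕ→ℚ (2 * m) ℚ.* ℕ→ℚ (D (suc n)) ℚ.+ ℕ→ℚ (suc n) ℚ.* (ν ℚ.* ℕ→ℚ (D n))
    ≡⟨ cong₂ ℚ._+_ (sym (ℕ→ℚ-* (2 * m) (D (suc n)))) (trans (cong (ℕ→ℚ (suc n) ℚ.*_) (sym (ℕ→ℚ-* n (D n)))) (sym (ℕ→ℚ-* (suc n) (n * D n)))) ⟩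
  ℕ→ℚ (2 * m * D (suc n)) ℚ.+ ℕ→ℚ (suc n * (n * D n))
    ≡⟨ sym (ℕ→ℚ-+ (2 * m * D (suc n)) (suc n * (n * D n))) ⟩
  ℕ→ℚ (2 * m * D (suc n) + suc n * (n * D n))
    ≡⟨ cong ℕ→ℚ (sym (cycleSum-recurrence (2 * m) n)) ⟩
  ℕ→ℚ (D (suc (suc n))) ∎
  where
  open ℚS using (solve; _:+_; _:*_; _:=_)
  M : S1
  M = R ^₁ m
  ν : ℚ
  ν = ℕ→ℚ n
  D : ℕ → ℕ
  D = cycleSum 0 (2 * m)

-- Part (c): Eulerian series weighted by the numbers of odd-cycle permutations

Σ₂-coeff : {B : Set} (h : B → S2) (xs : List B) → ∀ i j → Σ₂ (map h xs) i j ≡ sumℚ (map (λ x → h x i j) xs)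
Σ₂-coeff h []       zero    j = ℚP.*-zeroˡ (c1 1ℚ j)
Σ₂-coeff h []       (suc i) j = ℚP.*-zeroˡ (c1 1ℚ j)
Σ₂-coeff h (x ∷ xs) i       j = cong (h x i j ℚ.+_) (Σ₂-coeff h xs i j)

ΣL-applyUpTo : ∀ n (g f : ℕ → ℕ) → ΣL (applyUpTo g n) f ≡ Σ< n (f ∘ g)
ΣL-applyUpTo zero    g f = refl
ΣL-applyUpTo (suc n) g f = trans (cong (f (g 0) +_) (ΣL-applyUpTo n (g ∘ suc) f)) (sym (Σ<-cons n (f ∘ g)))

^-distribʳ-* : ∀ k a b → (a * b) ^ k ≡ a ^ k * b ^ k
^-distribʳ-* zero    a b = refl
^-distribʳ-* (suc k) a b = trans (cong (a * b *_) (^-distribʳ-* k a b))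
  (solve 4 (λ x y u v → x :* y :* (u :* v) := x :* u :* (y :* v)) refl a b (a ^ k) (b ^ k))
  where open ℕS using (solve; _:*_; _:=_)

-- The two Eulerian series contribute i^k and j^k, and 4^k i^k j^k = y^k for y = 4ij. The sum over k
-- is therefore 4 times the cycle polynomial at y, which is n! [x^n] R^(2ij) by `R^-cycleSum`.
RHSc-closed : ∀ n i j → RHSc n i j ≡ four ℚ.* (R ^₁ (2 * i * j)) n
RHSc-closed n i j = begin
  1/n! ℚ.* Σ₂ (map term (upTo (suc n))) i j
    ≡⟨ cong (1/n! ℚ.*_) (Σ₂-coeff term (upTo (suc n)) i j) ⟩
  1/n! ℚ.* sumℚ (map (λ k → term k i j) (upTo (suc n)))
    ≡⟨ cong (1/n! ℚ.*_) (sumℚ-cong (upTo (suc n)) natural) ⟩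
  1/n! ℚ.* sumℚ (map (λ k → ℕ→ℚ (4 * (y ^ k * d n k))) (upTo (suc n)))
    ≡⟨ cong (1/n! ℚ.*_) (trans (sumℚ-ℕ→ℚ (λ k → 4 * (y ^ k * d n k)) (upTo (suc n)))
         (cong ℕ→ℚ (trans (ΣL-applyUpTo (suc n) id (λ k → 4 * (y ^ k * d n k))) (trans (Σ<-* (suc n) 4 (λ k → y ^ k * d n k)) (cong (4 *_) (d-polynomial n y)))))) ⟩
  1/n! ℚ.* ℕ→ℚ (4 * cycleSum 0 y n)
    ≡⟨ cong (1/n! ℚ.*_) (trans (ℕ→ℚ-* 4 (cycleSum 0 y n)) (cong (four ℚ.*_) (sym (R^-cycleSum (2 * i * j) n)))) ⟩
  1/n! ℚ.* (four ℚ.* (ℕ→ℚ (n !) ℚ.* (R ^₁ (2 * i * j)) n))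
    ≡⟨ ℚS.solve 4 (λ a f b c → a ℚS.:* (f ℚS.:* (b ℚS.:* c)) ℚS.:= (a ℚS.:* b) ℚS.:* (f ℚS.:* c)) refl 1/n! four (ℕ→ℚ (n !)) ((R ^₁ (2 * i * j)) n) ⟩
  (1/n! ℚ.* ℕ→ℚ (n !)) ℚ.* (four ℚ.* (R ^₁ (2 * i * j)) n)
    ≡⟨ cong (ℚ._* (four ℚ.* (R ^₁ (2 * i * j)) n)) (1/n*n≡1 (n !) {{n !≢0}}) ⟩
  1ℚ ℚ.* (four ℚ.* (R ^₁ (2 * i * j)) n)
    ≡⟨ ℚP.*-identityˡ _ ⟩
  four ℚ.* (R ^₁ (2 * i * j)) n ∎
  where
  1/n! : ℚ
  1/n! = (pos 1 ℚ./ (n !)) {{n !≢0}}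
  y : ℕ
  y = 2 * (2 * i * j)
  term : ℕ → S2
  term k = ℕ→ℚ ((4 ^ suc k) * d n k) ·₂ ((A k ⊛ inv ((one ⊖ X) ^₁ suc k)) ⊗ (A k ⊛ inv ((one ⊖ X) ^₁ suc k)))
  y^ : ∀ k → y ^ k ≡ 4 ^ k * (i ^ k * j ^ k)
  y^ k = trans (cong (_^ k) (ℕS.solve 2 (λ a b → ℕS.con 2 ℕS.:* (ℕS.con 2 ℕS.:* a ℕS.:* b) ℕS.:= ℕS.con 4 ℕS.:* (a ℕS.:* b)) refl i j))
    (trans (^-distribʳ-* k 4 (i * j)) (cong (4 ^ k *_) (^-distribʳ-* k i j)))
  natural : ∀ k → term k i j ≡ ℕ→ℚ (4 * (y ^ k * d n k))
  natural k = begin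
    term k i j
      ≡⟨ cong₂ (λ a b → ℕ→ℚ ((4 ^ suc k) * d n k) ℚ.* (a ℚ.* b)) (eulerian k i) (eulerian k j) ⟩
    ℕ→ℚ ((4 ^ suc k) * d n k) ℚ.* (ℕ→ℚ (i ^ k) ℚ.* ℕ→ℚ (j ^ k))
      ≡⟨ trans (cong (ℕ→ℚ ((4 ^ suc k) * d n k) ℚ.*_) (sym (ℕ→ℚ-* (i ^ k) (j ^ k)))) (sym (ℕ→ℚ-* ((4 ^ suc k) * d n k) (i ^ k * j ^ k))) ⟩
    ℕ→ℚ ((4 ^ suc k) * d n k * (i ^ k * j ^ k))
      ≡⟨ cong ℕ→ℚ (trans (ℕS.solve 3 (λ p e q → (ℕS.con 4 ℕS.:* p) ℕS.:* e ℕS.:* q ℕS.:= ℕS.con 4 ℕS.:* ((p ℕS.:* q) ℕS.:* e)) refl (4 ^ k) (d n k) (i ^ k * j ^ k))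
           (cong (λ z → 4 * (z * d n k)) (sym (y^ k)))) ⟩
    ℕ→ℚ (4 * (y ^ k * d n k)) ∎

part-c : ∀ n → 1 ≤ n → ∀ i j → F n i j ≡ RHSc n i j
part-c (suc n) _ i j = trans (F-closed n i j) (sym (RHSc-closed (suc n) i j))

theorem3p2 : ((n i j : ℕ) → LHSa n i j ≡ RHSa n i j)
    × ((n : ℕ) → 1 ≤ n → (i j : ℕ) → F n i j ≡ RHSb n i j)
    × ((n : ℕ) → 1 ≤ n → (i j : ℕ) → F n i j ≡ RHSc n i j)
theorem3p2 = part-a , part-b , part-c
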